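{- Graph Isomorphism is polynomial-time solvable on $(\overline{2P_1+P_3},P_5)$-free graphs.
   Context: All graphs are finite, undirected, without multiple edges or self-loops. A graph is $(H_1,H_2)$-free if it has no induced subgraph isomorphic to $H_1$ or $H_2$. $P_r$ denotes the path on $r$ vertices, $G+H$ denotes the disjoint union of $G$ and $H$, $rG$ the disjoint union of $r$ copies of $G$, and $\overline{G}$ the complement of $G$. Graph Isomorphism is the problem of deciding whether two given graphs are isomorphic. -}

module Defs where

open import Data.Nat using (ℕ; zero; suc; _+_; _*_; _^_; _≡ᵇ_)
open import Data.Fin using (Fin; zero; suc; toℕ; splitAt; _≟_)
open import Data.Bool using (Bool; true; false; not; _∨_; if_then_else_)
open import Data.Bool.Properties using (∨-comm)
open import Data.List using (List; []; _∷_; _++_; length; replicate; concatMap; allFin; map)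
open import Data.Sum using (_⊎_; inj₁; inj₂)
open import Data.Product using (Σ; _×_; _,_)
open import Data.Maybe using (Maybe; just; nothing)
open import Function.Bundles using (_↔_; Inverse)
open import Function.Definitions using (Injective)
open import Relation.Binary.PropositionalEquality using (_≡_; refl; sym; cong)
open import Relation.Nullary using (¬_; yes; no)

record Graph : Set where
  field
    size  : ℕ
    adj   : Fin size → Fin size → Bool
    adj-sym     : ∀ i j → adj i j ≡ adj j i
    adj-irrefl  : ∀ i → adj i i ≡ false
open Graph public

Iso : Graph → Graph → Set
Iso G H = Σ (Fin (size G) ↔ Fin (size H)) λ φ →
  ∀ i j → adj H (Inverse.to φ i) (Inverse.to φ j) ≡ adj G i j

InducedSub : Graph → Graph → Set
InducedSub H G = Σ (Fin (size H) → Fin (size G)) λ f →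
  Injective _≡_ _≡_ f × (∀ i j → adj G (f i) (f j) ≡ adj H i j)

Free₂ : Graph → Graph → Graph → Set
Free₂ H₁ H₂ G = ¬ InducedSub H₁ G × ¬ InducedSub H₂ G

private
  suc≢ᵇ : ∀ n → (suc n ≡ᵇ n) ≡ false
  suc≢ᵇ zero = refl
  suc≢ᵇ (suc n) = suc≢ᵇ n

P : ℕ → Graph
P r = record
  { size = r
  ; adj = λ i j → (suc (toℕ i) ≡ᵇ toℕ j) ∨ (suc (toℕ j) ≡ᵇ toℕ i)
  ; adj-sym = λ i j → ∨-comm (suc (toℕ i) ≡ᵇ toℕ j) (suc (toℕ j) ≡ᵇ toℕ i)
  ; adj-irrefl = λ i → irr i
  }
  where
  irr : ∀ {r} (i : Fin r) → ((suc (toℕ i) ≡ᵇ toℕ i) ∨ (suc (toℕ i) ≡ᵇ toℕ i)) ≡ false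
  irr i rewrite suc≢ᵇ (toℕ i) = refl

_⊕_ : Graph → Graph → Graph
G ⊕ H = record
  { size = size G + size H
  ; adj = λ i j → a (splitAt (size G) i) (splitAt (size G) j)
  ; adj-sym = λ i j → s (splitAt (size G) i) (splitAt (size G) j)
  ; adj-irrefl = λ i → ir (splitAt (size G) i)
  }
  where
  a : Fin (size G) ⊎ Fin (size H) → Fin (size G) ⊎ Fin (size H) → Bool
  a (inj₁ x) (inj₁ y) = adj G x y
  a (inj₂ x) (inj₂ y) = adj H x y
  a (inj₁ _) (inj₂ _) = false
  a (inj₂ _) (inj₁ _) = false
  s : ∀ x y → a x y ≡ a y x
  s (inj₁ x) (inj₁ y) = adj-sym G x y
  s (inj₂ x) (inj₂ y) = adj-sym H x y
  s (inj₁ _) (inj₂ _) = refl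
  s (inj₂ _) (inj₁ _) = refl
  ir : ∀ x → a x x ≡ false
  ir (inj₁ x) = adj-irrefl G x
  ir (inj₂ x) = adj-irrefl H x

co : Graph → Graph
co G = record
  { size = size G
  ; adj = a
  ; adj-sym = s
  ; adj-irrefl = ir
  }
  where
  a : Fin (size G) → Fin (size G) → Bool
  a i j with i ≟ j
  ... | yes _ = false
  ... | no _ = not (adj G i j)
  s : ∀ i j → a i j ≡ a j i
  s i j with i ≟ j | j ≟ i
  ... | yes _ | yes _ = refl
  ... | yes p | no q = Data.Empty.⊥-elim (q (sym p))
    where import Data.Empty
  ... | no q | yes p = Data.Empty.⊥-elim (q (sym p))
    where import Data.Empty
  ... | no _ | no _ = cong not (adj-sym G i j)
  ir : ∀ i → a i i ≡ false
  ir i with i ≟ i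
  ... | yes _ = refl
  ... | no q = Data.Empty.⊥-elim (q refl)
    where import Data.Empty

-- Encoding of graphs as bit strings (adjacency-matrix encoding):
-- n in unary (n ones followed by a zero), then the n×n adjacency
-- matrix row by row.  This encoding is self-delimiting.

encode : Graph → List Bool
encode G = replicate (size G) true ++ (false ∷
  concatMap (λ i → map (λ j → adj G i j) (allFin (size G))) (allFin (size G)))

data Move : Set where
  L R S : Move

-- tape alphabet Fin (3 + extra): 0 = blank, 1 = bit 0, 2 = bit 1, rest extra
Sym : ℕ → Set
Sym k = Fin (3 + k)

blank : ∀ {k} → Sym k
blank = zero

bitSym : ∀ {k} → Bool → Sym k
bitSym false = suc zero
bitSym true  = suc (suc zero)

-- states Fin (suc Q), start state zero; a transition either halts with
-- an answer (inj₁ b) or goes to a new state, writes a symbol and moves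
record TM : Set where
  field
    Q     : ℕ
    extra : ℕ
    δ     : Fin (suc Q) → Sym extra →
            Bool ⊎ (Fin (suc Q) × Sym extra × Move)

record Config (M : TM) : Set where
  constructor cfg
  field
    state : Fin (suc (TM.Q M))
    left  : List (Sym (TM.extra M))   -- cells left of the head, nearest first
    cur   : Sym (TM.extra M)
    right : List (Sym (TM.extra M))   -- cells right of the head, nearest first

initConfig : (M : TM) → List Bool → Config M
initConfig M [] = cfg zero [] blank []
initConfig M (b ∷ bs) = cfg zero [] (bitSym b) (map bitSym bs)

step : (M : TM) → Config M → Bool ⊎ Config M
step M (cfg q l c r) with TM.δ M q c
... | inj₁ b = inj₁ b
... | inj₂ (q' , w , S) = inj₂ (cfg q' l w r)
... | inj₂ (q' , w , L) with l
...   | [] = inj₂ (cfg q' [] blank (w ∷ r))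
...   | x ∷ l' = inj₂ (cfg q' l' x (w ∷ r))
step M (cfg q l c r) | inj₂ (q' , w , R) with r
...   | [] = inj₂ (cfg q' (w ∷ l) blank [])
...   | x ∷ r' = inj₂ (cfg q' (w ∷ l) x r')

run : (M : TM) → ℕ → Config M → Maybe Bool
run M zero c = nothing
run M (suc t) c with step M c
... | inj₁ b = just b
... | inj₂ c' = run M t c'

HaltsWith : TM → List Bool → ℕ → Bool → Set
HaltsWith M w t b = run M t (initConfig M w) ≡ just b

GI-PolyOn : Graph → Graph → Set
GI-PolyOn H₁ H₂ = Σ TM λ M → Σ ℕ λ c →
  ∀ (G G' : Graph) → Free₂ H₁ H₂ G → Free₂ H₁ H₂ G' →
  let w = encode G ++ encode G' in
  Σ Bool λ b → HaltsWith M w (c * length w ^ c + c) b ×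
               ((b ≡ true → Iso G G') × (Iso G G' → b ≡ true))

-- A graph is F-free, for F the complement of 2P₁ + P₃, when all neighbourhoods are paw-free: F is the join of a vertex and a paw.
--
-- The machine plays a bijective pebble game on the two graphs for a fixed number of rounds. With the positions of the pebbles as
-- variables this is a nest of loops of constant depth, in which a bijection exists as soon as the elements of each type are equally
-- numerous on both sides. So it remains to see that a winning strategy for a constant number of rounds yields an isomorphism.
--
-- A connected P₅-free graph is dominated by two cliques. A 5-clique q extends to a complete multipartite set M, outside of which every
-- vertex has neighbours in at most one part. If three parts have neighbours outside M, then the component falls into blocks, one for each
-- part, and the adjacency of vertices in different blocks depends only on whether they lie in M, next to M or further away. If no
-- 5-clique is of this kind, then large cliques can be replaced by small ones and there is a dominating set of bounded size; since the
-- vertices of a class (those with the same neighbours in the set) can split at most two components of any other class, the set can be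
-- enlarged so that the components of all classes are modules. These components lie in neighbourhoods, so by Olariu's theorem they are
-- triangle-free, and can again be cut into independent classes, or complete multipartite. Between two classes P₅-freeness makes the
-- neighbourhoods a chain, so that the numbers of neighbours determine the adjacency, and isomorphisms of the pieces can be glued.
module Submission where

open import Defs
open import Data.Nat using (ℕ; zero; suc; _+_; _*_; _∸_; _^_; _⊔_; _≤_; _<_; _<?_; _≡ᵇ_; _<ᵇ_; z≤n; s≤s)
import Data.Nat.Properties as ℕₚ
open import Data.Fin as Fin using (Fin; zero; suc; toℕ; fromℕ<; splitAt; _↑ˡ_; _↑ʳ_)
open import Data.Fin.Permutation using (↔⇒≡)
import Data.Fin.Properties as Finₚ
open import Data.Bool as Bool using (Bool; true; false; _∧_; _∨_; not; _xor_; if_then_else_)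
import Data.Bool.Properties as Boolₚ
open import Data.List using (List; []; _∷_; _++_; length; filter; map; concatMap; replicate; allFin; tabulate)
import Data.List.Properties as Listₚ
open import Data.List.Membership.Propositional using (_∈_; find)
import Data.List.Membership.Propositional.Properties as Memₚ
open import Data.List.Relation.Binary.Pointwise using (Pointwise; []; _∷_)
open import Data.List.Relation.Unary.All as All using (All; []; _∷_)
import Data.List.Relation.Unary.All.Properties as Allₚ
open import Data.List.Relation.Unary.AllPairs using (AllPairs; []; _∷_)
import Data.List.Relation.Unary.AllPairs.Properties as APₚ
open import Data.List.Relation.Unary.Any as Any using (Any; here; there)
import Data.List.Relation.Unary.Any.Properties as Anyₚ
open import Data.Maybe using (just)
open import Data.Product using (Σ; _×_; _,_; proj₁; proj₂; ∃)
open import Data.Sum using (_⊎_; inj₁; inj₂; [_,_]′)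
open import Data.Empty using (⊥; ⊥-elim)
open import Data.Unit using (⊤; tt)
open import Data.Vec as Vec using (Vec; []; _∷_)
import Data.Vec.Properties as Vecₚ
open import Relation.Binary using (tri<; tri≈; tri>)
open import Relation.Binary.PropositionalEquality using (_≡_; _≢_; refl; sym; trans; cong; cong₂; subst; subst₂)
open import Relation.Nullary using (¬_; Dec; yes; no; does)
open import Relation.Nullary.Decidable using (_×-dec_; _⊎-dec_; _→-dec_; ¬?; from-yes; map′; dec-true; dec-false)
open import Function using (_∘_; case_of_)
open import Function.Bundles using (mk↔ₛ′; Inverse)

-- Whatever is chosen in the first graph (a dominating set, a frame, refining vertices) has to
-- reappear in the second one. It is carried over by pebbling, so only boundedly many vertices may
-- be chosen, and every vertex set in use must be recognised within a fixed number of rounds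
-- (`Def`). Components qualify because in a `P 5`-free graph walks can be shortened to at most three
-- edges. Cliques of five vertices are used because any three vertices of `M` miss at most three of
-- the five, and the two that remain are the common adjacent pair which the forbidden graph asks
-- for. Gluing has an obstacle of its own: the bijection of the duplicator respects types but may
-- scatter one block over many. `Partial.Glue` exchanges images until the bijection follows the
-- isomorphism of one block, removes this block together with its image and repeats. All that is
-- needed of different blocks is that types determine the adjacency between them.

-- Counting by Boolean predicates, and descent on finite sets.

module Counting where
  bit : Bool → ℕ
  bit true = 1
  bit false = 0

  cnt : ∀ {n} → (Fin n → Bool) → ℕ
  cnt {zero} p = 0
  cnt {suc n} p = bit (p zero) + cnt (p ∘ suc)

  bit-mono : ∀ {a b} → (a ≡ true → b ≡ true) → bit a ≤ bit b
  bit-mono {false} _ = z≤n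
  bit-mono {true} h rewrite h refl = ℕₚ.≤-refl

  cnt-mono : ∀ {n} {p q : Fin n → Bool} → (∀ x → p x ≡ true → q x ≡ true) → cnt p ≤ cnt q
  cnt-mono {zero} h = z≤n
  cnt-mono {suc n} h = ℕₚ.+-mono-≤ (bit-mono (h zero)) (cnt-mono (h ∘ suc))

  cnt-strict : ∀ {n} {p q : Fin n → Bool} → (∀ x → p x ≡ true → q x ≡ true) →
    ∀ x → p x ≡ false → q x ≡ true → cnt p < cnt q
  cnt-strict {suc n} {p} {q} h zero pf qt rewrite pf | qt = s≤s (cnt-mono (h ∘ suc))
  cnt-strict {suc n} {p} {q} h (suc x) pf qt = ℕₚ.+-mono-≤-< (bit-mono (h zero)) (cnt-strict (h ∘ suc) x pf qt)

  cnt-cong : ∀ {n} {p q : Fin n → Bool} → (∀ x → p x ≡ q x) → cnt p ≡ cnt q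
  cnt-cong {zero} h = refl
  cnt-cong {suc n} h = cong₂ (λ a b → bit a + b) (h zero) (cnt-cong (h ∘ suc))

  cnt-pos : ∀ {n} {p : Fin n → Bool} → 0 < cnt p → ∃ λ x → p x ≡ true
  cnt-pos {suc n} {p} h with p zero in e
  ... | true = zero , e
  ... | false with cnt-pos h
  ... | x , q = suc x , q

  cnt-has : ∀ {n} {p : Fin n → Bool} x → p x ≡ true → 0 < cnt p
  cnt-has {suc n} zero e rewrite e = s≤s z≤n
  cnt-has {suc n} {p} (suc x) e = ℕₚ.≤-trans (cnt-has x e) (ℕₚ.m≤n+m _ (bit (p zero)))

  module _ {State : Set} {n : ℕ} (U : State → Fin n → Set) (U? : ∀ s x → Dec (U s x)) (Done : State → Set)
    (improve : ∀ s → Done s ⊎ Σ State λ s' → (∀ x → U s' x → U s x) × Σ (Fin n) λ u → U s u × ¬ U s' u)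
    where

    private
      weight : State → ℕ
      weight s = cnt (λ x → does (U? s x))

      shrink : ∀ s s' → (∀ x → U s' x → U s x) → ∀ u → U s u → ¬ U s' u → weight s' < weight s
      shrink s s' sub u a b = cnt-strict mono u f t
        where
        mono : ∀ x → does (U? s' x) ≡ true → does (U? s x) ≡ true
        mono x _ with U? s' x | U? s x
        mono x _ | yes _ | yes _ = refl
        mono x _ | yes p | no q = ⊥-elim (q (sub x p))
        mono x () | no _ | _
        f : does (U? s' u) ≡ false
        f with U? s' u
        ... | yes p = ⊥-elim (b p)
        ... | no _ = refl
        t : does (U? s u) ≡ true
        t with U? s u
        ... | yes _ = refl
        ... | no q = ⊥-elim (q a)

      go : ∀ k s → weight s ≤ k → Σ State Done
      go k s b with improve s
      ... | inj₁ d = s , d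
      go zero s b | inj₂ (s' , sub , u , p , q) with ℕₚ.≤-trans (shrink s s' sub u p q) b
      ... | ()
      go (suc k) s b | inj₂ (s' , sub , u , p , q) =
        go k s' (ℕₚ.≤-pred (ℕₚ.≤-trans (shrink s s' sub u p q) b))

    -- The number of elements of `U s` drops in each step. The state itself may shrink: one of the
    -- cliques built this way loses members during its construction.
    descend : State → Σ State Done
    descend s = go (weight s) s ℕₚ.≤-refl

  dec-yes : ∀ {P : Set} (d : Dec P) → does d ≡ true → P
  dec-yes (yes p) _ = p

open Counting

-- Forbidden induced subgraphs and walks.

module FreeGraphs where
  F : Graph
  F = co ((P 1 ⊕ P 1) ⊕ P 3)

  -- Without twins, distinct vertices are separated by their adjacencies. A map that preserves
  -- adjacency is then injective, and distinctness of vertices never has to be checked separately.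
  TwinFree : Graph → Set
  TwinFree H = ∀ i j → (∀ k → adj H i k ≡ adj H j k) → i ≡ j

  twinFree? : ∀ H → Dec (TwinFree H)
  twinFree? H = Finₚ.all? λ i → Finₚ.all? λ j →
    Finₚ.all? (λ k → adj H i k Bool.≟ adj H j k) →-dec (i Fin.≟ j)

  embed : ∀ {G H} → TwinFree H → (f : Fin (size H) → Fin (size G)) →
    (∀ i j → i Fin.< j → adj G (f i) (f j) ≡ adj H i j) → InducedSub H G
  embed {G} {H} tf f up = f , (λ {i} {j} e → tf i j λ k →
      trans (sym (pres i k)) (trans (cong (λ v → adj G v (f k)) e) (pres j k))) , pres
    where
    pres : ∀ i j → adj G (f i) (f j) ≡ adj H i j
    pres i j with Finₚ.<-cmp i j
    ... | tri< l _ _ = up i j l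
    ... | tri≈ _ refl _ = trans (adj-irrefl G (f i)) (sym (adj-irrefl H i))
    ... | tri> _ _ g = trans (adj-sym G _ _) (trans (up j i g) (adj-sym H j i))

  module Adjacency (G : Graph) where
    V : Set
    V = Fin (size G)

    infix 4 _~_ _≁_
    _~_ _≁_ : V → V → Set
    x ~ y = adj G x y ≡ true
    x ≁ y = adj G x y ≡ false

    ~s : ∀ {x y} → x ~ y → y ~ x
    ~s {x} {y} = trans (adj-sym G y x)

    ≁s : ∀ {x y} → x ≁ y → y ≁ x
    ≁s {x} {y} = trans (adj-sym G y x)

    ~⊎≁ : ∀ x y → (x ~ y) ⊎ (x ≁ y)
    ~⊎≁ x y with adj G x y
    ... | true = inj₁ refl
    ... | false = inj₂ refl

    clash : ∀ {x y} {A : Set} → x ~ y → x ≁ y → A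
    clash p q with trans (sym p) q
    ... | ()

    ¬~ : ∀ {x y} → ¬ (x ~ y) → x ≁ y
    ¬~ {x} {y} h = [ (λ e → ⊥-elim (h e)) , (λ e → e) ]′ (~⊎≁ x y)

    ¬≁ : ∀ {x y} → ¬ (x ≁ y) → x ~ y
    ¬≁ {x} {y} h = [ (λ e → e) , (λ e → ⊥-elim (h e)) ]′ (~⊎≁ x y)

    _~?_ : ∀ x y → Dec (x ~ y)
    x ~? y = adj G x y Bool.≟ true

    _≁?_ : ∀ x y → Dec (x ≁ y)
    x ≁? y = adj G x y Bool.≟ false

    adj-⇔ : ∀ {x y x' y'} → (x ~ y → x' ~ y') → (x' ~ y' → x ~ y) → adj G x y ≡ adj G x' y'
    adj-⇔ {x} {y} f g = [ (λ e → trans e (sym (f e))) , (λ e → trans e (sym (¬~ λ h → clash (g h) e))) ]′ (~⊎≁ x y)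

  record FreeGraph : Set where
    field
      gr : Graph
      noP5 : ¬ InducedSub (P 5) gr
      noF  : ¬ InducedSub F gr
  open FreeGraph public

  Vtx : FreeGraph → Set
  Vtx Γ = Fin (size (gr Γ))

  private
    tfP5 : TwinFree (P 5)
    tfP5 = from-yes (twinFree? (P 5))
    tfF : TwinFree F
    tfF = from-yes (twinFree? F)


  0F 1F 2F 3F 4F : Fin 5
  0F = zero
  1F = suc zero
  2F = suc (suc zero)
  3F = suc (suc (suc zero))
  4F = suc (suc (suc (suc zero)))

  upper : ∀ {A : Fin 5 → Fin 5 → Set} →
    A 0F 1F → A 0F 2F → A 0F 3F → A 0F 4F → A 1F 2F → A 1F 3F → A 1F 4F → A 2F 3F → A 2F 4F → A 3F 4F →
    ∀ i j → i Fin.< j → A i j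
  upper a b c d e f g h k l zero (suc zero) _ = a
  upper a b c d e f g h k l zero (suc (suc zero)) _ = b
  upper a b c d e f g h k l zero (suc (suc (suc zero))) _ = c
  upper a b c d e f g h k l zero (suc (suc (suc (suc zero)))) _ = d
  upper a b c d e f g h k l (suc zero) (suc zero) (s≤s ())
  upper a b c d e f g h k l (suc zero) (suc (suc zero)) _ = e
  upper a b c d e f g h k l (suc zero) (suc (suc (suc zero))) _ = f
  upper a b c d e f g h k l (suc zero) (suc (suc (suc (suc zero)))) _ = g
  upper a b c d e f g h k l (suc (suc zero)) (suc zero) (s≤s ())
  upper a b c d e f g h k l (suc (suc zero)) (suc (suc zero)) (s≤s (s≤s ()))
  upper a b c d e f g h k l (suc (suc zero)) (suc (suc (suc zero))) _ = h
  upper a b c d e f g h k l (suc (suc zero)) (suc (suc (suc (suc zero)))) _ = k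
  upper a b c d e f g h k l (suc (suc (suc zero))) (suc zero) (s≤s ())
  upper a b c d e f g h k l (suc (suc (suc zero))) (suc (suc zero)) (s≤s (s≤s ()))
  upper a b c d e f g h k l (suc (suc (suc zero))) (suc (suc (suc zero))) (s≤s (s≤s (s≤s ())))
  upper a b c d e f g h k l (suc (suc (suc zero))) (suc (suc (suc (suc zero)))) _ = l
  upper a b c d e f g h k l (suc (suc (suc (suc zero)))) (suc zero) (s≤s ())
  upper a b c d e f g h k l (suc (suc (suc (suc zero)))) (suc (suc zero)) (s≤s (s≤s ()))
  upper a b c d e f g h k l (suc (suc (suc (suc zero)))) (suc (suc (suc zero))) (s≤s (s≤s (s≤s ())))
  upper a b c d e f g h k l (suc (suc (suc (suc zero)))) (suc (suc (suc (suc zero)))) (s≤s (s≤s (s≤s (s≤s ()))))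

  module Structure (Γ : FreeGraph) where
    G = gr Γ
    open Adjacency G public

    p5 : ∀ a b c d e → a ~ b → b ~ c → c ~ d → d ~ e →
      a ≁ c → a ≁ d → a ≁ e → b ≁ d → b ≁ e → c ≁ e → ⊥
    p5 a b c d e ab bc cd de ac ad ae bd be ce = noP5 Γ (embed {G} {P 5} tfP5
      (Vec.lookup (a ∷ b ∷ c ∷ d ∷ e ∷ []))
      (upper {λ i j → adj G (Vec.lookup vs i) (Vec.lookup vs j) ≡ adj (P 5) i j} ab ac ad ae bc bd be cd ce de))
      where vs = a ∷ b ∷ c ∷ d ∷ e ∷ []

    -- the clique a b c d, and e adjacent to a and b only
    k4 : ∀ a b c d e → a ~ b → a ~ c → a ~ d → b ~ c → b ~ d → c ~ d →
      e ~ a → e ~ b → e ≁ c → e ≁ d → ⊥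
    k4 a b c d e ab ac ad bc bd cd ea eb ec ed = noF Γ (embed {G} {F} tfF
      (Vec.lookup vs)
      (upper {λ i j → adj G (Vec.lookup vs i) (Vec.lookup vs j) ≡ adj F i j} ab ac (~s ea) ad bc (~s eb) bd (≁s ec) cd ed))
      -- In `F` the vertices 2, 3, 4 come from the path, so position 3 belongs to `e`, the vertex
      -- non-adjacent to both `c` and `d`.
      where vs = a ∷ b ∷ c ∷ e ∷ d ∷ []

    -- x reaches z along a walk whose vertices after x lie in P
    data Reach (P : V → Set) : V → V → Set where
      stop : ∀ {x} → Reach P x x
      move : ∀ {x z} w → x ~ w → P w → Reach P w z → Reach P x z

    module _ {P : V → Set} where
      reach-trans : ∀ {x y z} → Reach P x y → Reach P y z → Reach P x z
      reach-trans stop r = r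
      reach-trans (move w e p s) r = move w e p (reach-trans s r)

      reach-end : ∀ {x z} → P x → Reach P x z → P z
      reach-end px stop = px
      reach-end px (move w e p r) = reach-end p r

      reach-sym : ∀ {x z} → P x → Reach P x z → Reach P z x
      reach-sym px stop = stop
      reach-sym px (move w e p r) = reach-trans (reach-sym p r) (move _ (~s e) px stop)

      reach-pres : (Q : V → Set) → (∀ {u v} → P u → P v → u ~ v → Q u → Q v) →
        ∀ {x z} → P x → Reach P x z → Q x → Q z
      reach-pres Q h px stop q = q
      reach-pres Q h px (move w e p r) q = reach-pres Q h p r (h px p e q)

    reach-mono : ∀ {P P'} → (∀ {v} → P v → P' v) → ∀ {x z} → Reach P x z → Reach P' x z
    reach-mono h stop = stop
    reach-mono h (move w e p r) = move w e (h p) (reach-mono h r)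

    -- walks with at most two inner vertices; in a P5-free graph these are as good as arbitrary walks
    Conn : (V → Set) → V → V → Set
    Conn P x z = x ≡ z ⊎ (x ~ z) ⊎ (∃ λ w → P w × x ~ w × w ~ z) ⊎
      (∃ λ w → P w × x ~ w × ∃ λ w' → P w' × w ~ w' × w' ~ z)

    conn? : ∀ {P} → (∀ v → Dec (P v)) → ∀ x z → Dec (Conn P x z)
    conn? P? x z = (x Fin.≟ z) ⊎-dec (x ~? z) ⊎-dec
      Finₚ.any? (λ w → P? w ×-dec (x ~? w) ×-dec (w ~? z)) ⊎-dec
      Finₚ.any? (λ w → P? w ×-dec (x ~? w) ×-dec Finₚ.any? (λ w' → P? w' ×-dec (w ~? w') ×-dec (w' ~? z)))

    conn⇒reach : ∀ {P x z} → P z → Conn P x z → Reach P x z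
    conn⇒reach pz (inj₁ refl) = stop
    conn⇒reach pz (inj₂ (inj₁ e)) = move _ e pz stop
    conn⇒reach pz (inj₂ (inj₂ (inj₁ (w , pw , e , f)))) = move w e pw (move _ f pz stop)
    conn⇒reach pz (inj₂ (inj₂ (inj₂ (w , pw , e , w' , pw' , f , g)))) = move w e pw (move w' f pw' (move _ g pz stop))

    -- An edge prepended to a walk with two inner vertices gives five vertices in a row. Any of the
    -- six possible chords shortens the walk, and without a chord they induce `P 5`.
    reach⇒conn : ∀ {P x z} → Reach P x z → Conn P x z
    reach⇒conn stop = inj₁ refl
    reach⇒conn {P} {x} {z} (move w e p r) with reach⇒conn r
    ... | inj₁ refl = inj₂ (inj₁ e)
    ... | inj₂ (inj₁ f) = inj₂ (inj₂ (inj₁ (w , p , e , f)))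
    ... | inj₂ (inj₂ (inj₁ (a , pa , f , g))) = inj₂ (inj₂ (inj₂ (w , p , e , a , pa , f , g)))
    ... | inj₂ (inj₂ (inj₂ (a , pa , f , b , pb , g , h))) with ~⊎≁ x a
    ... | inj₁ xa = inj₂ (inj₂ (inj₂ (a , pa , xa , b , pb , g , h)))
    ... | inj₂ xa with ~⊎≁ x b
    ... | inj₁ xb = inj₂ (inj₂ (inj₁ (b , pb , xb , h)))
    ... | inj₂ xb with ~⊎≁ x z
    ... | inj₁ xz = inj₂ (inj₁ xz)
    ... | inj₂ xz with ~⊎≁ w b
    ... | inj₁ wb = inj₂ (inj₂ (inj₂ (w , p , e , b , pb , wb , h)))
    ... | inj₂ wb with ~⊎≁ w z
    ... | inj₁ wz = inj₂ (inj₂ (inj₁ (w , p , e , wz)))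
    ... | inj₂ wz with ~⊎≁ a z
    ... | inj₁ az = inj₂ (inj₂ (inj₂ (w , p , e , a , pa , f , az)))
    ... | inj₂ az = ⊥-elim (p5 x w a b z e f g h xa xb xz wb wz az)

    abstract
      reach? : ∀ {P} → (∀ v → Dec (P v)) → ∀ x z → Dec (P z × Reach P x z)
      reach? P? x z = map′ (λ (p , c) → p , conn⇒reach p c) (λ (p , r) → p , reach⇒conn r) (P? z ×-dec conn? P? x z)

-- Domination by two cliques, and Olariu's theorem.

module Dominating where
  open FreeGraphs

  module Domination (Γ : FreeGraph) where
    open Structure Γ

    Clique : List V → Set
    Clique = AllPairs _~_

    clique-~ : ∀ {K} → Clique K → ∀ {a b} → a ∈ K → b ∈ K → a ≢ b → a ~ b
    clique-~ (h ∷ c) (here refl) (here refl) n = ⊥-elim (n refl)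
    clique-~ (h ∷ c) (here refl) (there q) n = All.lookup h q
    clique-~ (h ∷ c) (there p) (here refl) n = ~s (All.lookup h p)
    clique-~ (h ∷ c) (there p) (there q) n = clique-~ c p q n

    Cov : List V → V → Set
    Cov K x = Any (λ k → k ≡ x ⊎ k ~ x) K

    abstract
      cov? : ∀ K x → Dec (Cov K x)
      cov? K x = Any.any? (λ k → (k Fin.≟ x) ⊎-dec (k ~? x)) K

    module Connected (C : V → Set) (C? : ∀ v → Dec (C v)) (conn : ∀ {x z} → C x → C z → Reach C x z) where

      module _ (x₀ : V) (cx₀ : C x₀) where
        private
          S₁ : Set
          S₁ = Σ (List V) λ K → Clique K × All C K × x₀ ∈ K

          U₁ : S₁ → V → Set
          U₁ (K , _) x = C x × ¬ Cov K x

          -- The clique grows only by vertices that are complete to it and cover something new. When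
          -- this stops, a covered vertex with an uncovered neighbour has a neighbour and also a
          -- non-neighbour in `K` (`at-nbr`, `at-non`).
          Done₁ : S₁ → Set
          Done₁ s@(K , _) = ∀ w u → C w → All (w ~_) K → U₁ s u → w ~ u → ⊥

          U₁? : ∀ s x → Dec (U₁ s x)
          U₁? (K , _) x = C? x ×-dec ¬? (cov? K x)

          improve₁ : ∀ s → Done₁ s ⊎ Σ S₁ λ s' → (∀ x → U₁ s' x → U₁ s x) × Σ V λ u → U₁ s u × ¬ U₁ s' u
          improve₁ s@(K , cl , ac , m) with Finₚ.any? (λ w → Finₚ.any? (λ u →
            C? w ×-dec All.all? (w ~?_) K ×-dec U₁? s u ×-dec (w ~? u)))
          ... | no ¬p = inj₁ λ w u cw al uu e → ¬p (w , u , cw , al , uu , e)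
          ... | yes (w , u , cw , al , uu , e) = inj₂ ((w ∷ K , al ∷ cl , cw ∷ ac , there m) ,
            (λ x (cx , nc) → cx , λ c → nc (there c)) , u , uu , λ (_ , nc) → nc (here (inj₂ e)))

          s₁ : Σ S₁ Done₁
          s₁ = descend U₁ U₁? Done₁ improve₁ ((x₀ ∷ [] , [] ∷ [] , cx₀ ∷ [] , here refl))

          K : List V
          K = proj₁ (proj₁ s₁)
          K-cl : Clique K
          K-cl = proj₁ (proj₂ (proj₁ s₁))
          K-C : All C K
          K-C = proj₁ (proj₂ (proj₂ (proj₁ s₁)))
          x₀∈K : x₀ ∈ K
          x₀∈K = proj₂ (proj₂ (proj₂ (proj₁ s₁)))

          U : V → Set
          U x = C x × ¬ Cov K x
          U? : ∀ x → Dec (U x)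
          U? = U₁? (proj₁ s₁)

          U≁ : ∀ {u k} → U u → k ∈ K → k ≁ u
          U≁ (_ , nc) m = ¬~ λ e → nc (Any.map (λ { refl → inj₂ e }) m)

          At : V → V → Set
          At w u = C w × Cov K w × U u × w ~ u

          at-nbr : ∀ {w u} → At w u → ∃ λ k → k ∈ K × k ~ w
          at-nbr {w} {u} (_ , c , uu , e) with find c
          ... | k , m , inj₁ refl = clash e (U≁ uu m)
          ... | k , m , inj₂ f = k , m , f

          at-non : ∀ {w u} → At w u → ∃ λ k → k ∈ K × k ≁ w
          at-non {w} {u} (cw , c , uu , e) with Any.any? (λ k → k ≁? w) K
          ... | yes a = find a
          ... | no n = ⊥-elim (proj₂ s₁ w u cw (All.map (λ h → ~s (¬≁ h)) (Allₚ.¬Any⇒All¬ K n)) uu e)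

          K~ : ∀ {k k' w} → k ∈ K → k' ∈ K → k ~ w → k' ≁ w → k ~ k'
          K~ m m' e n = clique-~ K-cl m m' λ { refl → clash e n }

          -- A non-neighbour `k'` and a neighbour `k` of `w` in `K` would prolong `w q q'` to an
          -- induced path on five vertices. So attachment passes along edges between uncovered
          -- vertices.
          spread : ∀ {w q q'} → At w q → U q' → q ~ q' → w ~ q'
          spread {w} {q} {q'} a@(_ , _ , uq , wq) uq' e with at-nbr a | at-non a
          ... | k , mk , kw | k' , mk' , k'w = ¬≁ λ wq' →
            p5 k' k w q q' (~s (K~ mk mk' kw k'w)) kw wq e k'w (U≁ uq mk') (U≁ uq' mk') (U≁ uq mk) (U≁ uq' mk) wq'

          attacher : ∀ {u z} → U u → Cov K z → Reach C u z → ∃ λ w → At w u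
          attacher (_ , nc) c stop = ⊥-elim (nc c)
          attacher {u} uu c (move w e cw r) with cov? K w
          ... | yes cv = w , cw , cv , uu , ~s e
          ... | no nc with attacher (cw , nc) c r
          ... | w' , a@(cw' , cv' , _) = w' , cw' , cv' , uu , spread a uu (~s e)

          -- If `u` and `u'` were private neighbours of `w` and `w'`, a connection of `w` and `w'`
          -- through one or two vertices of `K` would contain an induced path on five vertices.
          -- Hence non-adjacent attachers have comparable uncovered neighbourhoods.
          nested : ∀ {w w' u u'} → At w u → At w' u' → w ≁ w' → w ≁ u' → w' ~ u
          nested {w} {w'} {u} {u'} a@(cw , cv , uu , wu) a'@(cw' , cv' , uu' , wu') ww' wu'n = ¬≁ λ w'u →
            bad w'u (¬~ λ uu'e → clash (spread a uu' uu'e) wu'n)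
            where
            bad : w' ≁ u → u ≁ u' → ⊥
            bad w'u un with at-nbr a | at-nbr a'
            ... | k , mk , kw | k' , mk' , k'w' with ~⊎≁ k w'
            ... | inj₁ kw' = p5 u w k w' u' (~s wu) (~s kw) kw' wu' (≁s (U≁ uu mk)) (≁s w'u) un ww' wu'n (U≁ uu' mk)
            ... | inj₂ kw' with ~⊎≁ k' w
            ... | inj₁ k'w = p5 u w k' w' u' (~s wu) (~s k'w) k'w' wu' (≁s (U≁ uu mk')) (≁s w'u) un ww' wu'n (U≁ uu' mk')
            ... | inj₂ k'w = p5 u w k k' w' (~s wu) (~s kw) (~s (K~ mk' mk k'w' kw')) k'w'
                  (≁s (U≁ uu mk)) (≁s (U≁ uu mk')) (≁s w'u) (≁s k'w) ww' kw'

          S₂ : Set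
          S₂ = Σ (List V) λ W → Clique W × All (λ w → C w × Cov K w) W

          U₂ : S₂ → V → Set
          U₂ (W , _) x = U x × ¬ Any (_~ x) W

          improve₂ : ∀ s → (∀ x → ¬ U₂ s x) ⊎ Σ S₂ λ s' → (∀ x → U₂ s' x → U₂ s x) × Σ V λ u → U₂ s u × ¬ U₂ s' u
          improve₂ s@(W , cl , ac) with Finₚ.any? (λ x → U? x ×-dec ¬? (Any.any? (_~? x) W))
          ... | no ¬p = inj₁ λ x p → ¬p (x , p)
          ... | yes (u , uu , nu) with attacher uu (Any.map (λ e → inj₁ (sym e)) x₀∈K) (conn (proj₁ uu) cx₀)
          -- The members of `W` that are dropped are non-adjacent to `w'`, and none of them sees
          -- `u`. By `nested`, `w'` sees all the uncovered vertices that they see.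
          ... | w' , a@(cw' , cv' , _ , w'u) = inj₂ ((w' ∷ filter (w' ~?_) W , Allₚ.all-filter (w' ~?_) W ∷ APₚ.filter⁺ (w' ~?_) cl ,
                (cw' , cv') ∷ Allₚ.filter⁺ (w' ~?_) ac) , (λ x (ux , n) → ux , λ c → n (keep ux c)) , u , (uu , nu) , λ (_ , n) → n (here w'u))
            where
            keep : ∀ {x} → U x → Any (_~ x) W → Any (_~ x) (w' ∷ filter (w' ~?_) W)
            keep {x} ux c with find c
            ... | w , m , e with w' ~? w
            ... | yes f = there (Any.map (λ { refl → e }) (Memₚ.∈-filter⁺ (w' ~?_) m f))
            ... | no n = here (nested (proj₁ (All.lookup ac m) , proj₂ (All.lookup ac m) , ux , e) a (≁s (¬~ n))
                  (¬~ λ h → nu (Any.map (λ { refl → h }) m)))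

          s₂ : Σ S₂ λ s → ∀ x → ¬ U₂ s x
          s₂ = descend U₂ (λ (W , _) x → U? x ×-dec ¬? (Any.any? (_~? x) W)) _ improve₂ ([] , [] , [])

        abstract
          two-cliques : Σ (List V) λ K → Σ (List V) λ W → Clique K × Clique W × All C K × All C W ×
            (∀ x → C x → Cov K x ⊎ Cov W x)
          two-cliques = K , proj₁ (proj₁ s₂) , K-cl , proj₁ (proj₂ (proj₁ s₂)) , K-C , All.map proj₁ (proj₂ (proj₂ (proj₁ s₂))) ,
            λ x cx → case cov? K x of λ where
              (yes c) → inj₁ c
              (no n) → inj₂ (case Any.any? (_~? x) (proj₁ (proj₁ s₂)) of λ where
                (yes c) → Any.map inj₂ c
                (no n') → ⊥-elim (proj₂ s₂ x ((cx , n) , n')))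

      private
        -- `Cov` lets a vertex cover itself. One neighbour added for each vertex makes the
        -- domination total.
        addNbr : V → List V
        addNbr k with Finₚ.any? (λ y → C? y ×-dec (k ~? y))
        ... | yes (y , _) = k ∷ y ∷ []
        ... | no _ = k ∷ []

        addNbr-len : ∀ k → length (addNbr k) ≤ 2
        addNbr-len k with Finₚ.any? (λ y → C? y ×-dec (k ~? y))
        ... | yes _ = ℕₚ.≤-refl
        ... | no _ = s≤s z≤n

        addNbr-C : ∀ {k} → C k → All C (addNbr k)
        addNbr-C {k} ck with Finₚ.any? (λ y → C? y ×-dec (k ~? y))
        ... | yes (y , cy , _) = ck ∷ cy ∷ []
        ... | no _ = ck ∷ []

        addNbr-~ : ∀ {k x z} → C z → x ~ z → k ≡ x ⊎ k ~ x → Any (_~ x) (addNbr k)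
        addNbr-~ {k} cz xz c with Finₚ.any? (λ y → C? y ×-dec (k ~? y)) | c
        ... | yes (y , cy , e) | inj₁ refl = there (here (~s e))
        ... | no n | inj₁ refl = ⊥-elim (n (_ , cz , xz))
        ... | yes _ | inj₂ e = here e
        ... | no _ | inj₂ e = here e

        concat-len : ∀ {A B : Set} (f : A → List B) c → (∀ a → length (f a) ≤ c) → ∀ l → length (concatMap f l) ≤ length l * c
        concat-len f c h [] = z≤n
        concat-len f c h (a ∷ l) rewrite Listₚ.length-++ (f a) {concatMap f l} = ℕₚ.+-mono-≤ (h a) (concat-len f c h l)

      Dominates : List V → Set
      Dominates E = ∀ {x z} → C x → C z → x ~ z → Any (_~ x) E

      abstract
        -- The bound is (4 + 4) · 2: two shortened cliques, doubled by `addNbr`.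
        total : (∀ K → Clique K → All C K → Σ (List V) λ K₀ → length K₀ ≤ 4 × All C K₀ × (∀ x → C x → Cov K x → Cov K₀ x)) →
          ∀ x₀ → C x₀ → Σ (List V) λ E → length E ≤ 16 × All C E × Dominates E
        total sh x₀ cx₀ with two-cliques x₀ cx₀
        ... | K , W , clK , clW , aK , aW , dom with sh K clK aK | sh W clW aW
        ... | K₀ , lK , cK , dK | W₀ , lW , cW , dW = concatMap addNbr (K₀ ++ W₀) ,
          ℕₚ.≤-trans (concat-len addNbr 2 addNbr-len (K₀ ++ W₀))
            (ℕₚ.*-monoˡ-≤ 2 (subst (_≤ 8) (sym (Listₚ.length-++ K₀)) (ℕₚ.+-mono-≤ lK lW))) ,
          Allₚ.concat⁺ (Allₚ.map⁺ (All.map addNbr-C (Allₚ.++⁺ cK cW))) ,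
          λ {x} {z} cx cz e → Anyₚ.concat⁺ (Anyₚ.map⁺ (Any.map (addNbr-~ cz e)
            ([ (λ c → Anyₚ.++⁺ˡ (dK x cx c)) , (λ c → Anyₚ.++⁺ʳ K₀ (dW x cx c)) ]′ (dom x cx))))

      PawFree Multipartite TriangleFree : Set
      PawFree = ∀ {a b c d} → C a → C b → C c → C d → a ~ b → a ~ c → b ~ c → d ~ a → d ≁ b → d ≁ c → ⊥
      Multipartite = ∀ {x y z} → C x → C y → C z → x ≁ y → y ≁ z → x ≁ z
      TriangleFree = ∀ {a b c} → C a → C b → C c → a ~ b → a ~ c → b ~ c → ⊥

      abstract
        triangleFree? : TriangleFree ⊎ (∃ λ a → ∃ λ b → ∃ λ c → C a × C b × C c × a ~ b × a ~ c × b ~ c)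
        triangleFree? with Finₚ.any? (λ a → Finₚ.any? (λ b → Finₚ.any? (λ c → C? a ×-dec C? b ×-dec C? c ×-dec (a ~? b) ×-dec (a ~? c) ×-dec (b ~? c))))
        ... | yes (a , b , c , p) = inj₂ (a , b , c , p)
        ... | no n = inj₁ λ {a} {b} {c} ca cb cc ab ac bc → n (a , b , c , ca , cb , cc , ab , ac , bc)

      -- Olariu's theorem on paw-free graphs
      module _ (paw : PawFree) {a b c : V} (ca : C a) (cb : C b) (cc : C c) (ab : a ~ b) (ac : a ~ c) (bc : b ~ c) where
        private
          InTri : V → Set
          InTri v = ∃ λ x → ∃ λ y → C x × C y × v ~ x × v ~ y × x ~ y

          two : ∀ {v x y d} → C v → C x → C y → C d → v ~ x → v ~ y → x ~ y → d ~ v → d ~ x ⊎ d ~ y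
          two {v} {x} {y} {d} cv cx cy cd vx vy xy dv with ~⊎≁ d x | ~⊎≁ d y
          ... | inj₁ e | _ = inj₁ e
          ... | inj₂ _ | inj₁ e = inj₂ e
          ... | inj₂ e | inj₂ f = ⊥-elim (paw cv cx cy cd vx vy xy dv e f)

          inTri : ∀ {v} → C v → InTri v
          inTri cv = reach-pres InTri (λ {u} {v} cu cv uv (x , y , cx , cy , ux , uy , xy) →
              [ (λ vx → u , x , cu , cx , ~s uv , vx , ux) , (λ vy → u , y , cu , cy , ~s uv , vy , uy) ]′
                (two cu cx cy cv ux uy xy (~s uv)))
            ca (conn ca cv) (b , c , cb , cc , ab , ac , bc)

          edgeTri : ∀ {x z} → C x → C z → x ~ z → ∃ λ t → C t × t ~ x × t ~ z
          edgeTri cx cz xz with inTri cx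
          ... | p , q , cp , cq , xp , xq , pq = [ (λ e → p , cp , ~s xp , ~s e) , (λ e → q , cq , ~s xq , ~s e) ]′
                (two cx cp cq cz xp xq pq (~s xz))

          -- If `w` misses `z`, the triangle `x z t` forces `w` to meet `t`, and the triangle
          -- `w x t` forces `y` to meet `x` or `t`. Meeting `t` alone would make `t x z y` a paw.
          near : ∀ {x z} → C x → C z → x ~ z → ∀ {w y} → C w → C y → w ~ y → w ~ x → y ~ x ⊎ y ~ z
          near {x} {z} cx cz xz {w} {y} cw cy wy wx with edgeTri cx cz xz | ~⊎≁ y x | ~⊎≁ y z
          ... | _ | inj₁ e | _ = inj₁ e
          ... | _ | inj₂ _ | inj₁ e = inj₂ e
          ... | t , ct , tx , tz | inj₂ yx | inj₂ yz with ~⊎≁ w z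
          ... | inj₁ wz = ⊥-elim (paw cw cx cz cy wx wz xz (~s wy) yx yz)
          ... | inj₂ wz with two cx cz ct cw xz (~s tx) (~s tz) wx
          ... | inj₁ e = clash e wz
          ... | inj₂ wt with two cw cx ct cy wx wt (~s tx) (~s wy)
          ... | inj₁ e = inj₁ e
          ... | inj₂ yt = ⊥-elim (paw ct cx cz cy tx tz xz yt yx yz)

          dominating : ∀ {x z} → C x → C z → x ~ z → ∀ {y} → C y → y ~ x ⊎ y ~ z
          dominating {x} {z} cx cz xz cy = reach-pres (λ y → y ~ x ⊎ y ~ z)
            (λ {u} {v} cu cv uv → [ near cx cz xz cu cv uv , (λ e → [ inj₂ , inj₁ ]′ (near cz cx (~s xz) cu cv uv e)) ]′)
            cx (conn cx cy) (inj₂ xz)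

        abstract
          -- Once there is a triangle, every edge dominates the component; transitivity of
          -- non-adjacency is the contrapositive.
          olariu : Multipartite
          olariu {x} {y} {z} cx cy cz xy yz = ¬~ λ xz → [ (λ e → clash e (≁s xy)) , (λ e → clash e yz) ]′ (dominating cx cz xz cy)

-- Complete multipartite sets around a 5-clique, and classes by adjacency patterns.

module Multipartite where
  open FreeGraphs
  open Dominating

  abstract
    two-free : ∀ (a b c : Fin 5) → ∃ λ k → ∃ λ l → k ≢ l × (k ≢ a × k ≢ b × k ≢ c) × (l ≢ a × l ≢ b × l ≢ c)
    two-free = from-yes (Finₚ.all? λ a → Finₚ.all? λ b → Finₚ.all? λ c → Finₚ.any? λ k → Finₚ.any? λ l →
      ≢? k l ×-dec (≢? k a ×-dec ≢? k b ×-dec ≢? k c) ×-dec (≢? l a ×-dec ≢? l b ×-dec ≢? l c))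
      where
      ≢? : (i j : Fin 5) → Dec (i ≢ j)
      ≢? i j = ¬? (i Fin.≟ j)

  -- for a 5-clique q, M is complete multipartite: its parts are the classes of the relation _≁_ on M
  module Multi (Γ : FreeGraph) (q : Fin 5 → Vtx Γ) where
    open Structure Γ

    M : V → Set
    M v = ∃ λ i → ∃ λ j → i ≢ j × v ~ q i × v ~ q j

    abstract
      M? : ∀ v → Dec (M v)
      M? v = Finₚ.any? λ i → Finₚ.any? λ j → ¬? (i Fin.≟ j) ×-dec (v ~? q i) ×-dec (v ~? q j)

    Act : V → Set
    Act p = M p × ∃ λ a → ¬ M a × a ~ p

    abstract
      act? : ∀ p → Dec (Act p)
      act? p = M? p ×-dec Finₚ.any? λ a → ¬? (M? a) ×-dec (a ~? p)

    Clique5 : Set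
    Clique5 = ∀ i j → i ≢ j → q i ~ q j

    module _ (qc : Clique5) where
      private
        qc' : ∀ {i j} → i ≢ j → q i ~ q j
        qc' = qc _ _

      -- Two missed vertices and two hit ones would be a `k4` with `v` as its fifth vertex. The
      -- index `zero` is a dummy for the case that nothing is missed.
      miss : ∀ {v} → M v → ∃ λ m → ∀ k → k ≢ m → v ~ q k
      miss {v} (i , j , i≢j , vi , vj) with Finₚ.any? (λ k → v ≁? q k)
      ... | no n = zero , λ k _ → ¬≁ λ e → n (k , e)
      ... | yes (m , vm) = m , λ k k≢m → ¬≁ λ vk → k4 (q i) (q j) (q k) (q m) v
            (qc' i≢j) (qc' (≠ vi vk)) (qc' (≠ vi vm)) (qc' (≠ vj vk)) (qc' (≠ vj vm)) (qc' k≢m) vi vj vk vm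
        where
        ≠ : ∀ {a b} → v ~ q a → v ≁ q b → a ≢ b
        ≠ e f refl = clash e f

      hit : ∀ {v} → ¬ M v → ∃ λ m → ∀ k → k ≢ m → v ≁ q k
      hit {v} nm with Finₚ.any? (λ k → v ~? q k)
      ... | no n = zero , λ k _ → ¬~ λ e → n (k , e)
      ... | yes (m , vm) = m , λ k k≢m → ¬~ λ vk → nm (k , m , k≢m , vk , vm)

      M-q : ∀ k → M (q k)
      M-q k with two-free k k k
      ... | i , j , i≢j , (n , _) , (n' , _) = i , j , i≢j , qc' (n ∘ sym) , qc' (n' ∘ sym)

      common : ∀ {x y z} → M x → M y → M z → ∃ λ n → ∃ λ n' → M n × M n' × n ~ n' ×
        (n ~ x × n ~ y × n ~ z) × (n' ~ x × n' ~ y × n' ~ z)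
      common mx my mz with miss mx | miss my | miss mz
      ... | a , ha | b , hb | c , hc with two-free a b c
      ... | k , l , k≢l , (ka , kb , kc) , (la , lb , lc) = q k , q l , M-q k , M-q l , qc' k≢l ,
            (~s (ha k ka) , ~s (hb k kb) , ~s (hc k kc)) , (~s (ha l la) , ~s (hb l lb) , ~s (hc l lc))

      ≁-trans : ∀ {x y z} → M x → M y → M z → x ≁ y → y ≁ z → x ≁ z
      ≁-trans {x} {y} {z} mx my mz xy yz with common mx my mz
      ... | t , t' , _ , _ , tt' , (tx , ty , tz) , (t'x , t'y , t'z) = ¬~ λ xz →
            k4 t t' x z y tt' tx tz t'x t'z xz (~s ty) (~s t'y) (≁s xy) yz

      ≁~-trans : ∀ {x y z} → M x → M y → M z → x ≁ y → y ~ z → x ~ z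
      ≁~-trans mx my mz xy yz = ¬≁ λ xz → clash yz (≁-trans my mx mz (≁s xy) xz)

      -- Otherwise `b`, `b'` and two vertices of the clique which both of them see and `a` does not
      -- form a `k4` with `a`.
      one-part : ∀ {a b b'} → ¬ M a → M b → M b' → a ~ b → a ~ b' → b ≁ b'
      one-part {a} {b} {b'} na mb mb' ab ab' with miss mb | miss mb' | hit na
      ... | i , hi | j , hj | h , hh with two-free i j h
      ... | k , l , k≢l , (ki , kj , kh) , (li , lj , lh) = ¬~ λ bb' →
            k4 b b' (q k) (q l) a bb' (hi k ki) (hi l li) (hj k kj) (hj l lj) (qc' k≢l) ab ab' (hh k kh) (hh l lh)

      other-part : ∀ {a b b'} → ¬ M a → M b → M b' → a ~ b → b ~ b' → a ≁ b'
      other-part na mb mb' ab bb' = ¬~ λ ab' → clash bb' (one-part na mb mb' ab ab')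

  five : ∀ (Γ : FreeGraph) (a b c d e : Vtx Γ) → let open Structure Γ in
    a ~ b → a ~ c → a ~ d → a ~ e → b ~ c → b ~ d → b ~ e → c ~ d → c ~ e → d ~ e →
    Multi.Clique5 Γ (Vec.lookup (a ∷ b ∷ c ∷ d ∷ e ∷ []))
  five Γ a b c d e ab ac ad ae bc bd be cd ce de i j i≢j with Finₚ.<-cmp i j
  ... | tri< l _ _ = upper {λ i j → Structure._~_ Γ (Vec.lookup vs i) (Vec.lookup vs j)} ab ac ad ae bc bd be cd ce de i j l
    where vs = a ∷ b ∷ c ∷ d ∷ e ∷ []
  ... | tri≈ _ p _ = ⊥-elim (i≢j p)
  ... | tri> _ _ l = Structure.~s Γ (upper {λ i j → Structure._~_ Γ (Vec.lookup vs i) (Vec.lookup vs j)} ab ac ad ae bc bd be cd ce de j i l)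
    where vs = a ∷ b ∷ c ∷ d ∷ e ∷ []

  abstract
    anyVec? : ∀ {m} n {P : Vec (Fin m) n → Set} → (∀ v → Dec (P v)) → Dec (∃ P)
    anyVec? zero P? = map′ ([] ,_) (λ { ([] , p) → p }) (P? [])
    anyVec? (suc n) P? = map′ (λ (x , v , p) → x ∷ v , p) (λ { (x ∷ v , p) → x , v , p })
      (Finₚ.any? λ x → anyVec? n λ v → P? (x ∷ v))

  -- Eleven vertices: the clique and three pairs of a vertex `p` of `M` with a neighbour `a`
  -- outside. As a single vector the configuration can be searched for and pebbled in one go.
  TConfig : (Γ : FreeGraph) → Vec (Fin (size (gr Γ))) 11 → Set
  TConfig Γ (a ∷ b ∷ c ∷ d ∷ e ∷ p₁ ∷ a₁ ∷ p₂ ∷ a₂ ∷ p₃ ∷ a₃ ∷ []) =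
    Clique5 × (Leg p₁ a₁ × Leg p₂ a₂ × Leg p₃ a₃) × (p₁ ~ p₂ × p₁ ~ p₃ × p₂ ~ p₃)
    where
    open Structure Γ
    open Multi Γ (Vec.lookup (a ∷ b ∷ c ∷ d ∷ e ∷ []))
    Leg : V → V → Set
    Leg p a = M p × ¬ M a × a ~ p

  abstract
    tConfig? : ∀ Γ v → Dec (TConfig Γ v)
    tConfig? Γ (a ∷ b ∷ c ∷ d ∷ e ∷ p₁ ∷ a₁ ∷ p₂ ∷ a₂ ∷ p₃ ∷ a₃ ∷ []) =
      (Finₚ.all? λ i → Finₚ.all? λ j → ¬? (i Fin.≟ j) →-dec (_ ~? _)) ×-dec
      (leg? p₁ a₁ ×-dec leg? p₂ a₂ ×-dec leg? p₃ a₃) ×-dec ((p₁ ~? p₂) ×-dec (p₁ ~? p₃) ×-dec (p₂ ~? p₃))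
      where
      open Structure Γ
      open Multi Γ (Vec.lookup (a ∷ b ∷ c ∷ d ∷ e ∷ []))
      leg? : ∀ p a → Dec (M p × ¬ M a × a ~ p)
      leg? p a = M? p ×-dec ¬? (M? a) ×-dec (a ~? p)

  module Patterns (Γ : FreeGraph) where
    open Structure Γ

    pat : List V → V → List Bool
    pat E x = map (λ e → adj G e x) E

    abstract
      pat? : ∀ E x z → Dec (pat E x ≡ pat E z)
      pat? E x z = Listₚ.≡-dec Bool._≟_ (pat E x) (pat E z)

    pat-∈ : ∀ {E x z e} → e ∈ E → pat E x ≡ pat E z → adj G e x ≡ adj G e z
    pat-∈ (here refl) p = Listₚ.∷-injectiveˡ p
    pat-∈ (there m) p = pat-∈ m (Listₚ.∷-injectiveʳ p)

    pat-~ : ∀ {E x z e} → e ∈ E → pat E x ≡ pat E z → e ~ x → e ~ z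
    pat-~ m p h = trans (sym (pat-∈ m p)) h

    pat-all : ∀ {x z} E → (∀ {e} → e ∈ E → adj G e x ≡ adj G e z) → pat E x ≡ pat E z
    pat-all [] h = refl
    pat-all (e ∷ E) h = cong₂ _∷_ (h (here refl)) (pat-all E (h ∘ there))

    pat-sub : ∀ {E E' x z} → (∀ {e} → e ∈ E → e ∈ E') → pat E' x ≡ pat E' z → pat E x ≡ pat E z
    pat-sub {E} s p = pat-all E λ m → pat-∈ (s m) p

    differ : ∀ {x z} E → ¬ pat E x ≡ pat E z → ∃ λ e → e ∈ E × adj G e x ≢ adj G e z
    differ {x} {z} E n with Any.any? (λ e → ¬? (adj G e x Bool.≟ adj G e z)) E
    ... | yes a = find a
    ... | no na = ⊥-elim (n (pat-all E λ {e} m → case adj G e x Bool.≟ adj G e z of λ where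
            (yes p) → p
            (no np) → ⊥-elim (All.lookup (Allₚ.¬Any⇒All¬ E na) m np)))

    ≢-split : ∀ {a b c d} → adj G a b ≢ adj G c d → (a ~ b × c ≁ d) ⊎ (a ≁ b × c ~ d)
    ≢-split {a} {b} {c} {d} n with adj G a b | adj G c d
    ... | true | true = ⊥-elim (n refl)
    ... | true | false = inj₁ (refl , refl)
    ... | false | true = inj₂ (refl , refl)
    ... | false | false = ⊥-elim (n refl)

    -- Some `e` in `D` sees both ends in one of the classes and neither end in the other. It joins
    -- the two edges to an induced path on five vertices.
    no2K2 : ∀ {D x₁ x₂ y₁ y₂} → pat D x₁ ≡ pat D x₂ → pat D y₁ ≡ pat D y₂ → ¬ pat D x₁ ≡ pat D y₁ →
      x₁ ~ y₁ → x₂ ~ y₂ → x₁ ≁ x₂ → y₁ ≁ y₂ → x₁ ≁ y₂ → x₂ ≁ y₁ → ⊥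
    no2K2 {D} {x₁} {x₂} {y₁} {y₂} px py n e₁ e₂ nx ny n₁ n₂ with differ D n
    ... | e , m , ne with ≢-split ne
    ... | inj₁ (ex , ey) = p5 y₁ x₁ e x₂ y₂ (~s e₁) (~s ex) (pat-~ m px ex) e₂ (≁s ey) (≁s n₂) ny nx n₁
          (trans (sym (pat-∈ m py)) ey)
    ... | inj₂ (ex , ey) = p5 x₁ y₁ e y₂ x₂ e₁ (~s ey) (pat-~ m py ey) (~s e₂) (≁s ex) n₁ nx ny (≁s n₂)
          (trans (sym (pat-∈ m px)) ex)

  -- Three edges of the class κ, in different components and each split by a vertex of the class κ′, are impossible.
  module ThreeSplits (Γ : FreeGraph) (D : List (Vtx Γ)) (κ κ′ : List Bool) (κ≢κ′ : κ ≢ κ′) where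
    open Structure Γ
    open Patterns Γ

    record Split (x z y : V) : Set where
      constructor mkSplit
      field
        px : pat D x ≡ κ
        pz : pat D z ≡ κ
        py : pat D y ≡ κ′
        xz : x ~ z
        yx : y ~ x
        yz : y ≁ z
    open Split public

    abstract
      split? : ∀ x z y → Dec (Split x z y)
      split? x z y = map′ (λ (a , b , c , d , e , f) → mkSplit a b c d e f) (λ s → px s , pz s , py s , xz s , yx s , yz s)
        (≟κ (pat D x) κ ×-dec ≟κ (pat D z) κ ×-dec ≟κ (pat D y) κ′ ×-dec (x ~? z) ×-dec (y ~? x) ×-dec (y ≁? z))
        where
        ≟κ : (a b : List Bool) → Dec (a ≡ b)
        ≟κ = Listₚ.≡-dec Bool._≟_

    record Far (x z x' z' : V) : Set where
      constructor mkFar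
      field
        xx : x ≁ x'
        xz' : x ≁ z'
        zx : z ≁ x'
        zz : z ≁ z'
    open Far public

    abstract
      far? : ∀ x z x' z' → Dec (Far x z x' z')
      far? x z x' z' = map′ (λ (a , b , c , d) → mkFar a b c d) (λ f → xx f , xz' f , zx f , zz f)
        ((x ≁? x') ×-dec (x ≁? z') ×-dec (z ≁? x') ×-dec (z ≁? z'))

    far-sym : ∀ {x z x' z'} → Far x z x' z' → Far x' z' x z
    far-sym (mkFar a b c d) = mkFar (≁s a) (≁s c) (≁s b) (≁s d)

    private
      Full Anti : V → V → V → Set
      Full y x z = y ~ x × y ~ z
      Anti y x z = y ≁ x × y ≁ z

      -- Otherwise `y` would be the middle of an induced path consisting of itself and the two
      -- edges.
      unsplit : ∀ {x z y x' z' y'} → Split x z y → Split x' z' y' → Far x z x' z' → Full y x' z' ⊎ Anti y x' z'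
      unsplit {x} {z} {y} {x'} {z'} s s' f with ~⊎≁ y x' | ~⊎≁ y z'
      ... | inj₁ a | inj₁ b = inj₁ (a , b)
      ... | inj₂ a | inj₂ b = inj₂ (a , b)
      ... | inj₁ a | inj₂ b = ⊥-elim (p5 z x y x' z' (~s (xz s)) (~s (yx s)) a (xz s') (≁s (yz s)) (zx f) (zz f) (xx f) (xz' f) b)
      ... | inj₂ a | inj₁ b = ⊥-elim (p5 z x y z' x' (~s (xz s)) (~s (yx s)) b (~s (xz s')) (≁s (yz s)) (zz f) (zx f) (xz' f) (xx f) a)

      κ≢ : ∀ {x z y x' z' y'} → Split x z y → Split x' z' y' → ¬ pat D x ≡ pat D y'
      κ≢ s s' e = κ≢κ′ (trans (sym (px s)) (trans e (py s')))

      pairCC : ∀ {x z y x' z' y'} → Split x z y → Split x' z' y' → Far x z x' z' → y ≁ y' → Full y x' z' × Full y' x z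
      pairCC {x} {z} {y} {x'} {z'} {y'} s s' f n with unsplit s s' f | unsplit s' s (far-sym f)
      ... | inj₁ a | inj₁ b = a , b
      ... | inj₁ (a , b) | inj₂ (c , d) = ⊥-elim (p5 z x y x' y' (~s (xz s)) (~s (yx s)) a (~s (yx s')) (≁s (yz s)) (zx f) (≁s d) (xx f) (≁s c) n)
      ... | inj₂ (a , b) | inj₁ (c , d) = ⊥-elim (p5 z' x' y' x y (~s (xz s')) (~s (yx s')) c (~s (yx s)) (≁s (yz s')) (≁s (xz' f)) (≁s b) (≁s (xx f)) (≁s a) (≁s n))
      ... | inj₂ (a , b) | inj₂ (c , d) = ⊥-elim (no2K2 {D} (trans (px s) (sym (px s'))) (trans (py s) (sym (py s'))) (κ≢ s s)
              (~s (yx s)) (~s (yx s')) (xx f) n (≁s c) (≁s a))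

      -- Read `Full y x' z'` as an arc from the first split to the second. Any two splits are joined
      -- by an arc, `star` shows that none receives two of them, and `cyc` excludes the directed
      -- triangle that is left.
      pairOr : ∀ {x z y x' z' y'} → Split x z y → Split x' z' y' → Far x z x' z' → Full y x' z' ⊎ Full y' x z
      pairOr {x} {z} {y} {x'} {z'} {y'} s s' f with ~⊎≁ y y'
      ... | inj₂ n = inj₁ (proj₁ (pairCC s s' f n))
      ... | inj₁ e with unsplit s s' f | unsplit s' s (far-sym f)
      ... | inj₁ a | _ = inj₁ a
      ... | inj₂ _ | inj₁ b = inj₂ b
      ... | inj₂ (a , b) | inj₂ (c , d) = ⊥-elim (p5 z x y y' x' (~s (xz s)) (~s (yx s)) e (yx s') (≁s (yz s)) (≁s d) (zx f) (≁s c) (xx f) a)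

      module _ {d' : V} (d'∈ : d' ∈ D) (d'~ : ∀ {y} → pat D y ≡ κ′ → d' ~ y) where
        -- Otherwise `d' y x' z'` is a clique of which `x` sees `d'` and `y` only.
        d'≁ : ∀ {x z y x' z' y'} → Split x z y → Split x' z' y' → Far x z x' z' → Full y x' z' → ∀ {v} → pat D v ≡ κ → d' ≁ v
        d'≁ {x} {z} {y} {x'} {z'} s s' f (a , b) {v} pv = ¬~ λ e →
          let to : ∀ {w} → pat D w ≡ κ → d' ~ w
              to = λ pw → pat-~ d'∈ (trans pv (sym pw)) e in
          k4 d' y x' z' x (d'~ (py s)) (to (px s')) (to (pz s')) a b (xz s') (~s (to (px s))) (~s (yx s)) (xx f) (xz' f)

        star : ∀ {x z y x' z' y' x″ z″ y″} → Split x z y → Split x' z' y' → Split x″ z″ y″ →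
          Far x z x' z' → Far x z x″ z″ → Far x' z' x″ z″ → Full y' x z → Full y″ x z → ⊥
        star {x} {z} {y} {x'} {z'} {y'} {x″} {z″} {y″} s s' s″ f g h (a , b) (c , d) with ~⊎≁ y' y″
        ... | inj₁ e = k4 y' y″ x z d' e a b c d (xz s) (d'~ (py s')) (d'~ (py s″)) (off (px s)) (off (pz s))
          where
          off : ∀ {v} → pat D v ≡ κ → d' ≁ v
          off = d'≁ s' s (far-sym f) (a , b)
        ... | inj₂ n with pairCC s' s″ h n
        ... | (_ , e) , (_ , k) = p5 z' y″ z y' z″ (~s k) d (~s b) e (≁s (zz f)) (≁s (yz s')) (zz h) (≁s n) (yz s″) (zz g)

        cyc : ∀ {x z y x' z' y' x″ z″ y″} → Split x z y → Split x' z' y' → Split x″ z″ y″ →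
          Far x z x' z' → Far x z x″ z″ → Far x' z' x″ z″ → Full y x' z' → ⊥
        cyc {x} {z} {y} {x'} {z'} {y'} {x″} {z″} {y″} s s' s″ f g h c12 with pairOr s' s″ h
        ... | inj₂ c32 = star s' s s″ (far-sym f) h g c12 c32
        ... | inj₁ c23 with pairOr s s″ g
        ... | inj₁ c13 = star s″ s s' (far-sym g) (far-sym h) f c13 c23
        ... | inj₂ c31 with unsplit s' s (far-sym f) | unsplit s s″ g
        ... | inj₁ c21 | _ = star s s' s″ f g h c21 c31
        ... | inj₂ _ | inj₁ c13 = star s″ s s' (far-sym g) (far-sym h) f c13 c23
        ... | inj₂ (a , b) | inj₂ (c , d) with ~⊎≁ y y'
        ... | inj₂ n = clash (proj₁ (proj₂ (pairCC s s' f n))) a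
        ... | inj₁ e = p5 z x y y' x″ (~s (xz s)) (~s (yx s)) e (proj₁ c23) (≁s (yz s)) (≁s b) (zx g) (≁s a) (xx g) c

    three-splits : ∀ {d'} → d' ∈ D → (∀ {y} → pat D y ≡ κ′ → d' ~ y) →
      ∀ {x z y x' z' y' x″ z″ y″} → Split x z y → Split x' z' y' → Split x″ z″ y″ →
      Far x z x' z' → Far x z x″ z″ → Far x' z' x″ z″ → ⊥
    three-splits m d'~ s s' s″ f g h with pairOr s s' f
    ... | inj₁ c12 = cyc m d'~ s s' s″ f g h c12
    ... | inj₂ c21 = cyc m d'~ s' s s″ (far-sym f) h g c21

-- Components without a frame: refinement by boundedly many vertices.

module BoundedCase where
  open FreeGraphs
  open Dominating
  open Multipartite

  module Component (Γ : FreeGraph) (P : Vtx Γ → Set) (P? : ∀ v → Dec (P v)) (x : Vtx Γ) (px : P x) where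
    open Structure Γ

    C : V → Set
    C z = P z × Reach P x z

    C? : ∀ z → Dec (C z)
    C? z = reach? P? x z

    C-start : C x
    C-start = px , stop

    C-next : ∀ {u v} → C u → P v → u ~ v → C v
    C-next (pu , r) pv e = pv , reach-trans r (move _ e pv stop)

    private
      inside : ∀ {u v} → C u → Reach P u v → Reach C u v
      inside cu stop = stop
      inside cu (move w e pw r) = move w e (C-next cu pw e) (inside (C-next cu pw e) r)

    C-conn : ∀ {u v} → C u → C v → Reach C u v
    C-conn (pu , r) (pv , s) = inside (pu , r) (reach-trans (reach-sym px r) s)

  patterns : ℕ → List (List Bool)
  patterns zero = [] ∷ []
  patterns (suc n) = [] ∷ map (true ∷_) (patterns n) ++ map (false ∷_) (patterns n)

  patterns-complete : ∀ n (l : List Bool) → length l ≤ n → l ∈ patterns n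
  patterns-complete zero [] _ = here refl
  patterns-complete (suc n) [] _ = here refl
  patterns-complete (suc n) (true ∷ l) (s≤s h) = there (Memₚ.∈-++⁺ˡ (Memₚ.∈-map⁺ (true ∷_) (patterns-complete n l h)))
  patterns-complete (suc n) (false ∷ l) (s≤s h) =
    there (Memₚ.∈-++⁺ʳ (map (true ∷_) (patterns n)) (Memₚ.∈-map⁺ (false ∷_) (patterns-complete n l h)))

  pairs : ℕ → List (List Bool × List Bool)
  pairs n = concatMap (λ κ → map (κ ,_) (patterns n)) (patterns n)

  pairs-complete′ : ∀ n κ κ′ → length κ ≤ n → length κ′ ≤ n → (κ , κ′) ∈ pairs n
  pairs-complete′ n κ κ′ hκ hκ′ = Memₚ.∈-concatMap⁺ (λ κ → map (κ ,_) (patterns n))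
    (Any.map (λ { refl → Memₚ.∈-map⁺ (κ ,_) (patterns-complete n κ′ hκ′) }) (patterns-complete n κ hκ))

  abstract
    -- Abstract because the list has about 2^34 entries and must never be unfolded by the type
    -- checker.
    pattern-pairs : List (List Bool × List Bool)
    pattern-pairs = pairs 16

    pairs-complete : ∀ κ κ′ → length κ ≤ 16 → length κ′ ≤ 16 → (κ , κ′) ∈ pattern-pairs
    pairs-complete = pairs-complete′ 16

  -- The dominating set, and for each ordered pair of patterns at most two components with at most
  -- 16 refining vertices each.
  size-bound : ℕ
  size-bound = 16 + length pattern-pairs * 2 * 16

  module Bounded (Γ : FreeGraph) (x₀ : Vtx Γ)
    (noT : ∀ (v : Vec (Vtx Γ) 11) → Structure.Reach Γ (λ _ → ⊤) x₀ (Vec.head v) → TConfig Γ v → ⊥) where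
    open Structure Γ
    open Domination Γ
    open Patterns Γ

    private
      module B = Component Γ (λ _ → ⊤) (λ _ → yes tt) x₀ tt
      B : V → Set
      B = B.C
      B-next : ∀ {u v} → B u → u ~ v → B v
      B-next b e = B.C-next b tt e
      module BD = Connected B B.C? B.C-conn

      noActive : ∀ a b c d e → B a → let open Multi Γ (Vec.lookup (a ∷ b ∷ c ∷ d ∷ e ∷ [])) in Clique5 →
        ∀ {p₁ p₂ p₃} → Act p₁ → Act p₂ → Act p₃ → p₁ ~ p₂ → p₁ ~ p₃ → p₂ ~ p₃ → ⊥
      noActive a b c d e ba cl {p₁} {p₂} {p₃} (m₁ , a₁ , n₁ , e₁) (m₂ , a₂ , n₂ , e₂) (m₃ , a₃ , n₃ , e₃) f g h =
        noT (a ∷ b ∷ c ∷ d ∷ e ∷ p₁ ∷ a₁ ∷ p₂ ∷ a₂ ∷ p₃ ∷ a₃ ∷ []) (proj₂ ba)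
          (cl , ((m₁ , n₁ , e₁) , (m₂ , n₂ , e₂) , (m₃ , n₃ , e₃)) , f , g , h)

      -- A vertex of `M` misses at most one of the five, so it sees `a` or `b`. A neighbour outside
      -- `M` makes a member of `K` active, and three active members would be a frame. This leaves 2
      -- + 2 vertices.
      shorten : ∀ K → Clique K → All B K → Σ (List V) λ K₀ → length K₀ ≤ 4 × All B K₀ × (∀ x → B x → Cov K x → Cov K₀ x)
      shorten [] cl al = [] , z≤n , al , λ _ _ c → c
      shorten (a ∷ []) cl al = a ∷ [] , s≤s z≤n , al , λ _ _ c → c
      shorten (a ∷ b ∷ []) cl al = a ∷ b ∷ [] , s≤s (s≤s z≤n) , al , λ _ _ c → c
      shorten (a ∷ b ∷ c ∷ []) cl al = a ∷ b ∷ c ∷ [] , s≤s (s≤s (s≤s z≤n)) , al , λ _ _ c → c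
      shorten (a ∷ b ∷ c ∷ d ∷ []) cl al = a ∷ b ∷ c ∷ d ∷ [] , s≤s (s≤s (s≤s (s≤s z≤n))) , al , λ _ _ c → c
      shorten K@(a ∷ b ∷ c ∷ d ∷ e ∷ _) cl@((ab ∷ ac ∷ ad ∷ ae ∷ _) ∷ (bc ∷ bd ∷ be ∷ _) ∷ (cd ∷ ce ∷ _) ∷ (de ∷ _) ∷ _) al@(ba ∷ bb ∷ _) =
        a ∷ b ∷ filter act? K , s≤s (s≤s (≤2 (filter act? K) (Allₚ.all-filter act? K) (APₚ.filter⁺ act? cl))) ,
        ba ∷ bb ∷ Allₚ.filter⁺ act? al , covers
        where
        open Multi Γ (Vec.lookup (a ∷ b ∷ c ∷ d ∷ e ∷ []))
        qc : Clique5
        qc = five Γ a b c d e ab ac ad ae bc bd be cd ce de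
        ≤2 : ∀ Xs → All Act Xs → Clique Xs → length Xs ≤ 2
        ≤2 [] _ _ = z≤n
        ≤2 (_ ∷ []) _ _ = s≤s z≤n
        ≤2 (_ ∷ _ ∷ []) _ _ = s≤s (s≤s z≤n)
        ≤2 (p ∷ q ∷ r ∷ _) (ap ∷ aq ∷ ar ∷ _) ((pq ∷ pr ∷ _) ∷ (qr ∷ _) ∷ _) = ⊥-elim (noActive a b c d e ba qc ap aq ar pq pr qr)
        K⊆M : ∀ {k} → k ∈ K → M k
        K⊆M {k} m with k Fin.≟ a | k Fin.≟ b
        ... | yes refl | _ = M-q qc 0F
        ... | no _ | yes refl = M-q qc 1F
        ... | no na | no nb = 0F , 1F , (λ ()) , clique-~ cl m (here refl) na , clique-~ cl m (there (here refl)) nb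
        covers : ∀ x → B x → Cov K x → Cov (a ∷ b ∷ filter act? K) x
        covers x bx cv with M? x
        ... | yes mx with miss qc mx
        ... | m , h with m Fin.≟ 0F
        ... | yes refl = there (here (inj₂ (~s (h 1F λ ()))))
        ... | no n = here (inj₂ (~s (h 0F (n ∘ sym))))
        covers x bx cv | no nx with find cv
        ... | k , mk , inj₁ refl = ⊥-elim (nx (K⊆M mk))
        ... | k , mk , inj₂ e = there (there (Any.map (λ { refl → inj₂ e })
              (Memₚ.∈-filter⁺ act? mk (K⊆M mk , x , nx , ~s e))))

      dom : Σ (List V) λ D → length D ≤ 16 × All B D × BD.Dominates D
      dom = BD.total shorten x₀ B.C-start

      D : List V
      D = proj₁ dom
      D-len : length D ≤ 16
      D-len = proj₁ (proj₂ dom)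
      D-dom : BD.Dominates D
      D-dom = proj₂ (proj₂ (proj₂ dom))

      module Class (x : V) = Component Γ (λ w → pat D w ≡ pat D x) (λ w → pat? D w x) x refl

      infix 4 _⊑_
      _⊑_ : List V → List V → Set
      E ⊑ E' = ∀ e → e ∈ E → e ∈ E'

      -- E refines the component of x in its D-class into modules
      Handled : V → List V → Set
      Handled x E = ∀ u v y → Class.C x u → Class.C x v → u ~ v → pat E u ≡ pat E v →
        ¬ pat (D ++ E) y ≡ pat (D ++ E) u → y ~ u → y ~ v

      -- In a triangle-free component a dominating set leaves no edge within a class. Otherwise the
      -- component is complete multipartite and an edge within a class of `E` is complete to `E`; so
      -- `E` is chosen such that no vertex complete to it lies in a part with neighbours outside
      -- `M`.
      handle : ∀ x → B x → Σ (List V) λ E → length E ≤ 16 × All (Class.C x) E × Handled x E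
      handle x bx = go CD.triangleFree?
        where
        open Class x
        module CD = Connected C C? C-conn

        C⊆B : ∀ {u} → C u → B u
        C⊆B (_ , r) = tt , reach-trans (proj₂ bx) (reach-mono (λ _ → tt) r)

        centre : ∀ {u v} → C u → C v → u ~ v → ∃ λ e → e ∈ D × ∀ {w} → C w → e ~ w
        centre cu cv uv with find (D-dom (C⊆B cu) (C⊆B cv) uv)
        ... | e , m , eu = e , m , λ cw → pat-~ m (trans (proj₁ cu) (sym (proj₁ cw))) eu

        Result : Set
        Result = Σ (List V) λ E → length E ≤ 16 × All C E × Handled x E

        go : CD.TriangleFree ⊎ (∃ λ a → ∃ λ b → ∃ λ c → C a × C b × C c × a ~ b × a ~ c × b ~ c) → Result
        go (inj₁ tf) with CD.total sh x C-start
          where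
          sh : ∀ K → Clique K → All C K → Σ (List V) λ K₀ → length K₀ ≤ 4 × All C K₀ × (∀ x → C x → Cov K x → Cov K₀ x)
          sh [] cl al = [] , z≤n , al , λ _ _ c → c
          sh (a ∷ []) cl al = a ∷ [] , s≤s z≤n , al , λ _ _ c → c
          sh (a ∷ b ∷ []) cl al = a ∷ b ∷ [] , s≤s (s≤s z≤n) , al , λ _ _ c → c
          sh (a ∷ b ∷ c ∷ _) ((ab ∷ ac ∷ _) ∷ (bc ∷ _) ∷ _) (ca ∷ cb ∷ cc ∷ _) = ⊥-elim (tf ca cb cc ab ac bc)
        ... | E , lE , aE , dE = E , lE , aE , λ _ _ _ cu cv uv same _ _ → case find (dE cu cv uv) of λ where
                (e , m , eu) → ⊥-elim (tf (All.lookup aE m) cu cv eu (pat-~ m same eu) uv)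
        go (inj₂ (a , b , c , ca , cb , cc , ab , ac , bc)) with centre ca cb ab
        ... | e , _ , e~ = k4or (Finₚ.any? λ d → C? d ×-dec (d ~? a) ×-dec (d ~? b) ×-dec (d ~? c))
          where
          paw : CD.PawFree
          paw {a} {b} {c} {d} ca cb cc cd ab ac bc da db dc =
            k4 e a b c d (e~ ca) (e~ cb) (e~ cc) ab ac bc (~s (e~ cd)) da db dc
          multi : CD.Multipartite
          multi = CD.olariu paw ca cb cc ab ac bc

          keeps : ∀ {E u v} → All C E → C u → C v → u ~ v → pat E u ≡ pat E v → All (λ e' → e' ~ u × e' ~ v) E
          keeps {E} aE cu cv uv same = All.tabulate λ {e'} m →
            let eu = ¬≁ λ n → clash uv (multi cu (All.lookup aE m) cv (≁s n) (trans (sym (pat-∈ m same)) n)) in eu , pat-~ m same eu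

          k4or : Dec (∃ λ d → C d × d ~ a × d ~ b × d ~ c) → Result
          -- An edge complete to the triangle would give a clique on four vertices, so no edge
          -- remains to be looked at.
          k4or (no n) = a ∷ b ∷ c ∷ [] , s≤s (s≤s (s≤s z≤n)) , ca ∷ cb ∷ cc ∷ [] , λ u v _ cu cv uv same _ _ →
            case keeps (ca ∷ cb ∷ cc ∷ []) cu cv uv same of λ where
              ((au , _) ∷ (bu , _) ∷ (cu' , _) ∷ []) → ⊥-elim (n (u , cu , ~s au , ~s bu , ~s cu'))
          k4or (yes (d , cd , da , db , dc)) = choose (Finₚ.any? λ u → C? u ×-dec pa? u)
            where
            open Multi Γ (Vec.lookup (a ∷ b ∷ c ∷ d ∷ e ∷ []))
            qc : Clique5
            qc = five Γ a b c d e ab ac (~s da) (~s (e~ ca)) bc (~s db) (~s (e~ cb)) (~s dc) (~s (e~ cc)) (~s (e~ cd))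

            C⊆M : ∀ {u} → C u → M u
            C⊆M {u} cu with ~⊎≁ u a | ~⊎≁ u b | ~⊎≁ u c
            ... | inj₁ x | inj₁ y | _ = 0F , 1F , (λ ()) , x , y
            ... | inj₁ x | inj₂ _ | inj₁ y = 0F , 2F , (λ ()) , x , y
            ... | inj₂ _ | inj₁ x | inj₁ y = 1F , 2F , (λ ()) , x , y
            ... | inj₂ x | inj₂ y | _ = clash ab (multi ca cu cb (≁s x) y)
            ... | inj₂ x | inj₁ _ | inj₂ y = clash ac (multi ca cu cc (≁s x) y)
            ... | inj₁ _ | inj₂ x | inj₂ y = clash bc (multi cb cu cc (≁s x) y)

            -- u lies in the part of a vertex with neighbours outside M (p ≁ u includes p ≡ u)
            PA : V → Set
            PA u = ∃ λ p → Act p × p ≁ u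
            pa? : ∀ u → Dec (PA u)
            pa? u = Finₚ.any? λ p → act? p ×-dec (p ≁? u)

            lift~ : ∀ {p p' u u'} → Act p → Act p' → C u → C u' → p ≁ u → p' ≁ u' → u ~ u' → p ~ p'
            lift~ (mp , _) (mp' , _) cu cu' pu p'u' uu' =
              ~s (≁~-trans qc mp' (C⊆M cu') mp p'u' (~s (≁~-trans qc mp (C⊆M cu) (C⊆M cu') pu uu')))

            noPA3 : ∀ {u v w} → C u → C v → C w → PA u → PA v → PA w → u ~ v → u ~ w → v ~ w → ⊥
            noPA3 cu cv cw (p , ap , pu) (q , aq , qv) (r , ar , rw) uv uw vw = noActive a b c d e (C⊆B ca) qc ap aq ar
              (lift~ ap aq cu cv pu qv uv) (lift~ ap ar cu cw pu rw uw) (lift~ aq ar cv cw qv rw vw)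

            -- The part of `v` has no neighbours outside `M`, and inside `M` its vertices see
            -- exactly the other parts.
            twins : ∀ {y v} → M y → C v → ¬ PA v → y ≁ v → ∀ f → adj G f y ≡ adj G f v
            twins {y} {v} my cv nv yv f = adj-⇔
              (λ fy → ¬≁ λ fv → case M? f of λ where
                (yes mf) → clash fy (≁-trans qc mf (C⊆M cv) my fv (≁s yv))
                (no nf) → nv (y , (my , f , nf , fy) , yv))
              (λ fv → case M? f of λ where
                (yes mf) → ~s (≁~-trans qc my (C⊆M cv) mf yv (~s fv))
                (no nf) → ⊥-elim (nv (v , (C⊆M cv , f , nf , fv) , adj-irrefl G v)))

            -- A vertex `y` that sees `u` but not `v` is outside `M`, which makes `u` active, or it
            -- is a twin of `v` and then has the pattern of `u`.
            finish : ∀ E → length E ≤ 16 → All C E → (∀ u → C u → All (_~ u) E → ¬ PA u) → Result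
            finish E lE aE h = E , lE , aE , λ u v y cu cv uv same diff yu →
              let al = keeps aE cu cv uv same
                  nu = h u cu (All.map proj₁ al)
                  nv = h v cv (All.map proj₂ al) in
              ¬≁ λ yv → case M? y of λ where
                (no ny) → nu (u , (C⊆M cu , y , ny , yu) , adj-irrefl G u)
                (yes my) → diff (trans (pat-all (D ++ E) (λ {f} _ → twins my cv nv yv f))
                  (sym (trans (Listₚ.map-++ _ D E) (trans (cong₂ _++_ (trans (proj₁ cu) (sym (proj₁ cv))) same) (sym (Listₚ.map-++ _ D E))))))

            -- `E` is a maximal clique among the vertices with `PA`. By `noPA3` it has at most two
            -- members, and a further such vertex complete to it would enlarge it.
            choose : Dec (∃ λ u → C u × PA u) → Result
            choose (no n) = finish [] z≤n [] λ u cu _ pu → n (u , cu , pu)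
            choose (yes (u₁ , c₁ , p₁)) with Finₚ.any? (λ u → C? u ×-dec pa? u ×-dec (u₁ ~? u))
            ... | no n = finish (u₁ ∷ []) (s≤s z≤n) (c₁ ∷ []) λ { u cu (e₁ ∷ []) pu → n (u , cu , pu , e₁) }
            ... | yes (u₂ , c₂ , p₂ , e₁₂) = finish (u₁ ∷ u₂ ∷ []) (s≤s (s≤s z≤n)) (c₁ ∷ c₂ ∷ []) λ { u cu (e₁ ∷ e₂ ∷ []) pu →
                  noPA3 c₁ c₂ cu p₁ p₂ pu e₁₂ e₁ e₂ }

      module _ (κ κ′ : List Bool) (κ≢κ′ : κ ≢ κ′) where
        open ThreeSplits Γ D κ κ′ κ≢κ′

        BSplit : V → V → V → Set
        BSplit x z y = B x × Split x z y

        bsplit? : ∀ x z y → Dec (BSplit x z y)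
        bsplit? x z y = B.C? x ×-dec split? x z y

        close : ∀ {x z y x' z' y'} → Split x z y → Split x' z' y' → ¬ Far x' z' x z → Class.C x' x
        close {x} {z} {y} {x'} {z'} s s' nf with ~⊎≁ x' x | ~⊎≁ x' z | ~⊎≁ z' x | ~⊎≁ z' z
        ... | inj₁ e | _ | _ | _ = to (px s) , move x e (to (px s)) stop
          where to : ∀ {v} → pat D v ≡ κ → pat D v ≡ pat D x'
                to p = trans p (sym (px s'))
        ... | inj₂ _ | inj₁ e | _ | _ = to (px s) , move z e (to (pz s)) (move x (~s (xz s)) (to (px s)) stop)
          where to : ∀ {v} → pat D v ≡ κ → pat D v ≡ pat D x'
                to p = trans p (sym (px s'))
        ... | inj₂ _ | inj₂ _ | inj₁ e | _ = to (px s) , move z' (xz s') (to (pz s')) (move x e (to (px s)) stop)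
          where to : ∀ {v} → pat D v ≡ κ → pat D v ≡ pat D x'
                to p = trans p (sym (px s'))
        ... | inj₂ _ | inj₂ _ | inj₂ _ | inj₁ e = to (px s) , move z' (xz s') (to (pz s')) (move z e (to (pz s)) (move x (~s (xz s)) (to (px s)) stop))
          where to : ∀ {v} → pat D v ≡ κ → pat D v ≡ pat D x'
                to p = trans p (sym (px s'))
        ... | inj₂ a | inj₂ b | inj₂ c | inj₂ d = ⊥-elim (nf (mkFar a b c d))

        -- Split edges that are not far apart lie in one component, and `three-splits` forbids three
        -- that are pairwise far. The vertex of `D` required there is a dominator of the first
        -- splitting vertex.
        pick : Σ (List V) λ Xs → length Xs ≤ 2 × All B Xs × (∀ {x z y} → BSplit x z y → Any (λ x' → Class.C x' x) Xs)
        pick with Finₚ.any? (λ x → Finₚ.any? (λ z → Finₚ.any? (bsplit? x z)))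
        ... | no n = [] , z≤n , [] , λ {x} {z} {y} s → ⊥-elim (n (x , z , y , s))
        ... | yes (x₁ , z₁ , y₁ , b₁ , s₁) with Finₚ.any? (λ x → Finₚ.any? (λ z → Finₚ.any? (λ y → bsplit? x z y ×-dec far? x₁ z₁ x z)))
        ... | no n = x₁ ∷ [] , s≤s z≤n , b₁ ∷ [] , λ {x} {z} {y} s → here (close (proj₂ s) s₁ λ f → n (x , z , y , s , f))
        ... | yes (x₂ , z₂ , y₂ , (b₂ , s₂) , f₁₂) = x₁ ∷ x₂ ∷ [] , s≤s (s≤s z≤n) , b₁ ∷ b₂ ∷ [] , last
          where
          last : ∀ {x z y} → BSplit x z y → Any (λ x' → Class.C x' x) (x₁ ∷ x₂ ∷ [])
          last {x} {z} {y} (bx , s) with far? x₁ z₁ x z | far? x₂ z₂ x z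
          ... | no n | _ = here (close s s₁ n)
          ... | yes _ | no n = there (here (close s s₂ n))
          ... | yes f | yes g with find (D-dom (B-next b₁ (~s (yx s₁))) b₁ (yx s₁))
          ... | d , m , e = ⊥-elim (three-splits m (λ py' → pat-~ m (trans (py s₁) (sym py')) e) s₁ s₂ s f₁₂ f g)

      handleAll : ∀ Xs → All B Xs → Σ (List V) λ E → length E ≤ length Xs * 16 ×
        (∀ {x} → x ∈ Xs → Σ (List V) λ E' → E' ⊑ E × Handled x E') ×
        (∀ {e} → e ∈ E → ∃ λ x → Class.C x e × Σ (List V) λ E' → e ∈ E' × E' ⊑ E × Handled x E')
      handleAll [] _ = [] , z≤n , (λ ()) , (λ ())
      handleAll (x ∷ Xs) (bx ∷ aL) with handle x bx | handleAll Xs aL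
      ... | E₁ , l₁ , a₁ , h₁ | E₂ , l₂ , h₂ , k₂ = E₁ ++ E₂ ,
        subst (_≤ 16 + length Xs * 16) (sym (Listₚ.length-++ E₁)) (ℕₚ.+-mono-≤ l₁ l₂) ,
        (λ { (here refl) → E₁ , (λ _ q → Memₚ.∈-++⁺ˡ q) , h₁
           ; (there m) → let (E' , sub , h) = h₂ m in E' , (λ e q → Memₚ.∈-++⁺ʳ E₁ (sub e q)) , h }) ,
        λ m → case Memₚ.∈-++⁻ E₁ m of λ where
          (inj₁ m₁) → x , All.lookup a₁ m₁ , E₁ , m₁ , (λ _ q → Memₚ.∈-++⁺ˡ q) , h₁
          (inj₂ m₂) → let (x' , c , E' , e , sub , h) = k₂ m₂ in x' , c , E' , e , (λ e q → Memₚ.∈-++⁺ʳ E₁ (sub e q)) , h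

      reps : ∀ ps → Σ (List V) λ Xs → length Xs ≤ length ps * 2 × All B Xs ×
        (∀ {κ κ′} (n : κ ≢ κ′) → (κ , κ′) ∈ ps → ∀ {x z y} → BSplit κ κ′ n x z y → ∃ λ x' → x' ∈ Xs × Class.C x' x)
      reps [] = [] , z≤n , [] , λ _ ()
      reps ((κ , κ′) ∷ ps) with reps ps | Listₚ.≡-dec Bool._≟_ κ κ′
      ... | Xs , l , a , h | yes refl = Xs , ℕₚ.≤-trans l (ℕₚ.m≤n+m _ 2) , a ,
            λ { n (here refl) _ → ⊥-elim (n refl) ; n (there m) s → h n m s }
      ... | Xs , l , a , h | no n₀ with pick κ κ′ n₀
      ... | Xs' , l' , a' , h' = Xs' ++ Xs , subst (_≤ 2 + length ps * 2) (sym (Listₚ.length-++ Xs')) (ℕₚ.+-mono-≤ l' l) , Allₚ.++⁺ a' a ,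
            λ { n (here refl) (b , s) → let (x' , m , c) = find (h' (b , conv n s)) in x' , Memₚ.∈-++⁺ˡ m , c
              ; n (there m) s → let (x' , m' , c) = h n m s in x' , Memₚ.∈-++⁺ʳ Xs' m' , c }
        where
        conv : ∀ n {x z y} → ThreeSplits.Split Γ D κ κ′ n x z y → ThreeSplits.Split Γ D κ κ′ n₀ x z y
        conv n (ThreeSplits.mkSplit a b c d e f) = ThreeSplits.mkSplit a b c d e f

    splitter : Σ (List V) λ E → length E ≤ size-bound × BD.Dominates E ×
      (∀ {u v y} → B u → u ~ v → pat E u ≡ pat E v → ¬ pat E y ≡ pat E u → y ~ u → y ~ v)
    splitter with reps pattern-pairs
    ... | Xs , lL , aL , hL with handleAll Xs aL
    ... | E , lE , hE , kE = D ++ E ,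
      subst (_≤ size-bound) (sym (Listₚ.length-++ D)) (ℕₚ.+-mono-≤ D-len (ℕₚ.≤-trans lE (ℕₚ.*-monoˡ-≤ 16 lL))) ,
      (λ cx cz e → Anyₚ.++⁺ˡ (D-dom cx cz e)) , main
      where
      lenpat : ∀ v → length (pat D v) ≤ 16
      lenpat v = subst (_≤ 16) (sym (Listₚ.length-map _ D)) D-len

      handled : ∀ {x z y} → B x → x ~ z → pat D x ≡ pat D z → ¬ pat D y ≡ pat D x → y ~ x → y ≁ z →
        ∃ λ x' → Class.C x' x × Σ (List V) λ E' → E' ⊑ E × Handled x' E'
      handled {x} {z} {y} bx xz p n yx yz with hL {pat D x} {pat D y} (λ q → n (sym q)) (pairs-complete _ _ (lenpat x) (lenpat y))
        (bx , ThreeSplits.mkSplit refl (sym p) refl xz yx yz)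
      ... | x' , m , c = x' , c , hE m

      subD : ∀ {u v} → pat (D ++ E) u ≡ pat (D ++ E) v → pat D u ≡ pat D v
      subD = pat-sub {D} Memₚ.∈-++⁺ˡ

      main : ∀ {u v y} → B u → u ~ v → pat (D ++ E) u ≡ pat (D ++ E) v → ¬ pat (D ++ E) y ≡ pat (D ++ E) u → y ~ u → y ~ v
      main {u} {v} {y} bu uv same diff yu = ¬≁ λ yv → split yv (pat? D y u)
        where
        module _ (yv : y ≁ v) (x' : V) (cu : Class.C x' u) (E' : List V) (sub : E' ⊑ E) (h : Handled x' E') where
          cv : Class.C x' v
          cv = Class.C-next x' cu (trans (sym (subD same)) (proj₁ cu)) uv
          sameE' : pat E' u ≡ pat E' v
          sameE' = pat-sub {E'} (λ m → Memₚ.∈-++⁺ʳ D (sub _ m)) same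
          no-diff : ¬ pat (D ++ E') y ≡ pat (D ++ E') u → ⊥
          no-diff n = clash (h u v y cu cv uv sameE' n yu) yv

        split : y ≁ v → Dec (pat D y ≡ pat D u) → ⊥
        split yv (no n) with handled bu uv (subD same) n yu yv
        ... | x' , cu , E' , sub , h = no-diff yv x' cu E' sub h λ q → n (pat-sub {D} Memₚ.∈-++⁺ˡ q)
        -- Now `y` lies in the component of `u`, and the two are told apart only by some `e` in `E`,
        -- which was itself taken from a handled component.
        split yv (yes p) with differ (D ++ E) diff
        ... | e , m , ne with Memₚ.∈-++⁻ D m
        ... | inj₁ mD = ne (pat-∈ mD p)
        ... | inj₂ mE = viaE (pat? D e u)
          where
          viaE : Dec (pat D e ≡ pat D u) → ⊥
          -- `e` sees exactly one of `u` and `y`, so it belongs to their component, and this is the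
          -- handled component that supplied `e`.
          viaE (yes q) with kE mE
          ... | x″ , ce , E' , eE' , sub , h = no-diff yv x″ cu E' sub h λ r → ne (pat-∈ (Memₚ.∈-++⁺ʳ D eE') r)
            where
            py = trans p (trans (sym q) (proj₁ ce))
            pu = trans (sym q) (proj₁ ce)
            cu : Class.C x″ u
            cu with ≢-split ne
            ... | inj₁ (ey , _) = Class.C-next x″ (Class.C-next x″ ce py ey) pu yu
            ... | inj₂ (_ , eu) = Class.C-next x″ ce pu eu
          -- In another `D`-class, `e` splits the edge between `u` and `y`, and the component was
          -- handled for that reason.
          viaE (no q) with h'
            where
            h' : ∃ λ x' → Class.C x' u × Σ (List V) λ E' → E' ⊑ E × Handled x' E'
            h' with ≢-split ne
            ... | inj₂ (ey , eu) = handled bu (~s yu) (sym p) q eu ey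
            ... | inj₁ (ey , eu) with handled (B-next bu (~s yu)) yu p (λ r → q (trans r p)) ey eu
            ... | x' , cy , r = x' , Class.C-next x' cy (trans (sym p) (proj₁ cy)) yu , r
          ... | x' , cu , E' , sub , h with pat? E' y u
          ... | no r = no-diff yv x' cu E' sub h λ s → r (pat-sub {E'} (Memₚ.∈-++⁺ʳ D) s)
          -- Since `E'` does not separate `y` from `u`, the edge between them is an instance of
          -- `Handled`, and `e` sees both ends or neither.
          ... | yes r = ne (adj-⇔ (λ ey → h y u e cy cu yu r (λ s → q (trans (pat-sub {D} Memₚ.∈-++⁺ˡ s) p)) ey)
                                  (λ eu → h u y e cu cy (~s yu) (sym r) (λ s → q (pat-sub {D} Memₚ.∈-++⁺ˡ s)) eu))
            where
            cy : Class.C x' y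
            cy = Class.C-next x' cu (trans p (proj₁ cu)) (~s yu)

-- Components with a frame: blocks over the parts of `M`.

module Frames where
  open FreeGraphs
  open Dominating
  open Multipartite

  data Kind : Set where
    inM inA inR : Kind

  -- three parts of M with neighbours outside M: enough to split the whole component into blocks, one for each part
  record Frame (Γ : FreeGraph) : Set where
    open Structure Γ
    field
      q : Fin 5 → V
      p a : Fin 3 → V
      qc : Multi.Clique5 Γ q
      mp : ∀ i → Multi.M Γ q (p i)
      na : ∀ i → ¬ Multi.M Γ q (a i)
      ap : ∀ i → a i ~ p i
      pp : ∀ i j → i ≢ j → p i ~ p j

  module TFacts (Γ : FreeGraph) (cf : Frame Γ) where
    open Structure Γ
    open Frame cf
    open Multi Γ q
    open Patterns Γ

    B : V → Set
    B = Reach (λ _ → ⊤) (q 0F)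

    Foot : V → V → Set
    Foot v x = ¬ M v × M x × v ~ x

    InA InR : V → Set
    InA v = ∃ (Foot v)
    InR v = ¬ M v × ∀ x → M x → v ≁ x

    private
      0' 1' 2' : Fin 3
      0' = zero
      1' = suc zero
      2' = suc (suc zero)

      -- The three `p i` lie in different parts, and each of `x` and `y` can share its part with at
      -- most one of them.
      third : ∀ {x y} → M x → M y → ∃ λ i → p i ~ x × p i ~ y
      third {x} {y} mx my with ~⊎≁ (p 0') x | ~⊎≁ (p 0') y | ~⊎≁ (p 1') x | ~⊎≁ (p 1') y | ~⊎≁ (p 2') x | ~⊎≁ (p 2') y
      ... | inj₁ e | inj₁ f | _ | _ | _ | _ = 0' , e , f
      ... | _ | _ | inj₁ e | inj₁ f | _ | _ = 1' , e , f
      ... | _ | _ | _ | _ | inj₁ e | inj₁ f = 2' , e , f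
      ... | inj₂ e | _ | inj₂ f | _ | _ | _ = clash (pp 0' 1' λ ()) (≁-trans qc (mp 0') mx (mp 1') e (≁s f))
      ... | inj₂ e | _ | _ | _ | inj₂ f | _ = clash (pp 0' 2' λ ()) (≁-trans qc (mp 0') mx (mp 2') e (≁s f))
      ... | _ | _ | inj₂ e | _ | inj₂ f | _ = clash (pp 1' 2' λ ()) (≁-trans qc (mp 1') mx (mp 2') e (≁s f))
      ... | _ | inj₂ e | _ | inj₂ f | _ | _ = clash (pp 0' 1' λ ()) (≁-trans qc (mp 0') my (mp 1') e (≁s f))
      ... | _ | inj₂ e | _ | _ | _ | inj₂ f = clash (pp 0' 2' λ ()) (≁-trans qc (mp 0') my (mp 2') e (≁s f))
      ... | _ | _ | _ | inj₂ e | _ | inj₂ f = clash (pp 1' 2' λ ()) (≁-trans qc (mp 1') my (mp 2') e (≁s f))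

      off : ∀ {v x y} → Foot v x → M y → x ~ y → v ≁ y
      off (nv , mx , vx) my xy = other-part qc nv mx my vx xy

      -- If `x` misses both `v` and `w`, the path `w v pv px x` is induced. If it sees just one of
      -- them, the path through `x` and `px` ends in a common neighbour `n` of the feet.
      extend : ∀ {v w x pv pw px} → Foot v pv → Foot w pw → Foot x px → v ~ w →
        pv ~ pw → pv ~ px → pw ~ px → x ~ v × x ~ w
      extend {v} {w} {x} {pv} {pw} {px} fv@(nv , mv , vp) fw@(nw , mw , wp) fx@(nx , mx , xp) vw e f g with common qc mv mw mx
      ... | n , _ , mn , _ , _ , (nv' , nw' , nx') , _ with ~⊎≁ x v | ~⊎≁ x w
      ... | inj₁ xv | inj₁ xw = xv , xw
      ... | inj₂ xv | inj₂ xw = ⊥-elim (p5 w v pv px x (~s vw) vp f (~s xp) (off fw mv (~s e)) (off fw mx g) (≁s xw)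
              (off fv mx f) (≁s xv) (≁s (off fx mv (~s f))))
      ... | inj₁ xv | inj₂ xw = ⊥-elim (p5 w v x px n (~s vw) (~s xv) xp (~s nx') (≁s xw) (off fw mx g) (off fw mn (~s nw'))
              (off fv mx f) (off fv mn (~s nv')) (off fx mn (~s nx')))
      ... | inj₂ xv | inj₁ xw = ⊥-elim (p5 v w x px n vw (~s xw) xp (~s nx') (≁s xv) (off fv mx f) (off fv mn (~s nv'))
              (off fw mx g) (off fw mn (~s nw')) (off fx mn (~s nx')))

      foot-a : ∀ i → Foot (a i) (p i)
      foot-a i = na i , mp i , ap i

      on-triangle : ∀ {v w x z pv pw px pz} → Foot v pv → Foot w pw → Foot x px → Foot z pz →
        pv ~ pw → pv ~ px → pw ~ px → v ~ w → v ~ x → pz ~ pv → z ~ v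
      on-triangle {pw = pw} {px} {pz} fv fw fx fz e f g vw vx h with ~⊎≁ pz pw | ~⊎≁ pz px
      ... | inj₁ k | _ = proj₁ (extend fv fw fz vw e (~s h) (~s k))
      ... | inj₂ _ | inj₁ k = proj₁ (extend fv fx fz vx f (~s h) (~s k))
      ... | inj₂ k | inj₂ l = clash g (≁-trans qc (proj₁ (proj₂ fw)) (proj₁ (proj₂ fz)) (proj₁ (proj₂ fx)) (≁s k) l)

      via-triangle : ∀ {v w x y z pv pw px py pz} → Foot v pv → Foot w pw → Foot x px → Foot y py → Foot z pz →
        pv ~ pw → pv ~ px → pw ~ px → v ~ w → v ~ x → py ~ pz → pv ~ py → pv ~ pz → y ~ z
      via-triangle fv fw fx fy fz e f g vw vx yz h k =
        ~s (proj₁ (extend fy fv fz (on-triangle fv fw fx fy e f g vw vx (~s h)) (~s h) yz k))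

      -- `extend` enlarges the edge to a triangle with feet in three parts. One corner has its foot
      -- in a part different from those of `y` and `z`, and it forces the edge between them. So one
      -- bit describes all adjacencies between neighbours of different parts.
      cross-all : ∀ {v w pv pw y z py pz} → Foot v pv → Foot w pw → pv ~ pw → v ~ w →
        Foot y py → Foot z pz → py ~ pz → y ~ z
      cross-all {v} {w} {pv} {pw} {y} {z} {py} {pz} fv@(_ , mv , _) fw@(_ , mw , _) e vw fy@(_ , my , _) fz@(_ , mz , _) yz
        with third mv mw
      ... | i , f , g with extend fv fw (foot-a i) vw e (~s f) (~s g)
      ... | xv , xw with ~⊎≁ pv py | ~⊎≁ pv pz | ~⊎≁ pw py | ~⊎≁ pw pz | ~⊎≁ (p i) py | ~⊎≁ (p i) pz
      ... | inj₁ h | inj₁ k | _ | _ | _ | _ = via-triangle fv fw (foot-a i) fy fz e (~s f) (~s g) vw (~s xv) yz h k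
      ... | _ | _ | inj₁ h | inj₁ k | _ | _ = via-triangle fw fv (foot-a i) fy fz (~s e) (~s g) (~s f) (~s vw) (~s xw) yz h k
      ... | _ | _ | _ | _ | inj₁ h | inj₁ k = via-triangle (foot-a i) fv fw fy fz f g e xv xw yz h k
      ... | inj₂ h | _ | inj₂ k | _ | _ | _ = clash e (≁-trans qc mv my mw h (≁s k))
      ... | inj₂ h | _ | _ | _ | inj₂ k | _ = clash f (≁-trans qc (mp i) my mv k (≁s h))
      ... | _ | _ | inj₂ h | _ | inj₂ k | _ = clash g (≁-trans qc (mp i) my mw k (≁s h))
      ... | _ | inj₂ h | _ | inj₂ k | _ | _ = clash e (≁-trans qc mv mz mw h (≁s k))
      ... | _ | inj₂ h | _ | _ | _ | inj₂ k = clash f (≁-trans qc (mp i) mz mv k (≁s h))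
      ... | _ | _ | _ | inj₂ h | _ | inj₂ k = clash g (≁-trans qc (mp i) mz mw k (≁s h))

      joined : ∀ {u v w pv pw} → InR u → Foot v pv → Foot w pw → pv ~ pw → u ~ v → u ~ w × v ~ w
      joined {u} {v} {w} {pv} {pw} (nu , ru) fv@(nv , mv , vp) fw@(nw , mw , wp) e uv with common qc mv mw mw
      ... | n , _ , mn , _ , _ , (nv' , nw' , _) , _ with ~⊎≁ u w | ~⊎≁ v w
      ... | inj₁ h | inj₁ k = h , k
      ... | inj₂ h | inj₂ k = ⊥-elim (p5 u v pv pw w uv vp e (~s wp) (ru _ mv) (ru _ mw) h (off fv mw e) k (≁s (off fw mv (~s e))))
      ... | inj₂ h | inj₁ k = ⊥-elim (p5 u v w pw n uv k wp (~s nw') h (ru _ mw) (ru _ mn) (off fv mw e) (off fv mn (~s nv')) (off fw mn (~s nw')))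
      ... | inj₁ h | inj₂ k = ⊥-elim (p5 v u w pw n (~s uv) h wp (~s nw') k (off fv mw e) (off fv mn (~s nv')) (ru _ mw) (ru _ mn) (off fw mn (~s nw')))

      joined-all : ∀ {u v pv} → InR u → Foot v pv → u ~ v → ∀ {w} → InA w → u ~ w
      joined-all {u} {v} {pv} ru fv uv {w} (pw , fw) with third (proj₁ (proj₂ fv)) (proj₁ (proj₂ fw))
      ... | i , f , g = proj₁ (joined ru (foot-a i) fw g (proj₁ (joined ru fv (foot-a i) (~s f) uv)))

      inA? : ∀ v → Dec (∃ λ x → M x × v ~ x)
      inA? v = Finₚ.any? λ x → M? x ×-dec (v ~? x)

    abstract
      kind-of : ∀ v → M v ⊎ InA v ⊎ InR v
      kind-of v with M? v | inA? v
      ... | yes m | _ = inj₁ m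
      ... | no n | yes (x , mx , e) = inj₂ (inj₁ (x , n , mx , e))
      ... | no n | no h = inj₂ (inj₂ (n , λ x mx → ¬~ λ e → h (x , mx , e)))

    private
      NearA : V → Set
      NearA u = InR u → ∃ λ v → InA v × u ~ v

      -- No vertex of the component is further away from `M`: the path from `v` over `u`, `w` and
      -- its foot to a neighbour `n` of the foot would be induced.
      nearA : ∀ {u} → B u → NearA u
      nearA r = reach-pres NearA next tt r λ (n , _) → ⊥-elim (n (M-q qc 0F))
        where
        next : ∀ {u v} → ⊤ → ⊤ → u ~ v → NearA u → NearA v
        next {u} {v} _ _ uv h rv@(nv , hv) with kind-of u
        ... | inj₁ mu = clash (~s uv) (hv u mu)
        ... | inj₂ (inj₁ au) = u , au , ~s uv
        ... | inj₂ (inj₂ ru@(nu , hu)) with h ru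
        ... | w , aw@(pw , fw@(nw , mw , wp)) , uw with ~⊎≁ v w
        ... | inj₁ vw = w , aw , vw
        ... | inj₂ vw with common qc mw mw mw
        ... | n , _ , mn , _ , _ , (nw' , _) , _ = ⊥-elim (p5 v u w pw n (~s uv) uw wp (~s nw') vw (hv _ mw) (hv _ mn)
              (hu _ mw) (hu _ mn) (off fw mn (~s nw')))

    R-A : ∀ {u w} → B u → InR u → InA w → u ~ w
    R-A bu ru aw with nearA bu ru
    ... | v , (pv , fv) , uv = joined-all ru fv uv aw

    Home : V → V → Set
    Home v x = M x × (v ≡ x ⊎ (¬ M v × v ~ x))

    Linked : V → V → Set
    Linked x z = ∃ λ y → ∃ λ y' → Home x y × Home z y' × y ≁ y'

    -- On `M` the relation `_≁_` means lying in the same part, so linked vertices have their homes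
    -- in one part. The vertices without a neighbour in `M` form one further block.
    Eq : V → V → Set
    Eq x z = Linked x z ⊎ (InR x × InR z)

    private
      home? : ∀ v x → Dec (Home v x)
      home? v x = M? x ×-dec ((v Fin.≟ x) ⊎-dec (¬? (M? v) ×-dec (v ~? x)))

      inR? : ∀ v → Dec (InR v)
      inR? v = ¬? (M? v) ×-dec Finₚ.all? λ x → M? x →-dec (v ≁? x)

    abstract
      eq? : ∀ x z → Dec (Eq x z)
      eq? x z = Finₚ.any? (λ y → Finₚ.any? λ y' → home? x y ×-dec home? z y' ×-dec (y ≁? y')) ⊎-dec (inR? x ×-dec inR? z)

    private
      home-≁ : ∀ {v x y} → Home v x → Home v y → x ≁ y
      home-≁ (_ , inj₁ refl) (_ , inj₁ refl) = adj-irrefl G _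
      home-≁ (m , inj₁ refl) (_ , inj₂ (n , _)) = ⊥-elim (n m)
      home-≁ (_ , inj₂ (n , _)) (m , inj₁ refl) = ⊥-elim (n m)
      home-≁ (mx , inj₂ (n , e)) (my , inj₂ (_ , f)) = one-part qc n mx my e f

      home-R : ∀ {v x} {A : Set} → Home v x → InR v → A
      home-R (m , inj₁ refl) (n , _) = ⊥-elim (n m)
      home-R (m , inj₂ (_ , e)) (_ , h) = clash e (h _ m)

      foot-home : ∀ {v x} → Foot v x → Home v x
      foot-home (n , m , e) = m , inj₂ (n , e)

      M-home : ∀ {v} → M v → Home v v
      M-home m = m , inj₁ refl

      linked-≁ : ∀ {x z y y'} → Linked x z → Home x y → Home z y' → y ≁ y'
      linked-≁ (u , u' , hu , hu' , e) hy hy' =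
        ≁-trans qc (proj₁ hy) (proj₁ hu) (proj₁ hy') (home-≁ hy hu) (≁-trans qc (proj₁ hu) (proj₁ hu') (proj₁ hy') e (home-≁ hu' hy'))

    eq-refl : ∀ x → Eq x x
    eq-refl x with kind-of x
    ... | inj₁ m = inj₁ (x , x , M-home m , M-home m , adj-irrefl G x)
    ... | inj₂ (inj₁ (y , f)) = inj₁ (y , y , foot-home f , foot-home f , adj-irrefl G y)
    ... | inj₂ (inj₂ r) = inj₂ (r , r)

    eq-sym : ∀ {x z} → Eq x z → Eq z x
    eq-sym (inj₁ (y , y' , h , h' , e)) = inj₁ (y' , y , h' , h , ≁s e)
    eq-sym (inj₂ (r , r')) = inj₂ (r' , r)

    eq-trans : ∀ {x y z} → Eq x y → Eq y z → Eq x z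
    eq-trans (inj₁ (u , u' , hu , hu' , e)) (inj₁ l@(w , w' , hw , hw' , f)) =
      inj₁ (u , w' , hu , hw' , ≁-trans qc (proj₁ hu) (proj₁ hu') (proj₁ hw') e (linked-≁ l hu' hw'))
    eq-trans (inj₁ (_ , _ , _ , h , _)) (inj₂ (r , _)) = home-R h r
    eq-trans (inj₂ (_ , r)) (inj₁ (_ , _ , h , _)) = home-R h r
    eq-trans (inj₂ (r , _)) (inj₂ (_ , r')) = inj₂ (r , r')

    -- By `cross-all` the bit read off from the frame is as good as that of any two neighbours of
    -- different parts.
    value : Kind → Kind → Bool
    value inM inM = true
    value inA inA = adj G (a 0') (a 1')
    value inA inR = true
    value inR inA = true
    value _ _ = false

    kind : V → Kind
    kind v = [ (λ _ → inM) , [ (λ _ → inA) , (λ _ → inR) ]′ ]′ (kind-of v)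

    cross : ∀ {x z} → B x → B z → ¬ Eq x z → adj G x z ≡ value (kind x) (kind z)
    cross {x} {z} bx bz n with kind-of x | kind-of z
    ... | inj₁ mx | inj₁ mz = ¬≁ λ e → n (inj₁ (x , z , M-home mx , M-home mz , e))
    ... | inj₁ mx | inj₂ (inj₁ (y , nz , my , zy)) = ¬~ λ e → n (inj₁ (x , x , M-home mx , (mx , inj₂ (nz , ~s e)) , adj-irrefl G x))
    ... | inj₁ mx | inj₂ (inj₂ (nz , h)) = ≁s (h x mx)
    ... | inj₂ (inj₁ (y , nx , my , xy)) | inj₁ mz = ¬~ λ e → n (inj₁ (z , z , (mz , inj₂ (nx , e)) , M-home mz , adj-irrefl G z))
    ... | inj₂ (inj₁ (y , fx)) | inj₂ (inj₁ (y' , fz)) =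
          adj-⇔ (λ e → cross-all fx fz yy' e (foot-a 0') (foot-a 1') pp01) (λ e → cross-all (foot-a 0') (foot-a 1') pp01 e fx fz yy')
      where
      pp01 = pp 0' 1' λ ()
      yy' : y ~ y'
      yy' = ¬≁ λ e → n (inj₁ (y , y' , foot-home fx , foot-home fz , e))
    ... | inj₂ (inj₁ ax) | inj₂ (inj₂ rz) = ~s (R-A bz rz ax)
    ... | inj₂ (inj₂ (nx , h)) | inj₁ mz = h z mz
    ... | inj₂ (inj₂ rx) | inj₂ (inj₁ az) = R-A bx rx az
    ... | inj₂ (inj₂ rx) | inj₂ (inj₂ rz) = ⊥-elim (n (inj₂ (rx , rz)))

    private
      -- A failure is compared with some `a i` over another part. If `a i` misses `x`, the path
      -- `a i`, `p i`, `y`, `x`, `z` is induced. Otherwise `a i` sees `z` as well and is the end of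
      -- the induced path `y`, `m`, `pz`, `z`, `a i`.
      no-split : ∀ {x z pz y} → Linked x z → Foot z pz → x ~ z → Foot x y → y ~ z
      no-split {x} {z} {pz} {y} l fz@(nz , mz , zp) xz fx@(nx , my , xy) = ¬≁ λ yz → bad yz (third my mz)
        where
        ypz : y ≁ pz
        ypz = linked-≁ l (foot-home fx) (foot-home fz)
        bad : y ≁ z → (∃ λ i → p i ~ y × p i ~ pz) → ⊥
        bad yz (i , f , g) with ~⊎≁ (a i) x
        ... | inj₂ ax = p5 (a i) (p i) y x z (ap i) f (~s xy) xz (off (foot-a i) my f) ax
              (¬~ λ az → clash (cross-all (foot-a i) fz g az (foot-a i) fx f) ax)
              (≁s (off fx (mp i) (~s f))) (≁s (off fz (mp i) (~s g))) yz
        ... | inj₁ ax with common qc my mz (mp i)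
        ... | m , _ , mm , _ , _ , (my' , mz' , mi') , _ = p5 y m pz z (a i) (~s my') mz' (~s zp)
              (~s (cross-all (foot-a i) fx f ax (foot-a i) fz g)) ypz yz (≁s (off (foot-a i) my f))
              (≁s (off fz mm (~s mz'))) (≁s (off (foot-a i) mm (~s mi'))) (≁s (off (foot-a i) mz g))

    -- The pattern over the clique reveals membership in `M`: two neighbours there or at most one.
    Q : List V
    Q = tabulate q

    private
      q∈Q : ∀ i → q i ∈ Q
      q∈Q i = Memₚ.∈-tabulate⁺ {f = q} i

      pat-M : ∀ {x z} → pat Q x ≡ pat Q z → M x → M z
      pat-M e (i , j , n , f , g) = i , j , n , ~s (pat-~ (q∈Q i) e (~s f)) , ~s (pat-~ (q∈Q j) e (~s g))

      pat-Q : ∀ {x z} → (∀ i → adj G (q i) x ≡ adj G (q i) z) → pat Q x ≡ pat Q z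
      pat-Q h = pat-all Q λ m → let (i , e) = Memₚ.∈-tabulate⁻ {f = q} m in subst (λ v → adj G v _ ≡ adj G v _) (sym e) (h i)

      foot-Linked : ∀ {x y z} → Linked x z → Foot x y → ¬ M z → ∃ λ pz → Foot z pz
      foot-Linked (u , u' , hu , (m , inj₁ refl) , e) fx nz = ⊥-elim (nz m)
      foot-Linked (u , u' , hu , (m , inj₂ (n , f)) , e) fx nz = u' , n , m , f

      Eq-A : ∀ {x z} → Eq x z → InA x → Linked x z
      Eq-A (inj₁ l) _ = l
      Eq-A (inj₂ (r , _)) (_ , f) = home-R (foot-home f) r

      Eq-R : ∀ {x z} → Eq x z → InR x → InR z
      Eq-R (inj₁ (_ , _ , h , _)) r = home-R h r
      Eq-R (inj₂ (_ , r)) _ = r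

      link-sym : ∀ {x z} → Linked x z → Linked z x
      link-sym (y , y' , h , h' , e) = y' , y , h' , h , ≁s e

      M-edge : ∀ {x z} → Eq x z → pat Q x ≡ pat Q z → M x → x ~ z → ⊥
      M-edge {x} {z} (inj₁ l) e m xz = clash xz (linked-≁ l (M-home m) (M-home (pat-M e m)))
      M-edge (inj₂ ((n , _) , _)) e m xz = n m

    -- A part is independent, and the vertices beyond the neighbours of `M` all have the pattern
    -- without a `true`. Next to `M`, adjacent vertices of a block have the same feet, hence the
    -- same pattern unless one of them is in `M`.
    block-split : ∀ {x z y} → Eq x z → Eq x y → x ~ z → pat Q x ≡ pat Q z → ¬ pat Q y ≡ pat Q x → y ~ x → y ~ z
    block-split {x} {z} {y} exz exy xz same diff yx with kind-of x
    ... | inj₁ m = ⊥-elim (M-edge exz same m xz)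
    ... | inj₂ (inj₂ r) = ⊥-elim (diff (pat-Q λ i → trans (≁s (proj₂ (Eq-R exy r) _ (M-q qc i))) (sym (≁s (proj₂ r _ (M-q qc i))))))
    ... | inj₂ (inj₁ ax@(px , fx)) with foot-Linked (Eq-A exz ax) fx (λ m → proj₁ fx (pat-M (sym same) m)) | M? y
    ... | pz , fz | yes my = no-split (Eq-A exz ax) fz xz (proj₁ fx , my , ~s yx)
    ... | pz , fz | no ny with foot-Linked (Eq-A exy ax) fx ny
    ... | py , fy = ⊥-elim (diff (pat-Q λ i → adj-⇔
          (λ e → no-split (link-sym (Eq-A exy ax)) fx yx (ny , M-q qc i , ~s e))
          (λ e → no-split (Eq-A exy ax) fy (~s yx) (proj₁ fx , M-q qc i , ~s e))))

    -- A foot of `x` is passed on along walks by `no-split`. The vertices without neighbours in `M`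
    -- are all seen by `a 0'`.
    block-centre : ∀ {x z} → B x → Eq x z → pat Q z ≡ pat Q x → x ~ z →
      ∃ λ d → ∀ {w} → Reach (λ w → (B w × Eq x w) × pat Q w ≡ pat Q x) x w → d ~ w
    block-centre {x} {z} bx exz same xz with kind-of x
    ... | inj₁ m = ⊥-elim (M-edge exz (sym same) m xz)
    ... | inj₂ (inj₂ r) = a 0' , λ s → ~s (R-A (proj₁ (proj₁ (end s))) (Eq-R (proj₂ (proj₁ (end s))) r) (p 0' , foot-a 0'))
      where
      end : ∀ {w} → Reach (λ w → (B w × Eq x w) × pat Q w ≡ pat Q x) x w → (B w × Eq x w) × pat Q w ≡ pat Q x
      end = reach-end ((bx , eq-refl x) , refl)
    ... | inj₂ (inj₁ ax@(px , fx@(nx , mpx , xpx))) = px , λ s → reach-pres (px ~_) next ((bx , eq-refl x) , refl) s (~s xpx)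
      where
      Blk : V → Set
      Blk w = (B w × Eq x w) × pat Q w ≡ pat Q x
      next : ∀ {u v} → Blk u → Blk v → u ~ v → px ~ u → px ~ v
      next {u} {v} ((_ , eu) , pu) ((_ , ev) , pv) uv e with foot-Linked (Eq-A ev ax) fx (λ m → nx (pat-M pv m))
      ... | _ , fv = no-split (Eq-A (eq-trans (eq-sym eu) ev) (px , fu)) fv uv fu
        where
        fu : Foot u px
        fu = (λ m → nx (pat-M pu m)) , mpx , ~s e

-- Gluing partial isomorphisms.

module Gluing where
  module _ {n : ℕ} (a c : Fin n) where
    swap : Fin n → Fin n
    swap z with z Fin.≟ a
    ... | yes _ = c
    ... | no _ with z Fin.≟ c
    ... | yes _ = a
    ... | no _ = z

    swap-cases : ∀ z → (z ≡ a × swap z ≡ c) ⊎ (z ≡ c × z ≢ a × swap z ≡ a) ⊎ (z ≢ a × z ≢ c × swap z ≡ z)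
    swap-cases z with z Fin.≟ a
    ... | yes p = inj₁ (p , refl)
    ... | no p with z Fin.≟ c
    ... | yes q = inj₂ (inj₁ (q , p , refl))
    ... | no q = inj₂ (inj₂ (p , q , refl))

    swap-invol : ∀ z → swap (swap z) ≡ z
    swap-invol z with swap-cases z
    ... | inj₂ (inj₂ (_ , _ , e)) = trans (cong swap e) e
    ... | inj₂ (inj₁ (refl , _ , e)) = trans (cong swap e) (a-c (swap-cases a))
      where
      a-c : _ → swap a ≡ c
      a-c (inj₁ (_ , e)) = e
      a-c (inj₂ (inj₁ (_ , n , _))) = ⊥-elim (n refl)
      a-c (inj₂ (inj₂ (n , _))) = ⊥-elim (n refl)
    ... | inj₁ (refl , e) = trans (cong swap e) (c-a (swap-cases c))
      where
      c-a : _ → swap c ≡ a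
      c-a (inj₁ (p , e)) = trans e p
      c-a (inj₂ (inj₁ (_ , _ , e))) = e
      c-a (inj₂ (inj₂ (_ , n , _))) = ⊥-elim (n refl)

  -- Total functions with arbitrary values off the two subsets: restricting a bijection changes the
  -- proofs but not the maps.
  record PBij {n m : ℕ} (A : Fin n → Set) (B : Fin m → Set) : Set where
    field
      to : Fin n → Fin m
      from : Fin m → Fin n
      to∈ : ∀ {x} → A x → B (to x)
      from∈ : ∀ {y} → B y → A (from y)
      from-to : ∀ {x} → A x → from (to x) ≡ x
      to-from : ∀ {y} → B y → to (from y) ≡ y
  open PBij public

  pbij-sym : ∀ {n m} {A : Fin n → Set} {B : Fin m → Set} → PBij A B → PBij B A
  pbij-sym f = record { to = from f ; from = to f ; to∈ = from∈ f ; from∈ = to∈ f ; from-to = to-from f ; to-from = from-to f }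

  pbij-trans : ∀ {n m k} {A : Fin n → Set} {B : Fin m → Set} {C : Fin k → Set} → PBij A B → PBij B C → PBij A C
  pbij-trans f g = record
    { to = to g ∘ to f ; from = from f ∘ from g ; to∈ = to∈ g ∘ to∈ f ; from∈ = from∈ f ∘ from∈ g
    ; from-to = λ a → trans (cong (from f) (from-to g (to∈ f a))) (from-to f a)
    ; to-from = λ c → trans (cong (to g) (to-from f (from∈ g c))) (to-from g c) }

  pbij-conv : ∀ {n m} {A A' : Fin n → Set} {B B' : Fin m → Set} → (∀ {x} → A' x → A x) → (∀ {x} → A x → A' x) →
    (∀ {y} → B' y → B y) → (∀ {y} → B y → B' y) → PBij A B → PBij A' B'
  pbij-conv p q r s f = record
    { to = to f ; from = from f ; to∈ = s ∘ to∈ f ∘ p ; from∈ = q ∘ from∈ f ∘ r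
    ; from-to = from-to f ∘ p ; to-from = to-from f ∘ r }

  pbij-swap : ∀ {n} {A : Fin n → Set} {a c} → A a → A c → PBij A A
  pbij-swap {A = A} {a} {c} pa pc = record
    { to = swap a c ; from = swap a c ; to∈ = keep ; from∈ = keep
    ; from-to = λ {x} _ → swap-invol a c x ; to-from = λ {x} _ → swap-invol a c x }
    where
    keep : ∀ {x} → A x → A (swap a c x)
    keep {x} ax with swap-cases a c x
    ... | inj₁ (_ , e) = subst A (sym e) pc
    ... | inj₂ (inj₁ (_ , _ , e)) = subst A (sym e) pa
    ... | inj₂ (inj₂ (_ , _ , e)) = subst A (sym e) ax

  record PIso (G H : Graph) (τ : Fin (size G) → Fin (size H) → Set) (A : Fin (size G) → Set) (B : Fin (size H) → Set) : Set where
    field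
      bij : PBij A B
      adj-pres : ∀ {x z} → A x → A z → adj H (to bij x) (to bij z) ≡ adj G x z
      type : ∀ {x} → A x → τ x (to bij x)
  open PIso public

  piso-conv : ∀ {G H τ} {A A' : Fin (size G) → Set} {B B' : Fin (size H) → Set} → (∀ {x} → A' x → A x) → (∀ {x} → A x → A' x) →
    (∀ {y} → B' y → B y) → (∀ {y} → B y → B' y) → PIso G H τ A B → PIso G H τ A' B'
  piso-conv p q r s f = record { bij = pbij-conv p q r s (bij f)
    ; adj-pres = λ a b → adj-pres f (p a) (p b) ; type = λ a → type f (p a) }

  piso-map : ∀ {G H τ τ' A B} → (∀ {x y} → τ x y → τ' x y) → PIso G H τ A B → PIso G H τ' A B
  piso-map h f = record { bij = bij f ; adj-pres = adj-pres f ; type = λ a → h (type f a) }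

  -- `zig` takes the place of symmetry and transitivity, which cannot be stated for a relation
  -- between two different vertex sets.
  module Partial (G H : Graph) (τ : Fin (size G) → Fin (size H) → Set)
    (zig : ∀ {x y x' y'} → τ x y → τ x' y → τ x' y' → τ x y') where
    private
      V = Fin (size G)
      W = Fin (size H)
      PI : (V → Set) → (W → Set) → Set
      PI = PIso G H τ

    zigzag : ∀ {A A' B B'} → PI A B → PI A' B → PI A' B' → PI A B'
    zigzag {A} {A'} f g h = record
      { bij = pbij-trans (bij f) (pbij-trans (pbij-sym (bij g)) (bij h))
      ; adj-pres = λ a b → trans (adj-pres h (g' a) (g' b))
          (trans (sym (trans (cong₂ (adj H) (sym (tf a)) (sym (tf b))) (adj-pres g (g' a) (g' b)))) (adj-pres f a b))
      ; type = λ a → zig (type f a) (subst (τ _) (tf a) (type g (g' a))) (type h (g' a)) }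
      where
      g' : ∀ {x} → A x → A' (from (bij g) (to (bij f) x))
      g' a = from∈ (bij g) (to∈ (bij f) a)
      tf : ∀ {x} → A x → to (bij g) (from (bij g) (to (bij f) x)) ≡ to (bij f) x
      tf a = to-from (bij g) (to∈ (bij f) a)

    module Glue (A : V → Set) (B : W → Set) (A? : ∀ x → Dec (A x))
      (E : V → V → Set) (E? : ∀ x z → Dec (E x z)) (E' : W → W → Set) (E'? : ∀ x z → Dec (E' x z))
      (erefl : ∀ {x} → A x → E x x) (esym : ∀ {x z} → A x → A z → E x z → E z x)
      (etrans : ∀ {x y z} → A x → A y → A z → E x y → E y z → E x z)
      (erefl' : ∀ {x} → B x → E' x x) (esym' : ∀ {x z} → B x → B z → E' x z → E' z x)
      (etrans' : ∀ {x y z} → B x → B y → B z → E' x y → E' y z → E' x z)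
      (cross : ∀ {x z y w} → A x → A z → B y → B w → τ x y → τ z w → ¬ E x z → ¬ E' y w → adj H y w ≡ adj G x z)
      where

      Block : V → V → Set
      Block x z = A z × E x z
      Block' : W → W → Set
      Block' y w = B w × E' y w

      Loc : V → W → Set
      Loc x y = PI (Block x) (Block' y)

      private
        loc-move : ∀ {x x' y y'} → A x → A x' → B y → B y' → E x x' → E' y y' → Loc x y → Loc x' y'
        loc-move ax ax' by by' e e' = piso-conv
          (λ (az , f) → az , etrans ax ax' az e f) (λ (az , f) → az , etrans ax' ax az (esym ax ax' e) f)
          (λ (bz , f) → bz , etrans' by by' bz e' f) (λ (bz , f) → bz , etrans' by' by bz (esym' by by' e') f)

        module Stage (A₁ : V → Set) (B₁ : W → Set) (A₁? : ∀ x → Dec (A₁ x)) (A₁⊆ : ∀ {x} → A₁ x → A x) (B₁⊆ : ∀ {y} → B₁ y → B y)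
          (closed : ∀ {x z} → A₁ x → A z → E x z → A₁ z) (closed' : ∀ {x z} → B₁ x → B z → E' x z → B₁ z) where

          Matching : Set
          Matching = Σ (PBij A₁ B₁) λ f → ∀ {x} → A₁ x → Loc x (to f x)

          module _ (x : V) (ax : A₁ x) (f₀ : Matching) where
            private
              y : W
              y = to (proj₁ f₀) x
              by : B₁ y
              by = to∈ (proj₁ f₀) ax
              g : Loc x y
              g = proj₂ f₀ ax

            -- For `a` in the block of `x` let `c` be the current preimage of its `g`-image; the
            -- images of `a` and `c` are exchanged. The new image of `c` is admissible because the
            -- blocks of `c`, of the `g`-image of `a`, of `a` and of its old image form a zigzag of
            -- isomorphisms.
            rectify : ∀ l → Σ Matching λ f → ∀ {z} → z ∈ l → Block x z → to (proj₁ f) z ≡ to (bij g) z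
            rectify [] = f₀ , λ ()
            rectify (a ∷ l) with rectify l | A₁? a ×-dec E? x a
            ... | f , h | no n = f , λ { (here refl) (az , e) → ⊥-elim (n (closed ax az e , e)) ; (there m) b → h m b }
            ... | (f , loc) , h | yes (aa , ea) = (f' , loc') , h'
              where
              ba : Block x a
              ba = A₁⊆ aa , ea
              ga : B₁ (to (bij g) a)
              ga = closed' by (proj₁ (to∈ (bij g) ba)) (proj₂ (to∈ (bij g) ba))
              c : V
              c = from f (to (bij g) a)
              ac : A₁ c
              ac = from∈ f ga
              fc : to f c ≡ to (bij g) a
              fc = to-from f ga
              f' : PBij A₁ B₁
              f' = pbij-trans (pbij-swap {A = A₁} aa ac) f
              loc-a : Loc a (to (bij g) a)
              loc-a = loc-move (A₁⊆ ax) (A₁⊆ aa) (B₁⊆ by) (B₁⊆ ga) ea (proj₂ (to∈ (bij g) ba)) g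
              loc' : ∀ {z} → A₁ z → Loc z (to f (swap a c z))
              loc' {z} az with swap-cases a c z
              ... | inj₁ (refl , e) = subst (Loc a) (sym (trans (cong (to f) e) fc)) loc-a
              ... | inj₂ (inj₁ (refl , _ , e)) = subst (Loc c) (sym (cong (to f) e)) (zigzag (subst (Loc c) fc (loc ac)) loc-a (loc aa))
              ... | inj₂ (inj₂ (_ , _ , e)) = subst (Loc z) (sym (cong (to f) e)) (loc az)
              h' : ∀ {z} → z ∈ a ∷ l → Block x z → to f (swap a c z) ≡ to (bij g) z
              h' {z} m bz with swap-cases a c z | m
              ... | inj₁ (refl , e) | _ = trans (cong (to f) e) fc
              ... | inj₂ (inj₁ (_ , n , _)) | here p = ⊥-elim (n p)
              ... | inj₂ (inj₂ (n , _)) | here p = ⊥-elim (n p)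
              -- If `c` was already in its place, then `g` sends `c` and `a` to the same vertex, so
              -- they are equal.
              ... | inj₂ (inj₁ (refl , n , e)) | there m' = ⊥-elim (n (trans (sym (from-to (bij g) bz))
                      (trans (cong (from (bij g)) (trans (sym (h m' bz)) fc)) (from-to (bij g) ba))))
              ... | inj₂ (inj₂ (_ , _ , e)) | there m' = trans (cong (to f) e) (h m' bz)

            -- The rectified bijection agrees with `g` on the block of `x`. It maps that block onto
            -- the block of `y` and therefore restricts to the complements.
            rest : PI (Block x) (Block' y) × Σ (PBij (λ z → A₁ z × ¬ E x z) (λ w → B₁ w × ¬ E' y w)) λ f → ∀ {z} → A₁ z × ¬ E x z → Loc z (to f z)
            rest with rectify (allFin (size G))
            ... | (f , loc) , h = g , record
              { to = to f ; from = from f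
              ; to∈ = λ {z} (az , n) → to∈ f az , λ e →
                  let bw = B₁⊆ (to∈ f az) , e
                      bz = from∈ (bij g) bw
                  in n (subst (E x) (trans (sym (from-to f (closed ax (proj₁ bz) (proj₂ bz))))
                       (trans (cong (from f) (trans (h (all-∈ _) bz) (to-from (bij g) bw))) (from-to f az))) (proj₂ bz))
              ; from∈ = λ {w} (bw , n) → from∈ f bw , λ e →
                  let bz = A₁⊆ (from∈ f bw) , e in
                  n (subst (E' y) (trans (sym (h (all-∈ _) bz)) (to-from f bw)) (proj₂ (to∈ (bij g) bz)))
              ; from-to = λ (az , _) → from-to f az
              ; to-from = λ (bw , _) → to-from f bw } , λ (az , _) → loc az
              where
              all-∈ : ∀ z → z ∈ allFin (size G)
              all-∈ = Memₚ.∈-allFin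

            combine : PI (λ z → A₁ z × ¬ E x z) (λ w → B₁ w × ¬ E' y w) → PI A₁ B₁
            combine h = record
              { bij = record { to = F ; from = F' ; to∈ = F∈ ; from∈ = F'∈ ; from-to = F'F ; to-from = FF' }
              ; adj-pres = pres ; type = ty }
              where
              F : V → W
              F z with E? x z
              ... | yes _ = to (bij g) z
              ... | no _ = to (bij h) z
              F' : W → V
              F' w with E'? y w
              ... | yes _ = from (bij g) w
              ... | no _ = from (bij h) w
              F∈ : ∀ {z} → A₁ z → B₁ (F z)
              F∈ {z} az with E? x z
              ... | yes e = let (b , e') = to∈ (bij g) (A₁⊆ az , e) in closed' by b e'
              ... | no n = proj₁ (to∈ (bij h) (az , n))
              F'∈ : ∀ {w} → B₁ w → A₁ (F' w)
              F'∈ {w} bw with E'? y w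
              ... | yes e = let (b , e') = from∈ (bij g) (B₁⊆ bw , e) in closed ax b e'
              ... | no n = proj₁ (from∈ (bij h) (bw , n))
              F'F : ∀ {z} → A₁ z → F' (F z) ≡ z
              F'F {z} az with E? x z
              F'F {z} az | yes e with E'? y (to (bij g) z)
              ... | yes _ = from-to (bij g) (A₁⊆ az , e)
              ... | no n = ⊥-elim (n (proj₂ (to∈ (bij g) (A₁⊆ az , e))))
              F'F {z} az | no n with E'? y (to (bij h) z)
              ... | yes e = ⊥-elim (proj₂ (to∈ (bij h) (az , n)) e)
              ... | no _ = from-to (bij h) (az , n)
              FF' : ∀ {w} → B₁ w → F (F' w) ≡ w
              FF' {w} bw with E'? y w
              FF' {w} bw | yes e with E? x (from (bij g) w)
              ... | yes _ = to-from (bij g) (B₁⊆ bw , e)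
              ... | no n = ⊥-elim (n (proj₂ (from∈ (bij g) (B₁⊆ bw , e))))
              FF' {w} bw | no n with E? x (from (bij h) w)
              ... | yes e = ⊥-elim (proj₂ (from∈ (bij h) (bw , n)) e)
              ... | no _ = to-from (bij h) (bw , n)
              ty : ∀ {z} → A₁ z → τ z (F z)
              ty {z} az with E? x z
              ... | yes e = type g (A₁⊆ az , e)
              ... | no n = type h (az , n)
              mixed : ∀ {z w} → A₁ z → E x z → A₁ w → ¬ E x w → adj H (to (bij g) z) (to (bij h) w) ≡ adj G z w
              mixed {z} {w} az e aw n = cross (A₁⊆ az) (A₁⊆ aw) (proj₁ gz) (B₁⊆ (proj₁ hw))
                (type g (A₁⊆ az , e)) (type h (aw , n))
                (λ f → n (etrans (A₁⊆ ax) (A₁⊆ az) (A₁⊆ aw) e f))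
                (λ f → proj₂ hw (etrans' (B₁⊆ by) (proj₁ gz) (B₁⊆ (proj₁ hw)) (proj₂ gz) f))
                where
                gz = to∈ (bij g) (A₁⊆ az , e)
                hw = to∈ (bij h) (aw , n)
              pres : ∀ {z w} → A₁ z → A₁ w → adj H (F z) (F w) ≡ adj G z w
              pres {z} {w} az aw with E? x z | E? x w
              ... | yes e | yes f = adj-pres g (A₁⊆ az , e) (A₁⊆ aw , f)
              ... | no e | no f = adj-pres h (az , e) (aw , f)
              ... | yes e | no f = mixed az e aw f
              ... | no e | yes f = trans (adj-sym H _ _) (trans (mixed aw f az e) (adj-sym G _ _))

        go : ∀ k A₁ B₁ (A₁? : ∀ x → Dec (A₁ x)) → (∀ {x} → A₁ x → A x) → (∀ {y} → B₁ y → B y) →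
          (∀ {x z} → A₁ x → A z → E x z → A₁ z) → (∀ {x z} → B₁ x → B z → E' x z → B₁ z) →
          (f : PBij A₁ B₁) → (∀ {x} → A₁ x → Loc x (to f x)) → cnt (λ x → does (A₁? x)) ≤ k → PI A₁ B₁
        go k A₁ B₁ A₁? sub sub' cl cl' f loc b with Finₚ.any? A₁?
        ... | no n = record { bij = f ; adj-pres = λ {x} a _ → ⊥-elim (n (x , a)) ; type = λ {x} a → ⊥-elim (n (x , a)) }
        ... | yes (x , ax) with Stage.rest A₁ B₁ A₁? sub sub' cl cl' x ax (f , loc)
        ... | g , f₂ , loc₂ = next k b
          where
          A₂? : ∀ z → Dec (A₁ z × ¬ E x z)
          A₂? z = A₁? z ×-dec ¬? (E? x z)
          less : cnt (λ z → does (A₂? z)) < cnt (λ z → does (A₁? z))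
          less = cnt-strict (λ z e → dec-true (A₁? z) (proj₁ (dec-yes (A₂? z) e))) x
            (dec-false (A₂? x) (λ (_ , n) → n (erefl (sub ax)))) (dec-true (A₁? x) ax)
          next : ∀ k → cnt (λ x → does (A₁? x)) ≤ k → PI A₁ B₁
          next zero b with ℕₚ.≤-trans less b
          ... | ()
          next (suc k) b = Stage.combine A₁ B₁ A₁? sub sub' cl cl' x ax (f , loc)
            (go k (λ z → A₁ z × ¬ E x z) (λ w → B₁ w × ¬ E' (to f x) w) A₂? (sub ∘ proj₁) (sub' ∘ proj₁)
              (λ (a , n) az e → cl a az e , λ f → n (etrans (sub ax) az (sub a) f (esym (sub a) az e)))
              (λ (b , n) bz e → cl' b bz e , λ h → n (etrans' (sub' (to∈ f ax)) bz (sub' b) h (esym' (sub' b) bz e)))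
              f₂ loc₂ (ℕₚ.≤-pred (ℕₚ.≤-trans less b)))

      abstract
       glue : (f : PBij A B) → (∀ {x} → A x → Loc x (to f x)) → PI A B
       glue f loc = go _ A B A? (λ a → a) (λ b → b) (λ _ a _ → a) (λ _ b _ → b) f loc ℕₚ.≤-refl

-- The bijective pebble game.

module Games where
  open Gluing

  module _ {m : ℕ} (q : Fin m → Bool) (y : Fin m) where
    without : Fin m → Bool
    without z = q z ∧ not (does (z Fin.≟ y))

  cnt-without : ∀ {m} (q : Fin m → Bool) y → q y ≡ true → cnt q ≡ suc (cnt (without q y))
  cnt-without q zero e rewrite e = cong suc (cnt-cong λ x → sym (Boolₚ.∧-identityʳ (q (suc x))))
  cnt-without {suc m} q (suc y) e rewrite cnt-without (q ∘ suc) y e | Boolₚ.∧-identityʳ (q zero) = ℕₚ.+-suc (bit (q zero)) _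

  cnt-inj : ∀ {n m} (p : Fin n → Bool) (q : Fin m → Bool) (g : Fin n → Fin m) → (∀ x → p x ≡ true → q (g x) ≡ true) →
    (∀ x x' → p x ≡ true → p x' ≡ true → g x ≡ g x' → x ≡ x') → cnt p ≤ cnt q
  cnt-inj {zero} p q g h inj = z≤n
  cnt-inj {suc n} p q g h inj with p zero in e
  ... | false = cnt-inj (p ∘ suc) q (g ∘ suc) (h ∘ suc) (λ x x' a b c → Finₚ.suc-injective (inj _ _ a b c))
  ... | true rewrite cnt-without q (g zero) (h zero e) = s≤s (cnt-inj (p ∘ suc) (without q (g zero)) (g ∘ suc) h'
          (λ x x' a b c → Finₚ.suc-injective (inj _ _ a b c)))
    where
    h' : ∀ x → p (suc x) ≡ true → without q (g zero) (g (suc x)) ≡ true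
    h' x px rewrite h (suc x) px | dec-false (g (suc x) Fin.≟ g zero) (λ c → case inj _ _ px e c of λ ()) = refl

  Full : ∀ {n} → Fin n → Set
  Full _ = ⊤

  cnt-bij : ∀ {n m} {P : Fin n → Set} {Q : Fin m → Set} (P? : ∀ x → Dec (P x)) (Q? : ∀ y → Dec (Q y)) (f : PBij {n} {m} Full Full) →
    (∀ {x} → P x → Q (to f x)) → cnt (λ x → does (P? x)) ≤ cnt (λ y → does (Q? y))
  cnt-bij P? Q? f h = cnt-inj _ _ (to f) (λ x e → dec-true (Q? _) (h (dec-yes (P? x) e)))
    (λ x x' _ _ e → trans (sym (from-to f tt)) (trans (cong (from f) e) (from-to f tt)))

  -- Pebbles are addressed as pairs and not by an index. Forgetting, repeating or permuting pebbles
  -- is then an inclusion of these relations, which is all that `weaken` asks for.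
  data At {A B : Set} (x : A) (y : B) : ∀ {k} → Vec A k → Vec B k → Set where
    here : ∀ {k} {xs : Vec A k} {ys} → At x y (x ∷ xs) (y ∷ ys)
    there : ∀ {k} {xs : Vec A k} {ys x' y'} → At x y xs ys → At x y (x' ∷ xs) (y' ∷ ys)

  at-sym : ∀ {A B : Set} {x : A} {y : B} {k} {xs : Vec A k} {ys} → At x y xs ys → At y x ys xs
  at-sym here = here
  at-sym (there a) = there (at-sym a)

  at-split : ∀ {A B C : Set} {x : A} {z : C} {k} {xs : Vec A k} (ys : Vec B k) {zs : Vec C k} → At x z xs zs →
    ∃ λ y → At x y xs ys × At y z ys zs
  at-split (y ∷ ys) here = y , here , here
  at-split (_ ∷ ys) (there a) = let (y , b , c) = at-split ys a in y , there b , there c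

  Atomic : ∀ G H {k} → Vec (Fin (size G)) k → Vec (Fin (size H)) k → Set
  Atomic G H xs ys = ∀ {x y x' y'} → At x y xs ys → At x' y' xs ys →
    adj G x x' ≡ adj H y y' × (x ≡ x' → y ≡ y') × (y ≡ y' → x ≡ x')

  -- the duplicator survives r rounds of the bijective game
  data Game (G H : Graph) : ℕ → ∀ {k} → Vec (Fin (size G)) k → Vec (Fin (size H)) k → Set where
    over : ∀ {k} {xs : Vec _ k} {ys} → Atomic G H xs ys → Game G H zero xs ys
    round : ∀ {r k} {xs : Vec _ k} {ys} → Atomic G H xs ys → (f : PBij {size G} {size H} Full Full) →
      (∀ x → Game G H r (x ∷ xs) (to f x ∷ ys)) → Game G H (suc r) xs ys

  module _ {G H : Graph} where
    atomic : ∀ {r k} {xs : Vec _ k} {ys} → Game G H r xs ys → Atomic G H xs ys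
    atomic (over a) = a
    atomic (round a _ _) = a

    lower1 : ∀ {r k} {xs : Vec _ k} {ys} → Game G H (suc r) xs ys → Game G H r xs ys
    lower1 {zero} (round a f h) = over a
    lower1 {suc r} (round a f h) = round a f (λ x → lower1 (h x))

    lower′ : ∀ d {r k} {xs : Vec _ k} {ys} → Game G H (d + r) xs ys → Game G H r xs ys
    lower′ zero g = g
    lower′ (suc d) g = lower′ d (lower1 g)

    abstract
      lower : ∀ {r r' k} {xs : Vec _ k} {ys} → r ≤ r' → Game G H r' xs ys → Game G H r xs ys
      lower {r} {r'} le g = lower′ (r' ∸ r) (subst (λ n → Game G H n _ _) (sym (ℕₚ.m∸n+n≡m le)) g)

    abstract
      weaken : ∀ {r k l} {xs : Vec _ k} {ys} {xs' : Vec _ l} {ys'} → (∀ {x y} → At x y xs' ys' → At x y xs ys) →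
        Game G H r xs ys → Game G H r xs' ys'
      weaken s (over a) = over λ p q → a (s p) (s q)
      weaken s (round a f h) = round (λ p q → a (s p) (s q)) f λ x → weaken (λ { here → here ; (there p) → there (s p) }) (h x)

    abstract
      game-sym : ∀ {r k} {xs : Vec _ k} {ys} → Game G H r xs ys → Game H G r ys xs
      game-sym (over a) = over λ p q → let (e , f , g) = a (at-sym p) (at-sym q) in sym e , g , f
      game-sym {suc r} {xs = xs} {ys} (round a f h) = round (λ p q → let (e , f , g) = a (at-sym p) (at-sym q) in sym e , g , f) (pbij-sym f)
        λ y → game-sym (subst (λ v → Game G H r (from f y ∷ xs) (v ∷ ys)) (to-from f tt) (h (from f y)))

    forth : ∀ {r k} {xs : Vec _ k} {ys} → Game G H (suc r) xs ys → ∀ x → ∃ λ y → Game G H r (x ∷ xs) (y ∷ ys)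
    forth (round _ f h) x = to f x , h x

  abstract
    game-trans : ∀ {G H K r k} {xs : Vec _ k} {ys zs} → Game G H r xs ys → Game H K r ys zs → Game G K r xs zs
    game-trans {ys = ys} (over a) (over b) = over λ p q →
      let (y , p₁ , p₂) = at-split ys p
          (y' , q₁ , q₂) = at-split ys q
          (e , f , g) = a p₁ q₁
          (e' , f' , g') = b p₂ q₂
      in trans e e' , f' ∘ f , g ∘ g'
    game-trans {ys = ys} (round a f h) (round b f' h') = round (λ p q →
      let (y , p₁ , p₂) = at-split ys p
          (y' , q₁ , q₂) = at-split ys q
          (e , f , g) = a p₁ q₁
          (e' , f' , g') = b p₂ q₂
      in trans e e' , f' ∘ f , g ∘ g') (pbij-trans f f') λ x → game-trans (h x) (h' (to f x))

  back : ∀ {G H r k} {xs : Vec _ k} {ys} → Game G H (suc r) xs ys → ∀ y → ∃ λ x → Game G H r (x ∷ xs) (y ∷ ys)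
  back g y = let (x , h) = forth (game-sym g) y in x , game-sym h

  -- x and y have the same type over the pebbles xs and ys
  Type : ∀ G H (s : ℕ) {k} → Vec (Fin (size G)) k → Vec (Fin (size H)) k → Fin (size G) → Fin (size H) → Set
  Type G H s xs ys x y = Game G H s (x ∷ xs) (y ∷ ys)

  type-zig : ∀ {G H s k} {xs : Vec _ k} {ys} {x y x' y'} → Type G H s xs ys x y → Type G H s xs ys x' y → Type G H s xs ys x' y' → Type G H s xs ys x y'
  type-zig a b c = game-trans a (game-trans (game-sym b) c)

  -- `A` and `B` behave like one formula of quantifier rank `c`, with the pebbled vertices as
  -- parameters, evaluated in the two graphs.
  Def : ∀ G H (c : ℕ) {k} → Vec (Fin (size G)) k → Vec (Fin (size H)) k → (Fin (size G) → Set) → (Fin (size H) → Set) → Set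
  Def G H c xs ys A B = ∀ {x y} → Type G H c xs ys x y → (A x → B y) × (B y → A x)

  def-sym : ∀ {G H c k} {xs : Vec _ k} {ys A B} → Def G H c xs ys A B → Def H G c ys xs B A
  def-sym d t = let (f , g) = d (game-sym t) in g , f

  def-weaken : ∀ {G H c k l} {xs : Vec _ k} {ys} {xs' : Vec _ l} {ys' A B} → (∀ {x y} → At x y xs ys → At x y xs' ys') →
    Def G H c xs ys A B → Def G H c xs' ys' A B
  def-weaken s d t = d (weaken (λ { here → here ; (there p) → there (s p) }) t)

  at-type : ∀ {G H r k} {xs : Vec _ k} {ys x y} → At x y xs ys → Game G H r xs ys → Type G H r xs ys x y
  at-type a g = weaken (λ { here → a ; (there p) → p }) g

  abstract
    -- Types of `c` rounds decide membership, so the bijection of the next round maps `A` onto `B`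
    -- and can serve as input for gluing.
    restrict : ∀ {G H r c k} {xs : Vec _ k} {ys A B} → c ≤ r → Def G H c xs ys A B → Game G H (suc r) xs ys →
      Σ (PBij A B) λ f → ∀ x → Type G H r xs ys x (to f x)
    restrict {G} {H} {r} {c} {xs = xs} {ys} {A} {B} le d (round _ f h) = record
      { to = to f ; from = from f ; to∈ = λ {x} → proj₁ (d (lower le (h x)))
      ; from∈ = λ {y} b → proj₂ (d (lower le (h (from f y)))) (subst B (sym (to-from f tt)) b)
      ; from-to = λ _ → from-to f tt ; to-from = λ _ → to-from f tt } , h

  module _ {G H : Graph} {k : ℕ} {xs : Vec (Fin (size G)) k} {ys : Vec (Fin (size H)) k} where
    adj-at : ∀ {r x y x' y'} → Game G H r xs ys → At x y xs ys → At x' y' xs ys → adj G x x' ≡ adj H y y'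
    adj-at g p q = proj₁ (atomic g p q)

  Aligned : ∀ {A B : Set} {k} → Vec A k → Vec B k → List A → List B → Set
  Aligned xs ys = Pointwise (λ e e' → At e e' xs ys)

  abstract
    place : ∀ {G H} E {r k} {xs : Vec (Fin (size G)) k} {ys : Vec (Fin (size H)) k} → Game G H (length E + r) xs ys →
      Σ (List (Fin (size H))) λ E' → ∃ λ l → Σ (Vec (Fin (size G)) l) λ xs' → Σ (Vec (Fin (size H)) l) λ ys' →
      Game G H r xs' ys' × (∀ {x y} → At x y xs ys → At x y xs' ys') × Aligned xs' ys' E E'
    place [] g = [] , _ , _ , _ , g , (λ p → p) , []
    place (e ∷ E) g with forth g e
    ... | e' , h with place E h
    ... | E' , l , xs' , ys' , h' , s , al = e' ∷ E' , l , xs' , ys' , h' , (λ p → s (there p)) , s here ∷ al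

  aligned-any : ∀ {A B : Set} {k} {xs : Vec A k} {ys : Vec B k} {E E'} {P : A → Set} {Q : B → Set} →
    Aligned xs ys E E' → (∀ {e e'} → At e e' xs ys → P e → Q e') → Any P E → Any Q E'
  aligned-any (a ∷ al) h (here p) = here (h a p)
  aligned-any (a ∷ al) h (there p) = there (aligned-any al h p)

  aligned-all : ∀ {A B : Set} {k} {xs : Vec A k} {ys : Vec B k} {E E'} {P : A → Set} {Q : B → Set} →
    Aligned xs ys E E' → (∀ {e e'} → At e e' xs ys → P e → Q e') → All P E → All Q E'
  aligned-all [] h [] = []
  aligned-all (a ∷ al) h (p ∷ ps) = h a p ∷ aligned-all al h ps

  aligned-sym : ∀ {A B : Set} {k} {xs : Vec A k} {ys : Vec B k} {E E'} → Aligned xs ys E E' → Aligned ys xs E' E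
  aligned-sym [] = []
  aligned-sym (a ∷ al) = at-sym a ∷ aligned-sym al

  aligned-weaken : ∀ {A B : Set} {k l} {xs : Vec A k} {ys : Vec B k} {xs' : Vec A l} {ys' : Vec B l} {E E'} →
    (∀ {x y} → At x y xs ys → At x y xs' ys') → Aligned xs ys E E' → Aligned xs' ys' E E'
  aligned-weaken s [] = []
  aligned-weaken s (a ∷ al) = s a ∷ aligned-weaken s al

  aligned-pat : ∀ {G H k r} {xs : Vec (Fin (size G)) k} {ys : Vec (Fin (size H)) k} {E E' x y} → Aligned xs ys E E' →
    Type G H r xs ys x y → map (λ e → adj G e x) E ≡ map (λ e → adj H e y) E'
  aligned-pat [] t = refl
  aligned-pat (a ∷ al) t = cong₂ _∷_ (adj-at t (there a) here) (aligned-pat al t)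

-- Scenes: classes whose components are modules.

module Scenes where
  open Gluing
  open Games
  open FreeGraphs
  open Dominating
  open Multipartite using (module Patterns)

  module _ {A B : Set} where
    skip₁ : ∀ {k} {xs : Vec A k} {ys : Vec B k} {x y z w a b} → At x y (a ∷ xs) (b ∷ ys) → At x y (a ∷ z ∷ xs) (b ∷ w ∷ ys)
    skip₁ here = here
    skip₁ (there p) = there (there p)

    skip₂ : ∀ {k} {xs : Vec A k} {ys : Vec B k} {x y z w z' w' a b} → At x y (a ∷ xs) (b ∷ ys) → At x y (a ∷ z ∷ z' ∷ xs) (b ∷ w ∷ w' ∷ ys)
    skip₂ here = here
    skip₂ (there p) = there (there (there p))

  Comp : (Γ : FreeGraph) → (Fin (size (gr Γ)) → Set) → Fin (size (gr Γ)) → Fin (size (gr Γ)) → Set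
  Comp Γ P x z = P z × Structure.Reach Γ P x z

  module _ (Γ Δ : FreeGraph) {c k : ℕ} {xs : Vec (Vtx Γ) k} {ys : Vec (Vtx Δ) k} {P : Vtx Γ → Set} {P' : Vtx Δ → Set}
    (d : Def (gr Γ) (gr Δ) c xs ys P P') where
    private
      module X = Structure Γ
      module Y = Structure Δ

    conn-fwd : ∀ {x y z w} → At x y xs ys → Type (gr Γ) (gr Δ) (2 + c) xs ys z w → X.Conn P x z → Y.Conn P' y w
    conn-fwd a t (inj₁ e) = inj₁ (proj₁ (proj₂ (atomic t (there a) here)) e)
    conn-fwd a t (inj₂ (inj₁ e)) = inj₂ (inj₁ (trans (sym (adj-at t (there a) here)) e))
    conn-fwd a t (inj₂ (inj₂ (inj₁ (u , pu , e , f)))) with forth t u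
    ... | v , h = inj₂ (inj₂ (inj₁ (v , proj₁ (d (weaken skip₁ (lower (ℕₚ.n≤1+n c) h))) pu ,
          trans (sym (adj-at h (there (there a)) here)) e , trans (sym (adj-at h here (there here))) f)))
    conn-fwd a t (inj₂ (inj₂ (inj₂ (u , pu , e , u' , pu' , f , g)))) with forth t u
    ... | v , h with forth h u'
    ... | v' , h' = inj₂ (inj₂ (inj₂ (v , proj₁ (d (weaken skip₁ (lower (ℕₚ.n≤1+n c) h))) pu ,
          trans (sym (adj-at h (there (there a)) here)) e , v' , proj₁ (d (weaken skip₂ h')) pu' ,
          trans (sym (adj-at h' (there here) here)) f , trans (sym (adj-at h' here (there (there here)))) g)))

  -- The two additional rounds answer the two inner vertices of `Conn`.
  comp-def : ∀ (Γ Δ : FreeGraph) {c k} {xs : Vec (Fin (size (gr Γ))) k} {ys : Vec (Fin (size (gr Δ))) k} {P P' x y} →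
    Def (gr Γ) (gr Δ) c xs ys P P' → At x y xs ys → Def (gr Γ) (gr Δ) (2 + c) xs ys (Comp Γ P x) (Comp Δ P' y)
  comp-def Γ Δ {c} {P = P} {P'} d a t =
    (λ (p , r) → let p' = proj₁ (d (lower (ℕₚ.m≤n+m c 2) t)) p in
      p' , Structure.conn⇒reach Δ p' (conn-fwd Γ Δ d a t (Structure.reach⇒conn Γ r))) ,
    (λ (p , r) → let p' = proj₂ (d (lower (ℕₚ.m≤n+m c 2) t)) p in
      p' , Structure.conn⇒reach Γ p' (conn-fwd Δ Γ (def-sym {A = P} {B = P'} d) (at-sym a) (game-sym t) (Structure.reach⇒conn Δ r)))

  -- corresponding vertex sets B and B', divided into classes by the adjacency to E and E',
  -- in which the components of each class are modules
  record Scene (Γ Δ : FreeGraph) : Set₁ where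
    private
      G = gr Γ
      H = gr Δ
      V = Fin (size G)
      W = Fin (size H)
    field
      {k} : ℕ
      xs : Vec V k
      ys : Vec W k
      E : List V
      E' : List W
      al : Aligned xs ys E E'
      B : V → Set
      B' : W → Set
      B? : ∀ x → Dec (B x)
      B'? : ∀ x → Dec (B' x)
      c : ℕ
      dB : Def G H c xs ys B B'
    open Structure Γ using (_~_)
    open Structure Δ using () renaming (_~_ to _~'_)
    open Patterns Γ using (pat; pat?) public
    open Patterns Δ using () renaming (pat to pat'; pat? to pat'?) public
    field
      split : ∀ {x z y} → B x → B z → B y → x ~ z → pat E x ≡ pat E z → ¬ pat E y ≡ pat E x → y ~ x → y ~ z
      split' : ∀ {x z y} → B' x → B' z → B' y → x ~' z → pat' E' x ≡ pat' E' z → ¬ pat' E' y ≡ pat' E' x → y ~' x → y ~' z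

    Cls : V → V → Set
    Cls x w = B w × pat E w ≡ pat E x
    Cls' : W → W → Set
    Cls' y w = B' w × pat' E' w ≡ pat' E' y

  scene-sym : ∀ {Γ Δ} → Scene Γ Δ → Scene Δ Γ
  scene-sym s = record { xs = ys ; ys = xs ; E = E' ; E' = E ; al = aligned-sym al ; B = B' ; B' = B ; B? = B'? ; B'? = B?
    ; c = c ; dB = def-sym {A = B} {B = B'} dB ; split = split' ; split' = split }
    where open Scene s

  -- Between two classes the neighbourhoods form a chain, so the number of neighbours decides the adjacency.
  module Chain {Γ Δ : FreeGraph} (sc : Scene Γ Δ) {x z : Vtx Γ} {y w : Vtx Δ}
    (bx : Scene.B sc x) (bz : Scene.B sc z) (by : Scene.B' sc y) (bw : Scene.B' sc w)
    (txy : Type (gr Γ) (gr Δ) (2 + Scene.c sc) (Scene.xs sc) (Scene.ys sc) x y)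
    (tzw : Type (gr Γ) (gr Δ) (2 + Scene.c sc) (Scene.xs sc) (Scene.ys sc) z w)
    (diff : ¬ Patterns.pat Γ (Scene.E sc) x ≡ Patterns.pat Γ (Scene.E sc) z) where
    open Scene sc
    private
      G = gr Γ
      H = gr Δ
      module X = Structure Γ
      module Y = Structure Δ

      pxy : pat E x ≡ pat' E' y
      pxy = aligned-pat al txy
      pzw : pat E z ≡ pat' E' w
      pzw = aligned-pat al tzw

      Above : X.V → Set
      Above v = Cls z v × (∀ u → B u → pat E u ≡ pat E x → u X.~ z → u X.~ v)
      above? : ∀ v → Dec (Above v)
      above? v = (B? v ×-dec pat? E v z) ×-dec Finₚ.all? λ u → B? u →-dec pat? E u x →-dec (u X.~? z) →-dec (u X.~? v)

      Above' : Y.V → Set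
      Above' v = Cls' w v × (∀ u → B' u → pat' E' u ≡ pat' E' y → u Y.~ w → u Y.~ v)
      above'? : ∀ v → Dec (Above' v)
      above'? v = (B'? v ×-dec pat'? E' v w) ×-dec Finₚ.all? λ u → B'? u →-dec pat'? E' u y →-dec (u Y.~? w) →-dec (u Y.~? v)

      Nbr : X.V → Set
      Nbr v = Cls z v × x X.~ v
      nbr? : ∀ v → Dec (Nbr v)
      nbr? v = (B? v ×-dec pat? E v z) ×-dec (x X.~? v)

      Nbr' : Y.V → Set
      Nbr' v = Cls' w v × y Y.~ v
      nbr'? : ∀ v → Dec (Nbr' v)
      nbr'? v = (B'? v ×-dec pat'? E' v w) ×-dec (y Y.~? v)

      mono : ∀ {n} {P Q : Fin n → Set} (P? : ∀ x → Dec (P x)) (Q? : ∀ x → Dec (Q x)) → (∀ {x} → P x → Q x) →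
        cnt (λ x → does (P? x)) ≤ cnt (λ x → does (Q? x))
      mono P? Q? h = cnt-mono λ x e → dec-true (Q? x) (h (dec-yes (P? x) e))

      nbr-map : Type G H (2 + c) xs ys x y → cnt (λ v → does (nbr? v)) ≤ cnt (λ v → does (nbr'? v))
      nbr-map (round _ f h) = cnt-bij nbr? nbr'? f λ {v} ((bv , pv) , e) →
        let t = weaken skip₁ (lower (ℕₚ.n≤1+n c) (h v)) in
        (proj₁ (dB t) bv , trans (sym (aligned-pat al t)) (trans pv pzw)) , trans (sym (adj-at (h v) (there here) here)) e

      above-map : Type H G (2 + c) ys xs w z → cnt (λ v → does (above'? v)) ≤ cnt (λ v → does (above? v))
      above-map (round _ f h) = cnt-bij above'? above? f λ {v} ((bv , pv) , ab) →
        let t = game-sym (weaken skip₁ (lower (ℕₚ.n≤1+n c) (h v))) in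
        (proj₂ (dB t) bv , trans (aligned-pat al t) (trans pv (sym pzw))) , λ u bu pu uz →
          let (u' , g) = back (h v) u
              t' = game-sym (weaken skip₂ g) in
          trans (sym (adj-at g here (there here)))
            (ab u' (proj₁ (dB t') bu) (trans (sym (aligned-pat al t')) (trans pu pxy)) (trans (adj-at g here (there (there here))) uz))

    -- If `y` missed `w`, all neighbours of `y` in the class of `w` would satisfy `Above'`, and so
    -- would `w` itself, which is not a neighbour. In the other graph the edge between `x` and `z`
    -- turns `Above` into a subset of `Nbr`. The game transfers both numbers, which is a
    -- contradiction.
    edge : x X.~ z → y Y.~ w
    edge xz = Y.¬≁ λ yw → ℕₚ.<-irrefl refl (ℕₚ.≤-trans (strict yw) (ℕₚ.≤-trans (above-map (game-sym tzw))
        (ℕₚ.≤-trans (mono above? nbr? λ (cv , ab) → cv , ab x bx refl xz) (nbr-map txy))))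
      where
      nested : y Y.≁ w → ∀ {v} → Nbr' v → Above' v
      nested yw {v} ((bv , pv) , yv) = (bv , pv) , λ u bu pu uw → Y.¬≁ λ uv →
        -- An edge inside one of the two classes would put its ends in a common module, so that an
        -- adjacency of one end would hold for the other. This gives the non-edges required by
        -- `no2K2`.
        let yu = Y.¬~ λ yu → Y.clash (split' bu by bw (Y.~s yu) pu (λ e → diff' (sym (trans e pu))) (Y.~s uw)) (Y.≁s yw)
            vw = Y.¬~ λ vw → Y.clash (split' bv bw by vw pv (λ e → diff' (trans e pv)) yv) yw
        in Patterns.no2K2 Δ {E'} (sym pu) pv (λ e → diff' (trans e pv)) yv uw yu vw yw uv
        where
        diff' : ¬ pat' E' y ≡ pat' E' w
        diff' e = diff (trans pxy (trans e (sym pzw)))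
      strict : y Y.≁ w → cnt (λ v → does (nbr'? v)) < cnt (λ v → does (above'? v))
      strict yw = cnt-strict (λ v e → dec-true (above'? v) (nested yw (dec-yes (nbr'? v) e))) w
        (dec-false (nbr'? w) (λ (_ , e) → Y.clash e yw)) (dec-true (above'? w) ((bw , refl) , λ _ _ _ e → e))

  module Eqv (Γ : FreeGraph) (E : List (Vtx Γ)) (B : Vtx Γ → Set) where
    open Structure Γ
    open Patterns Γ
    Cl : V → V → Set
    Cl x w = B w × pat E w ≡ pat E x
    esym : ∀ {x z} → B x → Comp Γ (Cl x) x z → Comp Γ (Cl z) z x
    esym bx ((bz , p) , r) = (bx , sym p) , reach-mono (λ (b , q) → b , trans q (sym p)) (reach-sym (bx , refl) r)
    etrans : ∀ {x y z} → Comp Γ (Cl x) x y → Comp Γ (Cl y) y z → Comp Γ (Cl x) x z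
    etrans ((_ , p) , r) ((bz , q) , s) = (bz , trans q p) , reach-trans r (reach-mono (λ (b , h) → b , trans h p) s)

  -- The blocks to be glued are the components of the classes. Blocks of the same class are not
  -- joined by edges, and for different classes `Chain` recovers the adjacency from the types.
  fs : ∀ {Γ Δ} (sc : Scene Γ Δ) s l → let open Scene sc in 2 + c ≤ s →
    (∀ {x y} → B x → B' y → Type (gr Γ) (gr Δ) l xs ys x y →
      PIso (gr Γ) (gr Δ) (Type (gr Γ) (gr Δ) s (x ∷ xs) (y ∷ ys)) (Comp Γ (Cls x) x) (Comp Δ (Cls' y) y)) →
    Game (gr Γ) (gr Δ) (suc (s ⊔ l)) xs ys → PIso (gr Γ) (gr Δ) (Type (gr Γ) (gr Δ) s xs ys) B B'
  fs {Γ} {Δ} sc s l c≤s loc g = glue (proj₁ fb) λ {x} b → piso-conv proj₂ (λ (p , r) → proj₁ p , p , r) proj₂ (λ (p , r) → proj₁ p , p , r)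
      (piso-map (weaken skip₁) (loc b (to∈ (proj₁ fb) b) (lower (ℕₚ.m≤n⊔m s l) (proj₂ fb x))))
    where
    open Scene sc
    module X = Structure Γ
    module Y = Structure Δ
    fb : Σ (PBij B B') λ f → ∀ x → Type (gr Γ) (gr Δ) (s ⊔ l) xs ys x (to f x)
    fb = restrict (ℕₚ.≤-trans (ℕₚ.m≤n+m c 2) (ℕₚ.≤-trans c≤s (ℕₚ.m≤m⊔n s l))) dB g

    module EX = Eqv Γ E B
    module EY = Eqv Δ E' B'

    cross : ∀ {x z y w} → B x → B z → B' y → B' w → Type (gr Γ) (gr Δ) s xs ys x y → Type (gr Γ) (gr Δ) s xs ys z w →
      ¬ Comp Γ (Cls x) x z → ¬ Comp Δ (Cls' y) y w → adj (gr Δ) y w ≡ adj (gr Γ) x z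
    cross {x} {z} {y} {w} bx bz by bw t u n n' with pat? E z x
    ... | yes p = trans (Y.¬~ λ e → n' ((bw , p') , Y.move w e (bw , p') Y.stop)) (sym (X.¬~ λ e → n ((bz , p) , X.move z e (bz , p) X.stop)))
      where
      p' : pat' E' w ≡ pat' E' y
      p' = trans (sym (aligned-pat al u)) (trans p (aligned-pat al t))
    ... | no d with X.~⊎≁ x z | Y.~⊎≁ y w
    ... | inj₁ e | inj₁ f = trans f (sym e)
    ... | inj₂ e | inj₂ f = trans f (sym e)
    ... | inj₁ e | inj₂ f = Y.clash (Chain.edge sc bx bz by bw (lower c≤s t) (lower c≤s u) (d ∘ sym) e) f
    ... | inj₂ e | inj₁ f = X.clash (Chain.edge (scene-sym sc) by bw bx bz (game-sym (lower c≤s t)) (game-sym (lower c≤s u))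
            (λ q → d (sym (trans (aligned-pat al t) (trans q (sym (aligned-pat al u)))))) f) e

    open Partial.Glue (gr Γ) (gr Δ) (Type (gr Γ) (gr Δ) s xs ys) type-zig B B' B?
      (λ x → Comp Γ (Cls x) x) (λ x → X.reach? (λ w → B? w ×-dec pat? E w x) x)
      (λ y → Comp Δ (Cls' y) y) (λ y → Y.reach? (λ w → B'? w ×-dec pat'? E' w y) y)
      (λ b → (b , refl) , X.stop) (λ b _ → EX.esym b) (λ _ _ _ → EX.etrans)
      (λ b → (b , refl) , Y.stop) (λ b _ → EY.esym b) (λ _ _ _ → EY.etrans) cross

-- Isomorphisms of connected paw-free pieces.

module PawFreePieces where
  open Gluing
  open Games
  open Scenes
  open FreeGraphs
  open Dominating
  open Multipartite
  open BoundedCase using (module Component; module Bounded)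
  open Frames

  PawFree : (Γ : FreeGraph) → (Fin (size (gr Γ)) → Set) → Set
  PawFree Γ C = ∀ {a b c d} → C a → C b → C c → C d → a ~ b → a ~ c → b ~ c → d ~ a → d ≁ b → d ≁ c → ⊥
    where open Structure Γ

  Triangle : (Γ : FreeGraph) → (Fin (size (gr Γ)) → Set) → Set
  Triangle Γ C = ∃ λ a → ∃ λ b → ∃ λ c → C a × C b × C c × a ~ b × a ~ c × b ~ c
    where open Structure Γ

  triangle-fwd : ∀ {Γ Δ c k} {xs : Vec (Fin (size (gr Γ))) k} {ys : Vec (Fin (size (gr Δ))) k} {A A'} →
    Def (gr Γ) (gr Δ) c xs ys A A' → Game (gr Γ) (gr Δ) (3 + c) xs ys → Triangle Γ A → Triangle Δ A'
  triangle-fwd {c = c} d g (x , y , z , ax , ay , az , xy , xz , yz) with forth g x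
  ... | x' , g₁ with forth g₁ y
  ... | y' , g₂ with forth g₂ z
  ... | z' , g₃ = x' , y' , z' ,
    proj₁ (d (lower (ℕₚ.m≤n+m c 2) g₁)) ax , proj₁ (d (weaken skip₁ (lower (ℕₚ.n≤1+n c) g₂))) ay , proj₁ (d (weaken skip₂ g₃)) az ,
    trans (sym (adj-at g₂ (there here) here)) xy , trans (sym (adj-at g₃ (there (there here)) here)) xz ,
    trans (sym (adj-at g₃ (there here) here)) yz

  module PawFreeIso (c s : ℕ) where
    private
      N = s ⊔ (2 + c)
      s≤N : s ≤ N
      s≤N = ℕₚ.m≤m⊔n s (2 + c)
      2+c≤N : 2 + c ≤ N
      2+c≤N = ℕₚ.m≤n⊔m s (2 + c)
      c≤N : c ≤ N
      c≤N = ℕₚ.≤-trans (ℕₚ.m≤n+m c 2) 2+c≤N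

    -- 16 rounds pebble a dominating set in the triangle-free case. The remainder is what `fs`
    -- demands when both its parameters are `N`.
    rounds : ℕ
    rounds = 16 + suc (N ⊔ N)

    private
      N≤rounds : ∀ j → j ≤ 16 → j + N ≤ rounds
      N≤rounds j h = ℕₚ.+-mono-≤ h (ℕₚ.≤-trans (ℕₚ.m≤m⊔n N N) (ℕₚ.n≤1+n _))

    module _ (Γ Δ : FreeGraph) {k : ℕ} {xs : Vec (Vtx Γ) k} {ys : Vec (Vtx Δ) k}
      {A : Vtx Γ → Set} {A' : Vtx Δ → Set} (A? : ∀ x → Dec (A x)) (A'? : ∀ x → Dec (A' x))
      (conn : ∀ {x z} → A x → A z → Structure.Reach Γ A x z) (conn' : ∀ {x z} → A' x → A' z → Structure.Reach Δ A' x z)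
      (paw : PawFree Γ A) (paw' : PawFree Δ A') (d : Def (gr Γ) (gr Δ) c xs ys A A') {x₀ : Vtx Γ} (ax₀ : A x₀)
      (g : Game (gr Γ) (gr Δ) rounds xs ys) where

      private
        G = gr Γ
        H = gr Δ
        module X = Structure Γ
        module Y = Structure Δ
        module XC = Domination.Connected Γ A A? conn
        module YC = Domination.Connected Δ A' A'? conn'

        g₃ : Game G H (3 + c) xs ys
        g₃ = lower (ℕₚ.≤-trans (ℕₚ.+-monoʳ-≤ 1 2+c≤N) (N≤rounds 1 (s≤s z≤n))) g

        -- The blocks are the parts. They are independent, so every bijection of two parts is an
        -- isomorphism, and the game provides one that preserves types.
        multipartite : XC.Multipartite → YC.Multipartite → PIso G H (Type G H s xs ys) A A'
        multipartite mu mu' with restrict (ℕₚ.≤-trans c≤N (ℕₚ.n≤1+n N)) d (lower (N≤rounds 2 (s≤s (s≤s z≤n))) g)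
        ... | f , t = piso-map (lower s≤N) (glue f λ {x} ax → loc ax (to∈ f ax) (t x))
          where
          open Partial.Glue G H (Type G H N xs ys) type-zig A A' A? X._≁_ X._≁?_ Y._≁_ Y._≁?_
            (λ {x} _ → adj-irrefl G x) (λ _ _ → X.≁s) mu (λ {x} _ → adj-irrefl H x) (λ _ _ → Y.≁s) mu'
            (λ _ _ _ _ _ _ n n' → trans (Y.¬≁ n') (sym (X.¬≁ n)))
          loc : ∀ {x y} → A x → A' y → Type G H (suc N) xs ys x y → Loc x y
          loc {x} {y} ax ay h with restrict {A = Block x} {B = Block' y} ℕₚ.≤-refl (λ t →
                let (p , q) = d (weaken skip₁ (lower c≤N t)) ; e = adj-at t (there here) here in
                (λ (a , n) → p a , trans (sym e) n) , (λ (a , n) → q a , trans e n)) h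
          ... | f , t = record { bij = f ; type = λ {z} _ → weaken skip₁ (t z)
              ; adj-pres = λ {z} {w} (az , nz) (aw , nw) → trans
                  (mu' (proj₁ (to∈ f (az , nz))) ay (proj₁ (to∈ f (aw , nw))) (Y.≁s (proj₂ (to∈ f (az , nz)))) (proj₂ (to∈ f (aw , nw))))
                  (sym (mu az ax aw (X.≁s nz) nw)) }

        -- A vertex of `E` that sees one end of an edge inside a class sees the other end too and
        -- completes a triangle. So the classes are independent and the pieces are single vertices.
        triangleFree : XC.TriangleFree → YC.TriangleFree → PIso G H (Type G H s xs ys) A A'
        triangleFree tf tf' with XC.total short x₀ ax₀
          where
          open Domination Γ
          short : ∀ K → Clique K → All A K → Σ (List X.V) λ K₀ → length K₀ ≤ 4 × All A K₀ × (∀ x → A x → Cov K x → Cov K₀ x)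
          short [] cl al = [] , z≤n , al , λ _ _ c → c
          short (a ∷ []) cl al = a ∷ [] , s≤s z≤n , al , λ _ _ c → c
          short (a ∷ b ∷ []) cl al = a ∷ b ∷ [] , s≤s (s≤s z≤n) , al , λ _ _ c → c
          short (a ∷ b ∷ c ∷ _) ((ab ∷ ac ∷ _) ∷ (bc ∷ _) ∷ _) (ca ∷ cb ∷ cc ∷ _) = ⊥-elim (tf ca cb cc ab ac bc)
        ... | E , lE , aE , dE with place E (lower (ℕₚ.+-monoˡ-≤ (suc (N ⊔ N)) lE) g)
        ... | E' , l , xs' , ys' , g' , sub , al = piso-map (λ t → weaken (λ { here → here ; (there p) → there (sub p) }) (lower s≤N t))
              (fs sc N N 2+c≤N loc g')
          where
          d' : Def G H c xs' ys' A A'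
          d' = def-weaken {A = A} {B = A'} sub d
          aE' : All A' E'
          aE' = aligned-all al (λ p → proj₁ (d' (at-type p (lower (ℕₚ.≤-trans c≤N (ℕₚ.≤-trans (ℕₚ.m≤m⊔n N N) (ℕₚ.n≤1+n _))) g')))) aE
          dE' : YC.Dominates E'
          dE' {x'} {z'} ax' az' e' with back g' x'
          ... | x , h with back (lower {r = suc (suc c)} (ℕₚ.≤-trans 2+c≤N (ℕₚ.m≤m⊔n N N)) h) z'
          ... | z , h' = aligned-any al (λ p e → trans (sym (adj-at h' (there (there p)) (there here))) e)
                (dE (proj₂ (d' (lower (ℕₚ.≤-trans c≤N (ℕₚ.m≤m⊔n N N)) h)) ax') (proj₂ (d' (weaken skip₁ (lower (ℕₚ.n≤1+n c) h'))) az')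
                  (trans (adj-at h' (there here) here) e'))
          noEdge : ∀ {x z} → A x → A z → x X.~ z → Patterns.pat Γ E x ≡ Patterns.pat Γ E z → ⊥
          noEdge ax az e p with find (dE ax az e)
          ... | v , m , vx = tf (All.lookup aE m) ax az vx (Patterns.pat-~ Γ m p vx) e
          noEdge' : ∀ {x z} → A' x → A' z → x Y.~ z → Patterns.pat Δ E' x ≡ Patterns.pat Δ E' z → ⊥
          noEdge' ax az e p with find (dE' ax az e)
          ... | v , m , vx = tf' (All.lookup aE' m) ax az vx (Patterns.pat-~ Δ m p vx) e
          sc : Scene Γ Δ
          sc = record { xs = xs' ; ys = ys' ; E = E ; E' = E' ; al = al ; B = A ; B' = A' ; B? = A? ; B'? = A'? ; c = c ; dB = d'
            ; split = λ ax az _ e p _ _ → ⊥-elim (noEdge ax az e p) ; split' = λ ax az _ e p _ _ → ⊥-elim (noEdge' ax az e p) }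
          open Scene sc using (Cls; Cls')
          single : ∀ {x z} → A x → Comp Γ (Cls x) x z → x ≡ z
          single ax (_ , X.stop) = refl
          single ax (_ , X.move w e (aw , p) _) = ⊥-elim (noEdge ax aw e (sym p))
          single' : ∀ {x z} → A' x → Comp Δ (Cls' x) x z → x ≡ z
          single' ax (_ , Y.stop) = refl
          single' ax (_ , Y.move w e (aw , p) _) = ⊥-elim (noEdge' ax aw e (sym p))
          loc : ∀ {x y} → A x → A' y → Type G H N xs' ys' x y → PIso G H (Type G H N (x ∷ xs') (y ∷ ys')) (Comp Γ (Cls x) x) (Comp Δ (Cls' y) y)
          loc {x} {y} ax ay t = record
            { bij = record { to = λ _ → y ; from = λ _ → x ; to∈ = λ _ → (ay , refl) , Y.stop ; from∈ = λ _ → (ax , refl) , X.stop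
                           ; from-to = single ax ; to-from = single' ay }
            ; adj-pres = λ {u} {v} cu cv → trans (adj-irrefl H y) (sym (subst₂ (λ a b → adj G a b ≡ false) (single ax cu) (single ax cv) (adj-irrefl G x)))
            ; type = λ cu → subst (λ v → Type G H N (x ∷ xs') (y ∷ ys') v y) (single ax cu) (at-type here t) }

      pawFreeIso : PIso G H (Type G H s xs ys) A A'
      pawFreeIso with XC.triangleFree? | YC.triangleFree?
      ... | inj₁ tf | inj₁ tf' = triangleFree tf tf'
      ... | inj₂ (_ , _ , _ , ca , cb , cc , ab , ac , bc) | inj₂ (_ , _ , _ , ca' , cb' , cc' , ab' , ac' , bc') =
            multipartite (XC.olariu paw ca cb cc ab ac bc) (YC.olariu paw' ca' cb' cc' ab' ac' bc')
      ... | inj₁ tf | inj₂ t with triangle-fwd {Δ} {Γ} (def-sym {A = A} {B = A'} d) (game-sym g₃) t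
      ... | _ , _ , _ , ca , cb , cc , ab , ac , bc = ⊥-elim (tf ca cb cc ab ac bc)
      pawFreeIso | inj₂ t | inj₁ tf' with triangle-fwd {Γ} {Δ} d g₃ t
      ... | _ , _ , _ , ca , cb , cc , ab , ac , bc = ⊥-elim (tf' ca cb cc ab ac bc)

  module ScenePaw (c s : ℕ) where
    private
      N = s ⊔ (2 + c)
      module PF = PawFreeIso (2 + c) N

    rounds : ℕ
    rounds = suc (N ⊔ PF.rounds)

    sceneIso : ∀ {Γ Δ} (sc : Scene Γ Δ) → let open Scene sc hiding (c) in Scene.c sc ≡ c →
      (∀ {x} → B x → PawFree Γ (Comp Γ (Cls x) x)) → (∀ {x} → B' x → PawFree Δ (Comp Δ (Cls' x) x)) →
      Game (gr Γ) (gr Δ) rounds xs ys → PIso (gr Γ) (gr Δ) (Type (gr Γ) (gr Δ) s xs ys) B B'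
    sceneIso {Γ} {Δ} sc refl paw paw' g = piso-map (lower (ℕₚ.m≤m⊔n s (2 + c))) (fs sc N PF.rounds (ℕₚ.m≤n⊔m s (2 + c)) loc g)
      where
      open Scene sc hiding (c)
      loc : ∀ {x y} → B x → B' y → Type (gr Γ) (gr Δ) PF.rounds xs ys x y →
        PIso (gr Γ) (gr Δ) (Type (gr Γ) (gr Δ) N (x ∷ xs) (y ∷ ys)) (Comp Γ (Cls x) x) (Comp Δ (Cls' y) y)
      loc {x} {y} bx by t = PF.pawFreeIso Γ Δ CX.C? CY.C? CX.C-conn CY.C-conn (paw bx) (paw' by)
        (comp-def Γ Δ {P = Cls x} {P' = Cls' y} dCls here) CX.C-start t
        where
        module CX = Component Γ (Cls x) (λ w → B? w ×-dec pat? E w x) x (bx , refl)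
        module CY = Component Δ (Cls' y) (λ w → B'? w ×-dec pat'? E' w y) y (by , refl)
        dCls : Def (gr Γ) (gr Δ) _ (x ∷ xs) (y ∷ ys) (Cls x) (Cls' y)
        dCls u = let (p , q) = dB (weaken skip₁ u) ; e = aligned-pat al (weaken skip₁ u) ; f = aligned-pat al t in
          (λ (b , r) → p b , trans (sym e) (trans r f)) , (λ (b , r) → q b , trans e (trans r (sym f)))

-- From a winning strategy to an isomorphism, and back.

module GameToIso where
  open Gluing
  open Games
  open Scenes
  open PawFreePieces
  open FreeGraphs
  open Dominating
  open Multipartite
  open BoundedCase using (module Component; module Bounded; size-bound)
  open Frames

  Everywhere : ∀ {n} → Fin n → Set
  Everywhere _ = ⊤

  module _ (Γ Δ : FreeGraph) where
    private
      G = gr Γ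
      H = gr Δ
      module X = Structure Γ
      module Y = Structure Δ

    component-def : ∀ {k} {xs : Vec X.V k} {ys : Vec Y.V k} {x y} → At x y xs ys →
      Def G H 2 xs ys (Comp Γ Everywhere x) (Comp Δ Everywhere y)
    component-def = comp-def Γ Δ {c = 0} {P = Everywhere} {P' = Everywhere} (λ _ → (λ _ → tt) , (λ _ → tt))

  -- pieces dominated by E lie in neighbourhoods and so are paw-free
  class-paw : ∀ (Γ : FreeGraph) E (B : Vtx Γ → Set) → let open Structure Γ in let open Patterns Γ in
    (∀ {x z} → B x → B z → x ~ z → Any (_~ x) E) →
    ∀ {x} → PawFree Γ (Comp Γ (λ w → B w × pat E w ≡ pat E x) x)
  class-paw Γ E B dom {x} {a} {b} {c} {d} ((ba , pa) , _) ((bb , pb) , _) ((_ , pc) , _) ((_ , pd) , _) ab ac bc da db dc with find (dom ba bb ab)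
  ... | e , m , ea = k4 e a b c d ea (near pb) (near pc) ab ac bc (~s (near pd)) da db dc
    where
    open Structure Γ
    open Patterns Γ
    near : ∀ {v} → pat E v ≡ pat E x → e ~ v
    near p = pat-~ m (trans pa (sym p)) ea

  M-transfer : ∀ (Γ Δ : FreeGraph) {q q'} {r l x y} {xs : Vec (Fin (size (gr Γ))) l} {ys : Vec (Fin (size (gr Δ))) l} →
    (∀ i → At (q i) (q' i) xs ys) → Game (gr Γ) (gr Δ) r xs ys → At x y xs ys → Multi.M Γ q x → Multi.M Δ q' y
  M-transfer Γ Δ aq g p (i , j , n , e , f) = i , j , n , trans (sym (adj-at g p (aq i))) e , trans (sym (adj-at g p (aq j))) f

  -- Apart from the pebbled clique, the frames have to agree in one bit only, the one that enters
  -- `value`.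
  record Matched (Γ Δ : FreeGraph) {k} (xs : Vec (Fin (size (gr Γ))) k) (ys : Vec (Fin (size (gr Δ))) k) (cx : Frame Γ) (cy : Frame Δ) : Set where
    field
      aq : ∀ i → At (Frame.q cx i) (Frame.q cy i) xs ys
      a₀₁ : adj (gr Γ) (Frame.a cx zero) (Frame.a cx (suc zero)) ≡ adj (gr Δ) (Frame.a cy zero) (Frame.a cy (suc zero))

  module _ (Γ Δ : FreeGraph) {k : ℕ} {xs : Vec (Vtx Γ) k} {ys : Vec (Vtx Δ) k} (cx : Frame Γ) (cy : Frame Δ) where
    open Matched
    matched-sym : Matched Γ Δ xs ys cx cy → Matched Δ Γ ys xs cy cx
    matched-sym m = record { aq = at-sym ∘ aq m ; a₀₁ = sym (a₀₁ m) }

    matched-weaken : ∀ {l} {xs' : Vec (Fin (size (gr Γ))) l} {ys'} → (∀ {x y} → At x y xs ys → At x y xs' ys') →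
      Matched Γ Δ xs ys cx cy → Matched Γ Δ xs' ys' cx cy
    matched-weaken s m = record { aq = s ∘ aq m ; a₀₁ = a₀₁ m }

  module Transfer (Γ Δ : FreeGraph) {k : ℕ} {xs : Vec (Vtx Γ) k} {ys : Vec (Vtx Δ) k}
    (cx : Frame Γ) (cy : Frame Δ) (al : Matched Γ Δ xs ys cx cy) where
    private
      G = gr Γ
      H = gr Δ
      module T = TFacts Γ cx
      module T' = TFacts Δ cy
      module MX = Multi Γ (Frame.q cx)
      module MY = Multi Δ (Frame.q cy)
      open Matched al

    module _ {r l : ℕ} {x : Fin (size G)} {y : Fin (size H)} {us : Vec (Fin (size G)) l} {vs : Vec (Fin (size H)) l} (s : ∀ {u v} → At u v xs ys → At u v us vs)
      (g : Game G H r us vs) (p : At x y us vs) where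
      M-fwd : MX.M x → MY.M y
      M-fwd = M-transfer Γ Δ (s ∘ aq) g p

      M-bwd : MY.M y → MX.M x
      M-bwd = M-transfer Δ Γ (at-sym ∘ s ∘ aq) (game-sym g) (at-sym p)

    inA-fwd : ∀ {x y} → Type G H 1 xs ys x y → T.InA x → T'.InA y
    inA-fwd t (u , n , m , e) with forth t u
    ... | v , h = v , (λ m' → n (M-bwd there t here m')) , M-fwd (λ p → there (there p)) h here m , trans (sym (adj-at h (there here) here)) e

    inR-fwd : ∀ {x y} → Type G H 1 xs ys x y → T.InR x → T'.InR y
    inR-fwd t (n , h) = (λ m' → n (M-bwd there t here m')) , λ v m' → let (u , g) = back t v in
      trans (sym (adj-at g (there here) here)) (h u (M-bwd (λ p → there (there p)) g here m'))

    private
      home-fwd : ∀ {l x y u v r} {us : Vec (Fin (size G)) l} {vs : Vec (Fin (size H)) l} → (∀ {u v} → At u v xs ys → At u v us vs) →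
        Game G H r us vs → At x y us vs → At u v us vs → T.Home x u → T'.Home y v
      home-fwd s g a b (m , inj₁ e) = M-fwd s g b m , inj₁ (proj₁ (proj₂ (atomic g a b)) e)
      home-fwd s g a b (m , inj₂ (n , e)) = M-fwd s g b m , inj₂ ((λ m' → n (M-bwd s g a m')) , trans (sym (adj-at g a b)) e)

    eq-fwd : ∀ {x y z w} → At x y xs ys → Type G H 2 xs ys z w → T.Eq x z → T'.Eq y w
    eq-fwd a t (inj₂ (r , r')) = inj₂ (inR-fwd (at-type a (weaken there (lower (s≤s z≤n) t))) r , inR-fwd (lower (s≤s z≤n) t) r')
    eq-fwd a t (inj₁ (u , u' , h , h' , e)) with forth t u
    ... | v , g with forth g u'
    ... | v' , g' = inj₁ (v , v' , home-fwd s g' (there (there (there a))) (there here) h , home-fwd s g' (there (there here)) here h' ,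
          trans (sym (adj-at g' (there here) here)) e)
      where
      s : ∀ {u v} → At u v xs ys → At u v _ _
      s p = there (there (there p))

  block-paw : ∀ (Γ : FreeGraph) (cf : Frame Γ) {b x} → let open TFacts Γ cf in let open Patterns Γ in
    Comp Γ Everywhere (Frame.q cf zero) x × Eq b x →
    PawFree Γ (Comp Γ (λ w → (Comp Γ Everywhere (Frame.q cf zero) w × Eq b w) × pat Q w ≡ pat Q x) x)
  block-paw Γ cf {b} {x} bx {u} {v} {w} {z} cu cv cw cz uv uw vw zu zv zw
    with TFacts.block-centre Γ cf {u} {v} (proj₂ (proj₁ (proj₁ (proj₁ cu))))
           (TFacts.eq-trans Γ cf (TFacts.eq-sym Γ cf (proj₂ (proj₁ (proj₁ cu)))) (proj₂ (proj₁ (proj₁ cv))))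
           (trans (proj₂ (proj₁ cv)) (sym (proj₂ (proj₁ cu)))) uv
  ... | d , h = k4 d u v w z (h stop) (centre cv) (centre cw) uv uw vw (~s (centre cz)) zu zv zw
    where
    open Structure Γ
    open TFacts Γ cf
    open Patterns Γ
    K : V → Set
    K w = (Comp Γ Everywhere (Frame.q cf zero) w × Eq b w) × pat Q w ≡ pat Q x
    centre : ∀ {t} → Comp Γ K x t → d ~ t
    centre (_ , r) = h (reach-mono (λ (((_ , rb) , e) , pt) → (rb , eq-trans (eq-sym (proj₂ (proj₁ (proj₁ cu)))) e) , trans pt (sym (proj₂ (proj₁ cu))))
      (reach-trans (reach-sym (bx , refl) (proj₂ cu)) r))

  module _ {P : Fin 3 → Set} (a : P zero) (b : P (suc zero)) (c : P (suc (suc zero))) where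
    fin3 : ∀ i → P i
    fin3 zero = a
    fin3 (suc zero) = b
    fin3 (suc (suc zero)) = c

  toFrame : ∀ (Γ : FreeGraph) (v : Vec (Vtx Γ) 11) → TConfig Γ v → Σ (Frame Γ) λ cx → Vec.head v ≡ Frame.q cx zero
  toFrame Γ (q₀ ∷ q₁ ∷ q₂ ∷ q₃ ∷ q₄ ∷ p₁ ∷ a₁ ∷ p₂ ∷ a₂ ∷ p₃ ∷ a₃ ∷ []) (qc , ((mp₁ , na₁ , e₁) , (mp₂ , na₂ , e₂) , (mp₃ , na₃ , e₃)) , e₁₂ , e₁₃ , e₂₃) = record
    { q = Vec.lookup (q₀ ∷ q₁ ∷ q₂ ∷ q₃ ∷ q₄ ∷ []) ; p = Vec.lookup (p₁ ∷ p₂ ∷ p₃ ∷ []) ; a = Vec.lookup (a₁ ∷ a₂ ∷ a₃ ∷ [])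
    ; qc = qc ; mp = fin3 mp₁ mp₂ mp₃ ; na = fin3 na₁ na₂ na₃ ; ap = fin3 e₁ e₂ e₃
    ; pp = fin3 (fin3 (λ n → ⊥-elim (n refl)) (λ _ → e₁₂) (λ _ → e₁₃)) (fin3 (λ _ → ~s e₁₂) (λ n → ⊥-elim (n refl)) (λ _ → e₂₃))
                (fin3 (λ _ → ~s e₁₃) (λ _ → ~s e₂₃) (λ n → ⊥-elim (n refl))) } , refl
    where open Structure Γ

  module _ (Γ Δ : FreeGraph) {r k : ℕ} {xs : Vec (Vtx Γ) k} {ys : Vec (Vtx Δ) k} (g : Game (gr Γ) (gr Δ) r xs ys) where
    frame-fwd : ∀ (cx : Frame Γ) {q' p' a'} → (∀ i → At (Frame.q cx i) (q' i) xs ys) → (∀ i → At (Frame.p cx i) (p' i) xs ys) →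
      (∀ i → At (Frame.a cx i) (a' i) xs ys) → Σ (Frame Δ) (Matched Γ Δ xs ys cx)
    frame-fwd cx {q'} {p'} {a'} aq ap aa = record
      { q = q' ; p = p' ; a = a'
      ; qc = λ i j n → trans (sym (adj-at g (aq i) (aq j))) (Frame.qc cx i j n)
      ; mp = λ i → M-transfer Γ Δ aq g (ap i) (Frame.mp cx i)
      ; na = λ i m → Frame.na cx i (M-transfer Δ Γ (at-sym ∘ aq) (game-sym g) (at-sym (aa i)) m)
      ; ap = λ i → trans (sym (adj-at g (aa i) (ap i))) (Frame.ap cx i)
      ; pp = λ i j n → trans (sym (adj-at g (ap i) (ap j))) (Frame.pp cx i j n) } , record { aq = aq ; a₀₁ = adj-at g (aa zero) (aa (suc zero)) }

    frames : ∀ v {E'} → TConfig Γ v → Aligned xs ys (Vec.toList v) E' →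
      Σ (Frame Γ) λ cx → Vec.head v ≡ Frame.q cx zero × Σ (Frame Δ) (Matched Γ Δ xs ys cx)
    frames v@(_ ∷ _ ∷ _ ∷ _ ∷ _ ∷ _ ∷ _ ∷ _ ∷ _ ∷ _ ∷ _ ∷ [])
      {q₀ ∷ q₁ ∷ q₂ ∷ q₃ ∷ q₄ ∷ p₁ ∷ a₁ ∷ p₂ ∷ a₂ ∷ p₃ ∷ a₃ ∷ []} t
      (aq₀ ∷ aq₁ ∷ aq₂ ∷ aq₃ ∷ aq₄ ∷ ap₁ ∷ aa₁ ∷ ap₂ ∷ aa₂ ∷ ap₃ ∷ aa₃ ∷ []) =
      proj₁ (toFrame Γ v t) , refl , frame-fwd (proj₁ (toFrame Γ v t)) {Vec.lookup (q₀ ∷ q₁ ∷ q₂ ∷ q₃ ∷ q₄ ∷ [])}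
        {Vec.lookup (p₁ ∷ p₂ ∷ p₃ ∷ [])} {Vec.lookup (a₁ ∷ a₂ ∷ a₃ ∷ [])} aq (fin3 ap₁ ap₂ ap₃) (fin3 aa₁ aa₂ aa₃)
      where
      aq : ∀ i → At (Frame.q (proj₁ (toFrame Γ v t)) i) (Vec.lookup (q₀ ∷ q₁ ∷ q₂ ∷ q₃ ∷ q₄ ∷ []) i) xs ys
      aq zero = aq₀
      aq (suc zero) = aq₁
      aq (suc (suc zero)) = aq₂
      aq (suc (suc (suc zero))) = aq₃
      aq (suc (suc (suc (suc zero)))) = aq₄

  module Local (s : ℕ) where
    private
      module SP = ScenePaw 2 (s ⊔ 4)
      -- The summand 8 is ample: pulling back three vertices and deciding membership in a component
      -- takes five rounds.
      rest = SP.rounds + 8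

      big : ∀ j → j ≤ 8 → j ≤ rest
      big j h = ℕₚ.≤-trans h (ℕₚ.m≤n+m 8 SP.rounds)

    module Placed (Γ Δ : FreeGraph) {x : Vtx Γ} {y : Vtx Δ} (E : List (Vtx Γ)) (E' : List (Vtx Δ)) {l : ℕ} {xs : Vec (Vtx Γ) l} {ys : Vec (Vtx Δ) l}
      (dE : ∀ {u v} → Comp Γ Everywhere x u → Comp Γ Everywhere x v → Structure._~_ Γ u v → Any (λ e → Structure._~_ Γ e u) E)
      (sE : ∀ {u v w} → Comp Γ Everywhere x u → Structure._~_ Γ u v → Patterns.pat Γ E u ≡ Patterns.pat Γ E v →
        ¬ Patterns.pat Γ E w ≡ Patterns.pat Γ E u → Structure._~_ Γ w u → Structure._~_ Γ w v)
      (g : Game (gr Γ) (gr Δ) rest xs ys) (at : At x y xs ys) (al : Aligned xs ys E E') where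
      private
        G = gr Γ
        H = gr Δ
        module X = Structure Γ
        module Y = Structure Δ
        module PX = Patterns Γ
        module PY = Patterns Δ
        module BX = Component Γ Everywhere (λ _ → yes tt) x tt
        module BY = Component Δ Everywhere (λ _ → yes tt) y tt

        dB : Def G H 2 xs ys BX.C BY.C
        dB = component-def Γ Δ at

        g₅ : Game G H 5 xs ys
        g₅ = lower (big 5 (s≤s (s≤s (s≤s (s≤s (s≤s z≤n)))))) g

        -- Domination and the module property were proved for `E` in `Γ`. For `E'` they follow by
        -- pulling the vertices concerned back through the game.
        dE' : ∀ {u v} → BY.C u → BY.C v → u Y.~ v → Any (Y._~ u) E'
        dE' {u} {v} bu bv e =
          let (u' , h) = back g₅ u
              (v' , h') = back h v
          in aligned-any al (λ p e → trans (sym (adj-at h' (there (there p)) (there here))) e)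
              (dE (proj₂ (dB (lower (s≤s (s≤s z≤n)) h)) bu) (proj₂ (dB (weaken skip₁ (lower (s≤s (s≤s z≤n)) h'))) bv) (trans (adj-at h' (there here) here) e))

        sE' : ∀ {u v w} → BY.C u → u Y.~ v → PY.pat E' u ≡ PY.pat E' v → ¬ PY.pat E' w ≡ PY.pat E' u → w Y.~ u → w Y.~ v
        sE' {u} {v} {w} bu e p n wu =
          let (u' , h) = back g₅ u
              (v' , h') = back h v
              (w' , h″) = back h' w
              pu : PX.pat E u' ≡ PY.pat E' u
              pu = aligned-pat al h
              pv : PX.pat E v' ≡ PY.pat E' v
              pv = aligned-pat al (weaken skip₁ h')
              pw : PX.pat E w' ≡ PY.pat E' w
              pw = aligned-pat al (weaken skip₂ h″)
          in trans (sym (adj-at h″ here (there here))) (sE (proj₂ (dB (lower (s≤s (s≤s z≤n)) h)) bu) (trans (adj-at h' (there here) here) e)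
              (trans pu (trans p (sym pv))) (λ q → n (trans (sym pw) (trans q pu))) (trans (adj-at h″ here (there (there here))) wu))

        sc : Scene Γ Δ
        sc = record { xs = xs ; ys = ys ; E = E ; E' = E' ; al = al ; B = BX.C ; B' = BY.C ; B? = BX.C? ; B'? = BY.C? ; c = 2 ; dB = dB
          ; split = λ bx _ _ → sE bx ; split' = λ by _ _ → sE' by }

      placedIso : PIso G H (Type G H s (x ∷ []) (y ∷ [])) BX.C BY.C
      placedIso = piso-map (λ t → weaken (λ { here → here ; (there here) → there at }) (lower (ℕₚ.m≤m⊔n s 4) t))
        (SP.sceneIso sc refl (λ _ → class-paw Γ E BX.C dE) (λ _ → class-paw Δ E' BY.C dE') (lower (ℕₚ.m≤m+n SP.rounds 8) g))

    noConfigIso : ∀ (Γ Δ : FreeGraph) {x y} → (∀ v → Structure.Reach Γ Everywhere x (Vec.head v) → TConfig Γ v → ⊥) →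
      Game (gr Γ) (gr Δ) (size-bound + rest) (x ∷ []) (y ∷ []) →
      PIso (gr Γ) (gr Δ) (Type (gr Γ) (gr Δ) s (x ∷ []) (y ∷ [])) (Comp Γ Everywhere x) (Comp Δ Everywhere y)
    noConfigIso Γ Δ {x} noT g =
      let (E , lE , dE , sE) = Bounded.splitter Γ x noT
          (E' , _ , _ , _ , g' , sub , al) = place E (lower (ℕₚ.+-monoˡ-≤ rest lE) g)
      in Placed.placedIso Γ Δ E E' dE sE g' (sub here) al

    private
      N = s ⊔ 4
      s≤N : s ≤ N
      s≤N = ℕₚ.m≤m⊔n s 4
      4≤N : 4 ≤ N
      4≤N = ℕₚ.m≤n⊔m s 4

    module ConfigIso (Γ Δ : FreeGraph) {k : ℕ} {xs : Vec (Vtx Γ) k} {ys : Vec (Vtx Δ) k}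
      (cx : Frame Γ) (cy : Frame Δ) (al : Matched Γ Δ xs ys cx cy) where
      private
        G = gr Γ
        H = gr Δ
        module X = Structure Γ
        module Y = Structure Δ
        module CX = Frame cx
        module CY = Frame cy
        module TX = TFacts Γ cx
        module TY = TFacts Δ cy
        module Fwd = Transfer Γ Δ cx cy al
        module Bwd = Transfer Δ Γ cy cx (matched-sym Γ Δ cx cy al)
        open Matched al

        kind-eq : ∀ {x y} → Type G H 1 xs ys x y → TX.kind x ≡ TY.kind y
        kind-eq {x} {y} t with TX.kind-of x | TY.kind-of y
        ... | inj₁ _ | inj₁ _ = refl
        ... | inj₂ (inj₁ _) | inj₂ (inj₁ _) = refl
        ... | inj₂ (inj₂ _) | inj₂ (inj₂ _) = refl
        ... | inj₁ m | inj₂ (inj₁ (_ , n , _)) = ⊥-elim (n (Fwd.M-fwd there t here m))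
        ... | inj₁ m | inj₂ (inj₂ (n , _)) = ⊥-elim (n (Fwd.M-fwd there t here m))
        ... | inj₂ (inj₁ (_ , n , _)) | inj₁ m = ⊥-elim (n (Bwd.M-fwd there (game-sym t) here m))
        ... | inj₂ (inj₂ (n , _)) | inj₁ m = ⊥-elim (n (Bwd.M-fwd there (game-sym t) here m))
        ... | inj₂ (inj₁ a) | inj₂ (inj₂ (_ , r)) = let (v , n , m , e) = Fwd.inA-fwd t a in Y.clash e (r v m)
        ... | inj₂ (inj₂ r) | inj₂ (inj₁ (v , n , m , e)) = Y.clash e (proj₂ (Fwd.inR-fwd t r) v m)

        value-eq : ∀ i j → TX.value i j ≡ TY.value i j
        value-eq inM inM = refl
        value-eq inM inA = refl
        value-eq inM inR = refl
        value-eq inA inM = refl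
        value-eq inA inA = a₀₁
        value-eq inA inR = refl
        value-eq inR inM = refl
        value-eq inR inA = refl
        value-eq inR inR = refl

        BX : X.V → Set
        BX = Comp Γ Everywhere (CX.q zero)
        BY : Y.V → Set
        BY = Comp Δ Everywhere (CY.q zero)
        bx? : ∀ x → Dec (BX x)
        bx? = X.reach? (λ _ → yes tt) (CX.q zero)
        by? : ∀ x → Dec (BY x)
        by? = Y.reach? (λ _ → yes tt) (CY.q zero)
        dB : Def G H 2 xs ys BX BY
        dB = component-def Γ Δ (aq zero)

        alQ : Aligned xs ys TX.Q TY.Q
        alQ = aq zero ∷ aq (suc zero) ∷ aq (suc (suc zero)) ∷ aq (suc (suc (suc zero))) ∷ aq (suc (suc (suc (suc zero)))) ∷ []

        split : ∀ (Γ : FreeGraph) (cf : Frame Γ) {b : Vtx Γ} {K : Vtx Γ → Set} {x z y} → let open Structure Γ in let open TFacts Γ cf in let open Patterns Γ in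
          K x × Eq b x → K z × Eq b z → K y × Eq b y → x ~ z → pat Q x ≡ pat Q z → ¬ pat Q y ≡ pat Q x → y ~ x → y ~ z
        split Γ cf (_ , ex) (_ , ez) (_ , ey) = T.block-split (T.eq-trans (T.eq-sym ex) ez) (T.eq-trans (T.eq-sym ex) ey)
          where module T = TFacts Γ cf

        module Block {b : X.V} {b' : Y.V} (bb : BX b) (bb' : BY b') (t : Type G H SP.rounds xs ys b b') where
          sc : Scene Γ Δ
          sc = record { xs = b ∷ xs ; ys = b' ∷ ys ; E = TX.Q ; E' = TY.Q ; al = aligned-weaken there alQ
            ; B = λ z → BX z × TX.Eq b z ; B' = λ z → BY z × TY.Eq b' z
            ; B? = λ z → bx? z ×-dec TX.eq? b z ; B'? = λ z → by? z ×-dec TY.eq? b' z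
            ; c = 2
            ; dB = λ u → let (f , g) = dB (weaken skip₁ u) in
                (λ (z , e) → f z , Transfer.eq-fwd Γ Δ cx cy (matched-weaken Γ Δ cx cy there al) here u e) ,
                (λ (z , e) → g z , Transfer.eq-fwd Δ Γ cy cx (matched-sym Γ Δ cx cy (matched-weaken Γ Δ cx cy there al)) here (game-sym u) e)
            ; split = split Γ cx ; split' = split Δ cy }

          iso : PIso G H (Type G H N (b ∷ xs) (b' ∷ ys)) (λ z → BX z × TX.Eq b z) (λ z → BY z × TY.Eq b' z)
          iso = SP.sceneIso sc refl (block-paw Γ cx) (block-paw Δ cy) t

      blocksIso : Game G H (suc (N ⊔ SP.rounds)) xs ys → PIso G H (Type G H N xs ys) BX BY
      blocksIso g with restrict (ℕₚ.≤-trans (s≤s (s≤s z≤n)) (ℕₚ.≤-trans 4≤N (ℕₚ.m≤m⊔n N SP.rounds))) dB g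
      ... | f , h = glue f λ {x} b → piso-map (weaken skip₁) (Block.iso b (to∈ f b) (lower (ℕₚ.m≤n⊔m N SP.rounds) (h x)))
        where
        kind-eq' : ∀ {x y} → Type G H N xs ys x y → TX.kind x ≡ TY.kind y
        kind-eq' t = kind-eq (lower (ℕₚ.≤-trans (s≤s z≤n) 4≤N) t)
        cross : ∀ {x z y w} → BX x → BX z → BY y → BY w → Type G H N xs ys x y → Type G H N xs ys z w →
          ¬ TX.Eq x z → ¬ TY.Eq y w → adj H y w ≡ adj G x z
        cross {_} {_} {y} {w} (_ , bx) (_ , bz) (_ , by) (_ , bw) t u n n' = trans (TY.cross by bw n')
          (trans (sym (trans (cong₂ TX.value (kind-eq' t) (kind-eq' u)) (value-eq (TY.kind y) (TY.kind w)))) (sym (TX.cross bx bz n)))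
        open Partial.Glue G H (Type G H N xs ys) type-zig BX BY bx? TX.Eq TX.eq? TY.Eq TY.eq?
          (λ _ → TX.eq-refl _) (λ _ _ → TX.eq-sym) (λ _ _ _ → TX.eq-trans)
          (λ _ → TY.eq-refl _) (λ _ _ → TY.eq-sym) (λ _ _ _ → TY.eq-trans) cross

    module _ (Γ Δ : FreeGraph) {x : Vtx Γ} {y : Vtx Δ} where
      private
        G = gr Γ
        H = gr Δ
        module X = Structure Γ
        module Y = Structure Δ

      framedIso : (cx : Frame Γ) (cy : Frame Δ) → X.Reach Everywhere x (Frame.q cx zero) → ∀ {l} {xs : Vec (Vtx Γ) l} {ys : Vec (Vtx Δ) l} →
        Matched Γ Δ xs ys cx cy → At x y xs ys → Game G H (suc (N ⊔ SP.rounds)) xs ys →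
        PIso G H (Type G H s (x ∷ []) (y ∷ [])) (Comp Γ Everywhere x) (Comp Δ Everywhere y)
      framedIso cx cy r ma at g =
        piso-conv (λ (_ , s) → tt , X.reach-trans (X.reach-sym tt r) s) (λ (_ , s) → tt , X.reach-trans r s)
          (λ (_ , s) → tt , Y.reach-trans (Y.reach-sym tt r') s) (λ (_ , s) → tt , Y.reach-trans r' s)
          (piso-map (λ t → weaken (λ { here → here ; (there here) → there at }) (lower s≤N t)) (ConfigIso.blocksIso Γ Δ cx cy ma g))
        where
        r' : Y.Reach Everywhere y (Frame.q cy zero)
        r' = proj₂ (proj₁ (component-def Γ Δ at (at-type (Matched.aq ma zero)
          (lower {r = 2} (s≤s (ℕₚ.≤-trans (ℕₚ.≤-trans (s≤s z≤n) 4≤N) (ℕₚ.m≤m⊔n N SP.rounds))) g))) (tt , r))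

      configIso : ∀ v → X.Reach Everywhere x (Vec.head v) → TConfig Γ v → Game G H (11 + suc (N ⊔ SP.rounds)) (x ∷ []) (y ∷ []) →
        PIso G H (Type G H s (x ∷ []) (y ∷ [])) (Comp Γ Everywhere x) (Comp Δ Everywhere y)
      configIso v@(_ ∷ _ ∷ _ ∷ _ ∷ _ ∷ _ ∷ _ ∷ _ ∷ _ ∷ _ ∷ _ ∷ []) r t g =
        let (_ , _ , _ , _ , g' , sub , al) = place (Vec.toList v) g
            (cx , e , cy , ma) = frames Γ Δ g' v t al
        in framedIso cx cy (subst (X.Reach Everywhere x) e r) ma (sub here) g'

    rounds : ℕ
    rounds = (size-bound + rest) ⊔ (11 + suc (N ⊔ SP.rounds))

    -- The case is decided in `Γ`. A frame found there is copied by pebbling its eleven vertices,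
    -- and without one the refining set is copied in the same way.
    componentIso : ∀ (Γ Δ : FreeGraph) {x y} → Game (gr Γ) (gr Δ) rounds (x ∷ []) (y ∷ []) →
      PIso (gr Γ) (gr Δ) (Type (gr Γ) (gr Δ) s (x ∷ []) (y ∷ [])) (Comp Γ Everywhere x) (Comp Δ Everywhere y)
    componentIso Γ Δ {x} g with anyVec? 11 (λ v → Structure.reach? Γ {Everywhere} (λ _ → yes tt) x (Vec.head v) ×-dec tConfig? Γ v)
    ... | yes (v , (_ , r) , t) = configIso Γ Δ v r t (lower (ℕₚ.m≤n⊔m (size-bound + rest) (11 + suc (N ⊔ SP.rounds))) g)
    ... | no n = noConfigIso Γ Δ (λ v r t → n (v , (tt , r) , t)) (lower (ℕₚ.m≤m⊔n (size-bound + rest) (11 + suc (N ⊔ SP.rounds))) g)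

  gameRounds : ℕ
  gameRounds = suc (2 ⊔ Local.rounds 2)

  game⇒iso : ∀ (Γ Δ : FreeGraph) → Game (gr Γ) (gr Δ) gameRounds [] [] → Iso (gr Γ) (gr Δ)
  game⇒iso Γ Δ g = mk↔ₛ′ (to (bij f)) (from (bij f)) (λ _ → to-from (bij f) tt) (λ _ → from-to (bij f) tt) , λ _ _ → adj-pres f tt tt
    where
    -- With `E` empty there is a single class, whose components are the connected components of the
    -- graph.
    sc : Scene Γ Δ
    sc = record { xs = [] ; ys = [] ; E = [] ; E' = [] ; al = [] ; B = Everywhere ; B' = Everywhere ; B? = λ _ → yes tt ; B'? = λ _ → yes tt
      ; c = 0 ; dB = λ _ → (λ _ → tt) , (λ _ → tt) ; split = λ _ _ _ _ _ n → ⊥-elim (n refl) ; split' = λ _ _ _ _ _ n → ⊥-elim (n refl) }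
    plain : ∀ (Γ : FreeGraph) {x z} → Comp Γ (λ w → ⊤ × [] {A = Bool} ≡ []) x z → Comp Γ Everywhere x z
    plain Γ (_ , r) = tt , Structure.reach-mono Γ (λ _ → tt) r
    unplain : ∀ (Γ : FreeGraph) {x z} → Comp Γ Everywhere x z → Comp Γ (λ w → ⊤ × [] {A = Bool} ≡ []) x z
    unplain Γ (_ , r) = (tt , refl) , Structure.reach-mono Γ (λ _ → tt , refl) r
    f : PIso (gr Γ) (gr Δ) (Type (gr Γ) (gr Δ) 2 [] []) Everywhere Everywhere
    f = fs sc 2 (Local.rounds 2) ℕₚ.≤-refl
      (λ _ _ t → piso-conv (plain Γ) (unplain Γ) (plain Δ) (unplain Δ) (Local.componentIso 2 Γ Δ t)) g

  iso⇒game : ∀ {G H} → Iso G H → ∀ r → Game G H r [] []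
  iso⇒game {G} {H} (φ , pres) r = go r []
    where
    open Inverse φ using (strictlyInverseˡ; strictlyInverseʳ) renaming (to to φ→; from to φ←)
    image : ∀ {k x y} (xs : Vec (Fin (size G)) k) → At x y xs (Vec.map φ→ xs) → y ≡ φ→ x
    image (x ∷ xs) here = refl
    image (x ∷ xs) (there p) = image xs p
    atom : ∀ {k} (xs : Vec (Fin (size G)) k) → Atomic G H xs (Vec.map φ→ xs)
    atom xs p q with image xs p | image xs q
    ... | refl | refl = sym (pres _ _) , cong φ→ , λ e → trans (sym (strictlyInverseʳ _)) (trans (cong φ← e) (strictlyInverseʳ _))
    go : ∀ r {k} (xs : Vec (Fin (size G)) k) → Game G H r xs (Vec.map φ→ xs)
    go zero xs = over (atom xs)
    go (suc r) xs = round (atom xs) (record { to = φ→ ; from = φ← ; to∈ = λ _ → tt ; from∈ = λ _ → tt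
      ; from-to = λ _ → strictlyInverseʳ _ ; to-from = λ _ → strictlyInverseˡ _ }) λ x → go r (x ∷ xs)

-- Turing machines composed from structured programs.

module Machines where
  -- Turing machines that exit with a Boolean, entered in state zero
  record Prog (e : ℕ) : Set where
    field
      last : ℕ
      tr : Fin (suc last) → Sym e → (Fin (suc last) ⊎ Bool) × Sym e × Move
  open Prog public

  module _ {e : ℕ} where
    record Tape : Set where
      constructor tape
      field
        left : List (Sym e)
        cur : Sym e
        right : List (Sym e)
    open Tape public

    -- head on the first cell of the right part, or on the first cell of the left part
    onR onL : List (Sym e) → List (Sym e) → Tape
    onR l [] = tape l blank []
    onR l (x ∷ r) = tape l x r
    onL [] r = tape [] blank r
    onL (x ∷ l) r = tape l x r

    act : Sym e → Move → Tape → Tape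
    act w S (tape l c r) = tape l w r
    act w L (tape l c r) = onL l (w ∷ r)
    act w R (tape l c r) = onR (w ∷ l) r

    data Run (p : Prog e) : Fin (suc (last p)) → Tape → ℕ → Bool → Tape → Set where
      exit : ∀ {s t b w m} → tr p s (cur t) ≡ (inj₂ b , w , m) → Run p s t 1 b (act w m t)
      next : ∀ {s t s' w m k b t'} → tr p s (cur t) ≡ (inj₁ s' , w , m) → Run p s' (act w m t) k b t' → Run p s t (suc k) b t'

    module _ (p : Prog e) where
      private
        exitState : Bool → Fin 2
        exitState false = zero
        exitState true = suc zero

        after : (Fin (suc (last p)) ⊎ Bool) × Sym e × Move → Bool ⊎ (Fin (suc (last p) + 2) × Sym e × Move)
        after (inj₁ s , w , m) = inj₂ (s ↑ˡ 2 , w , m)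
        after (inj₂ b , w , m) = inj₂ (suc (last p) ↑ʳ exitState b , w , m)

        δ′ : Fin (suc (last p)) ⊎ Fin 2 → Sym e → Bool ⊎ (Fin (suc (last p) + 2) × Sym e × Move)
        δ′ (inj₁ s) c = after (tr p s c)
        δ′ (inj₂ zero) c = inj₁ false
        δ′ (inj₂ (suc _)) c = inj₁ true

      -- A halting transition of `TM` neither writes nor moves, while an exit of a `Prog` does both.
      -- Two more states, one for each answer, make up for the difference.
      toTM : TM
      toTM = record { Q = last p + 2 ; extra = e ; δ = λ q c → δ′ (splitAt (suc (last p)) q) c }

      conf : Fin (suc (last p) + 2) → Tape → Config toTM
      conf q t = cfg q (left t) (cur t) (right t)

      private
        step-act : ∀ q t {q' w m} → TM.δ toTM q (cur t) ≡ inj₂ (q' , w , m) → step toTM (conf q t) ≡ inj₂ (conf q' (act w m t))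
        step-act q (tape l c r) eq with TM.δ toTM q c
        step-act q (tape l c r) refl | inj₂ (q' , w , S) = refl
        step-act q (tape [] c r) refl | inj₂ (q' , w , L) = refl
        step-act q (tape (x ∷ l) c r) refl | inj₂ (q' , w , L) = refl
        step-act q (tape l c []) refl | inj₂ (q' , w , R) = refl
        step-act q (tape l c (x ∷ r)) refl | inj₂ (q' , w , R) = refl

        run-step : ∀ k {c c'} → step toTM c ≡ inj₂ c' → run toTM (suc k) c ≡ run toTM k c'
        run-step k {c} eq with step toTM c
        run-step k refl | inj₂ _ = refl

        step-exit : ∀ b t → step toTM (conf (suc (last p) ↑ʳ exitState b) t) ≡ inj₁ b
        step-exit b (tape l c r) with TM.δ toTM (suc (last p) ↑ʳ exitState b) c | halts b
          where
          halts : ∀ b → TM.δ toTM (suc (last p) ↑ʳ exitState b) c ≡ inj₁ b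
          halts false = cong (λ z → δ′ z c) (Finₚ.splitAt-↑ʳ (suc (last p)) 2 zero)
          halts true = cong (λ z → δ′ z c) (Finₚ.splitAt-↑ʳ (suc (last p)) 2 (suc zero))
        ... | _ | refl = refl

        run-exit : ∀ k b t → run toTM (suc k) (conf (suc (last p) ↑ʳ exitState b) t) ≡ just b
        run-exit k b t with step toTM (conf (suc (last p) ↑ʳ exitState b) t) | step-exit b t
        ... | _ | refl = refl

        δ-next : ∀ {s c s' w m} → tr p s c ≡ (inj₁ s' , w , m) → TM.δ toTM (s ↑ˡ 2) c ≡ inj₂ (s' ↑ˡ 2 , w , m)
        δ-next {s} {c} eq = trans (cong (λ z → δ′ z c) (Finₚ.splitAt-↑ˡ (suc (last p)) s 2)) (cong after eq)

        δ-exit : ∀ {s c b w m} → tr p s c ≡ (inj₂ b , w , m) → TM.δ toTM (s ↑ˡ 2) c ≡ inj₂ (suc (last p) ↑ʳ exitState b , w , m)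
        δ-exit {s} {c} eq = trans (cong (λ z → δ′ z c) (Finₚ.splitAt-↑ˡ (suc (last p)) s 2)) (cong after eq)

      run-prog : ∀ {s t k b t'} → Run p s t k b t' → ∀ j → run toTM (k + suc j) (conf (s ↑ˡ 2) t) ≡ just b
      run-prog {s} {t} {b = b} (exit {w = w} {m} eq) j =
        trans (run-step (suc j) {conf (s ↑ˡ 2) t} {conf (suc (last p) ↑ʳ exitState b) (act w m t)} (step-act (s ↑ˡ 2) t (δ-exit eq))) (run-exit j b (act w m t))
      run-prog {s} {t} (next {s' = s'} {w} {m} {k} eq r) j =
        trans (run-step (k + suc j) {conf (s ↑ˡ 2) t} {conf (s' ↑ˡ 2) (act w m t)} (step-act (s ↑ˡ 2) t (δ-next eq))) (run-prog r j)

    goto : ∀ {A B : Set} → (A → B) → (Bool → B) → (A ⊎ Bool) × Sym e × Move → B × Sym e × Move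
    goto f g (inj₁ s , w , m) = f s , w , m
    goto f g (inj₂ b , w , m) = g b , w , m

    module _ (p q r : Prog e) where
      private
        m₁ m₂ m₃ : ℕ
        m₁ = suc (last p)
        m₂ = suc (last q)
        m₃ = suc (last r)

        inP : Fin m₁ → Fin (m₁ + (m₂ + m₃))
        inP s = s ↑ˡ (m₂ + m₃)
        inQ : Fin m₂ → Fin (m₁ + (m₂ + m₃))
        inQ s = m₁ ↑ʳ (s ↑ˡ m₃)
        inR : Fin m₃ → Fin (m₁ + (m₂ + m₃))
        inR s = m₁ ↑ʳ (m₂ ↑ʳ s)

        State = Fin (m₁ + (m₂ + m₃))
        afterP : Bool → State ⊎ Bool
        afterP b = inj₁ (Bool.if b then inQ zero else inR zero)
        gP = goto {Fin m₁} {State ⊎ Bool} (λ s' → inj₁ (inP s')) afterP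
        gQ = goto {Fin m₂} {State ⊎ Bool} (λ s' → inj₁ (inQ s')) inj₂
        gR = goto {Fin m₃} {State ⊎ Bool} (λ s' → inj₁ (inR s')) inj₂

        tr′ : Fin m₁ ⊎ Fin (m₂ + m₃) → Sym e → (Fin (m₁ + (m₂ + m₃)) ⊎ Bool) × Sym e × Move
        tr″ : Fin m₂ ⊎ Fin m₃ → Sym e → (Fin (m₁ + (m₂ + m₃)) ⊎ Bool) × Sym e × Move
        tr′ (inj₁ s) c = gP (tr p s c)
        tr′ (inj₂ s) c = tr″ (splitAt m₂ s) c
        tr″ (inj₁ s) c = gQ (tr q s c)
        tr″ (inj₂ s) c = gR (tr r s c)

      ite : Prog e
      ite = record { last = last p + (m₂ + m₃) ; tr = λ s c → tr′ (splitAt m₁ s) c }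

      private
        tr-P : ∀ s c → tr ite (inP s) c ≡ gP (tr p s c)
        tr-P s c = cong (λ z → tr′ z c) (Finₚ.splitAt-↑ˡ m₁ s (m₂ + m₃))
        tr-Q : ∀ s c → tr ite (inQ s) c ≡ gQ (tr q s c)
        tr-Q s c = trans (cong (λ z → tr′ z c) (Finₚ.splitAt-↑ʳ m₁ (m₂ + m₃) (s ↑ˡ m₃))) (cong (λ z → tr″ z c) (Finₚ.splitAt-↑ˡ m₂ s m₃))
        tr-R : ∀ s c → tr ite (inR s) c ≡ gR (tr r s c)
        tr-R s c = trans (cong (λ z → tr′ z c) (Finₚ.splitAt-↑ʳ m₁ (m₂ + m₃) (m₂ ↑ʳ s))) (cong (λ z → tr″ z c) (Finₚ.splitAt-↑ʳ m₂ m₃ s))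

        run-Q : ∀ {s t k b t'} → Run q s t k b t' → Run ite (inQ s) t k b t'
        run-Q {s} {t} (exit eq) = exit (trans (tr-Q s (cur t)) (cong gQ eq))
        run-Q {s} {t} (next eq h) = next (trans (tr-Q s (cur t)) (cong gQ eq)) (run-Q h)

        run-R : ∀ {s t k b t'} → Run r s t k b t' → Run ite (inR s) t k b t'
        run-R {s} {t} (exit eq) = exit (trans (tr-R s (cur t)) (cong gR eq))
        run-R {s} {t} (next eq h) = next (trans (tr-R s (cur t)) (cong gR eq)) (run-R h)

        run-P : ∀ {s t k b t' l c t″} → Run p s t k b t' → Run ite (Bool.if b then inQ zero else inR zero) t' l c t″ → Run ite (inP s) t (k + l) c t″
        run-P {s} {t} (exit eq) h = next (trans (tr-P s (cur t)) (cong gP eq)) h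
        run-P {s} {t} (next eq g) h = next (trans (tr-P s (cur t)) (cong gP eq)) (run-P g h)

      run-ite-true : ∀ {t k t' l b t″} → Run p zero t k true t' → Run q zero t' l b t″ → Run ite zero t (k + l) b t″
      run-ite-true g h = run-P g (run-Q h)

      run-ite-false : ∀ {t k t' l b t″} → Run p zero t k false t' → Run r zero t' l b t″ → Run ite zero t (k + l) b t″
      run-ite-false g h = run-P g (run-R h)

    -- repeat q as long as p exits with true; exit with false as soon as q does, otherwise with true
    module _ (p q : Prog e) where
      private
        m₁ m₂ : ℕ
        m₁ = suc (last p)
        m₂ = suc (last q)

        inP : Fin m₁ → Fin (m₁ + m₂)
        inP s = s ↑ˡ m₂
        inQ : Fin m₂ → Fin (m₁ + m₂)
        inQ s = m₁ ↑ʳ s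

        afterP afterQ : Bool → Fin (m₁ + m₂) ⊎ Bool
        afterP b = Bool.if b then inj₁ (inQ zero) else inj₂ true
        afterQ b = Bool.if b then inj₁ (inP zero) else inj₂ false

        gP = goto {Fin m₁} {Fin (m₁ + m₂) ⊎ Bool} (λ s' → inj₁ (inP s')) afterP
        gQ = goto {Fin m₂} {Fin (m₁ + m₂) ⊎ Bool} (λ s' → inj₁ (inQ s')) afterQ

        tr′ : Fin m₁ ⊎ Fin m₂ → Sym e → (Fin (m₁ + m₂) ⊎ Bool) × Sym e × Move
        tr′ (inj₁ s) c = gP (tr p s c)
        tr′ (inj₂ s) c = gQ (tr q s c)

      whileAll : Prog e
      whileAll = record { last = last p + m₂ ; tr = λ s c → tr′ (splitAt m₁ s) c }

      private
        tr-P : ∀ s c → tr whileAll (inP s) c ≡ gP (tr p s c)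
        tr-P s c = cong (λ z → tr′ z c) (Finₚ.splitAt-↑ˡ m₁ s m₂)
        tr-Q : ∀ s c → tr whileAll (inQ s) c ≡ gQ (tr q s c)
        tr-Q s c = cong (λ z → tr′ z c) (Finₚ.splitAt-↑ʳ m₁ m₂ s)

        run-P : ∀ {s t k t' l c t″} → Run p s t k true t' → Run whileAll (inQ zero) t' l c t″ → Run whileAll (inP s) t (k + l) c t″
        run-P {s} {t} (exit eq) h = next (trans (tr-P s (cur t)) (cong gP eq)) h
        run-P {s} {t} (next eq g) h = next (trans (tr-P s (cur t)) (cong gP eq)) (run-P g h)

        run-Q : ∀ {s t k t' l c t″} → Run q s t k true t' → Run whileAll zero t' l c t″ → Run whileAll (inQ s) t (k + l) c t″
        run-Q {s} {t} (exit eq) h = next (trans (tr-Q s (cur t)) (cong gQ eq)) h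
        run-Q {s} {t} (next eq g) h = next (trans (tr-Q s (cur t)) (cong gQ eq)) (run-Q g h)

        end-P : ∀ {s t k t'} → Run p s t k false t' → Run whileAll (inP s) t k true t'
        end-P {s} {t} (exit eq) = exit (trans (tr-P s (cur t)) (cong gP eq))
        end-P {s} {t} (next eq g) = next (trans (tr-P s (cur t)) (cong gP eq)) (end-P g)

        end-Q : ∀ {s t k t'} → Run q s t k false t' → Run whileAll (inQ s) t k false t'
        end-Q {s} {t} (exit eq) = exit (trans (tr-Q s (cur t)) (cong gQ eq))
        end-Q {s} {t} (next eq g) = next (trans (tr-Q s (cur t)) (cong gQ eq)) (end-Q g)

      run-while-done : ∀ {t k t'} → Run p zero t k false t' → Run whileAll zero t k true t'
      run-while-done = end-P

      run-while-stop : ∀ {t k t' l t″} → Run p zero t k true t' → Run q zero t' l false t″ → Run whileAll zero t (k + l) false t″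
      run-while-stop g h = run-P g (end-Q h)

      run-while-more : ∀ {t k t' l t″ m b t‴} → Run p zero t k true t' → Run q zero t' l true t″ → Run whileAll zero t″ m b t‴ →
        Run whileAll zero t (k + (l + m)) b t‴
      run-while-more g h i = run-P g (run-Q h i)

-- Cells with flags, and sweeps over the tape.

module Sweeps where
  open Machines

  -- a cell carries a bit and k flags
  extra : ℕ → ℕ
  extra zero = 0
  extra (suc k) = extra k + (2 + extra k)

  -- `2 + extra (suc k)` computes to twice `2 + extra k`, so `splitAt` takes off one flag at a time.
  code : ∀ {k} → Vec Bool k → Bool → Fin (2 + extra k)
  code [] false = zero
  code [] true = suc zero
  code {suc k} (false ∷ fs) b = code fs b ↑ˡ (2 + extra k)
  code {suc k} (true ∷ fs) b = (2 + extra k) ↑ʳ code fs b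

  decode : ∀ k → Fin (2 + extra k) → Vec Bool k × Bool
  decode′ : ∀ k → Fin (2 + extra k) ⊎ Fin (2 + extra k) → Vec Bool (suc k) × Bool
  decode zero zero = [] , false
  decode zero (suc _) = [] , true
  decode (suc k) c = decode′ k (splitAt (2 + extra k) c)
  decode′ k (inj₁ d) = let (fs , b) = decode k d in false ∷ fs , b
  decode′ k (inj₂ d) = let (fs , b) = decode k d in true ∷ fs , b

  decode-code : ∀ {k} (fs : Vec Bool k) b → decode k (code fs b) ≡ (fs , b)
  decode-code [] false = refl
  decode-code [] true = refl
  decode-code {suc k} (false ∷ fs) b = trans (cong (decode′ k) (Finₚ.splitAt-↑ˡ (2 + extra k) (code fs b) (2 + extra k)))
    (cong (λ z → false ∷ proj₁ z , proj₂ z) (decode-code fs b))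
  decode-code {suc k} (true ∷ fs) b = trans (cong (decode′ k) (Finₚ.splitAt-↑ʳ (2 + extra k) (2 + extra k) (code fs b)))
    (cong (λ z → true ∷ proj₁ z , proj₂ z) (decode-code fs b))

  -- A bit without flags is the input symbol itself, so the input tape already consists of valid
  -- cells.
  code-plain : ∀ k b → suc (code (Vec.replicate k false) b) ≡ bitSym {extra k} b
  code-plain zero false = refl
  code-plain zero true = refl
  code-plain (suc k) false = cong (λ z → Fin.suc (z ↑ˡ (2 + extra k))) (Finₚ.suc-injective (code-plain k false))
  code-plain (suc k) true = cong (λ z → Fin.suc (z ↑ˡ (2 + extra k))) (Finₚ.suc-injective (code-plain k true))

  module Sweep (k : ℕ) where
    Cell : Set
    Cell = Vec Bool k × Bool

    enc : Cell → Sym (extra k)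
    enc (fs , b) = suc (code fs b)

    Transducer : Set
    Transducer = Bool → Cell → Bool × Vec Bool k

    mealy : Transducer → Bool → List Cell → Bool × List Cell
    mealy f b [] = b , []
    mealy f b (c@(_ , v) ∷ cs) = let (b' , fs) = f b c ; (b″ , cs') = mealy f b' cs in b″ , (fs , v) ∷ cs'

    private
      goR goL : Bool → Fin 4
      goR false = zero
      goR true = suc zero
      goL false = suc (suc zero)
      goL true = suc (suc (suc zero))

      dir : Fin 4 → Bool × Bool
      dir zero = true , false
      dir (suc zero) = true , true
      dir (suc (suc zero)) = false , false
      dir (suc (suc (suc zero))) = false , true

      module _ (f : Transducer) (g : Bool → Bool) where
        write : Bool × Vec Bool k → Bool → (Fin 4 ⊎ Bool) × Sym (extra k) × Move
        write (b' , fs) v = inj₁ (goR b') , enc (fs , v) , R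

        tr′ : Bool × Bool → Sym (extra k) → (Fin 4 ⊎ Bool) × Sym (extra k) × Move
        tr′ (true , b) zero = inj₁ (goL b) , blank , L
        tr′ (true , b) (suc c) = write (f b (decode k c)) (proj₂ (decode k c))
        tr′ (false , b) zero = inj₂ (g b) , blank , R
        tr′ (false , b) (suc c) = inj₁ (goL b) , suc c , L

    -- one pass to the right through the cells, applying the transducer, and back to the first cell
    sweep : Transducer → (Bool → Bool) → Prog (extra k)
    sweep f g = record { last = 3 ; tr = λ s → tr′ f g (dir s) }

    -- Outside the word there is either untouched tape or the one blank that is written at the
    -- turning point.
    Margin : List (Sym (extra k)) → Set
    Margin l = l ≡ [] ⊎ l ≡ blank ∷ []

    module _ (f : Transducer) (g : Bool → Bool) where
      private
        tr-right : ∀ b c → tr (sweep f g) (goR b) c ≡ tr′ f g (true , b) c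
        tr-right false c = refl
        tr-right true c = refl
        tr-left : ∀ b c → tr (sweep f g) (goL b) c ≡ tr′ f g (false , b) c
        tr-left false c = refl
        tr-left true c = refl

        finish : ∀ b {l} r → Margin l → Run (sweep f g) (goL b) (onL l r) 1 (g b) (onR (blank ∷ []) r)
        finish b r (inj₁ refl) = exit (tr-left b blank)
        finish b r (inj₂ refl) = exit (tr-left b blank)

        pass : ∀ cs b l {tl m v t} → Margin tl →
          Run (sweep f g) (goL (proj₁ (mealy f b cs))) (onL l (map enc (proj₂ (mealy f b cs)) ++ blank ∷ [])) m v t →
          Run (sweep f g) (goR b) (onR l (map enc cs ++ tl)) (2 * length cs + suc m) v t
        pass [] b l (inj₁ refl) h = next (tr-right b blank) h
        pass [] b l (inj₂ refl) h = next (tr-right b blank) h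
        pass (c@(fs , v) ∷ cs) b l {tl} {m} {u} {t} mg h = subst (λ n → Run (sweep f g) (goR b) (onR l (map enc (c ∷ cs) ++ tl)) n u t) count
          (next (trans (tr-right b (enc c)) (cong (λ z → write f g (f b z) (proj₂ z)) (decode-code fs v)))
            (pass cs (proj₁ (f b c)) (enc c″ ∷ l) mg
              (next (tr-left (proj₁ (mealy f b (c ∷ cs))) (enc c″)) h)))
          where
          c″ : Cell
          c″ = proj₂ (f b c) , v
          count : suc (2 * length cs + suc (suc m)) ≡ 2 * length (c ∷ cs) + suc m
          count = trans (cong suc (ℕₚ.+-suc (2 * length cs) (suc m))) (cong (_+ suc m) (sym (ℕₚ.*-suc 2 (length cs))))

      sweep-run : ∀ cs {l tl} → Margin l → Margin tl →
        Run (sweep f g) zero (onR l (map enc cs ++ tl)) (2 * length cs + 2) (g (proj₁ (mealy f false cs)))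
          (onR (blank ∷ []) (map enc (proj₂ (mealy f false cs)) ++ blank ∷ []))
      sweep-run cs ml mt = pass cs false _ mt (finish (proj₁ (mealy f false cs)) _ ml)

-- A programming language on pointer variables.

module Variables where
  open Machines
  open Sweeps

  State : Set
  State = ℕ → ℕ

  ≡ᵇ-refl : ∀ n → (n ≡ᵇ n) ≡ true
  ≡ᵇ-refl zero = refl
  ≡ᵇ-refl (suc n) = ≡ᵇ-refl n

  ≡ᵇ-false : ∀ {m n} → m ≢ n → (m ≡ᵇ n) ≡ false
  ≡ᵇ-false {zero} {zero} n = ⊥-elim (n refl)
  ≡ᵇ-false {zero} {suc _} n = refl
  ≡ᵇ-false {suc _} {zero} n = refl
  ≡ᵇ-false {suc m} {suc n} h = ≡ᵇ-false (h ∘ cong suc)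

  ≡ᵇ-true : ∀ m n → (m ≡ᵇ n) ≡ true → m ≡ n
  ≡ᵇ-true zero zero _ = refl
  ≡ᵇ-true (suc m) (suc n) h = cong suc (≡ᵇ-true m n h)

  abstract
    upd : State → ℕ → ℕ → State
    upd σ v x u = if u ≡ᵇ v then x else σ u

    upd-if : ∀ σ v x u → upd σ v x u ≡ (if u ≡ᵇ v then x else σ u)
    upd-if σ v x u = refl

  upd-same : ∀ σ v x → upd σ v x v ≡ x
  upd-same σ v x = trans (upd-if σ v x v) (cong (if_then x else σ v) (≡ᵇ-refl v))

  upd-other : ∀ σ {v u} x → u ≢ v → upd σ v x u ≡ σ u
  upd-other σ {v} {u} x n = trans (upd-if σ v x u) (cong (if_then x else σ u) (≡ᵇ-false n))

  -- out of range reads as false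
  nth : List Bool → ℕ → Bool
  nth [] _ = false
  nth (b ∷ w) zero = b
  nth (b ∷ w) (suc i) = nth w i

  anyFrom : (ℕ → Bool → Bool) → List Bool → ℕ → Bool
  anyFrom h [] p = false
  anyFrom h (v ∷ w) p = h p v ∨ anyFrom h w (suc p)

  anyFrom-false : ∀ h w p → (∀ q v → p ≤ q → h q v ≡ false) → anyFrom h w p ≡ false
  anyFrom-false h [] p e = refl
  anyFrom-false h (v ∷ w) p e rewrite e p v ℕₚ.≤-refl = anyFrom-false h w (suc p) λ q v l → e q v (ℕₚ.<⇒≤ l)

  anyFrom-true : ∀ h w p d → d < length w → (∀ v → h (p + d) v ≡ true) → anyFrom h w p ≡ true
  anyFrom-true h (v ∷ w) p zero l e rewrite trans (cong (λ q → h q v) (sym (ℕₚ.+-identityʳ p))) (e v) = refl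
  anyFrom-true h (v ∷ w) p (suc d) (s≤s l) e = trans (cong (h p v ∨_) (anyFrom-true h w (suc p) d l λ u →
    trans (cong (λ q → h q u) (sym (ℕₚ.+-suc p d))) (e u))) (Boolₚ.∨-zeroʳ (h p v))

  anyFrom-nth : ∀ w p d → anyFrom (λ q v → (p + d ≡ᵇ q) ∧ v) w p ≡ nth w d
  anyFrom-nth [] p d = refl
  anyFrom-nth (v ∷ w) p zero rewrite ℕₚ.+-identityʳ p | ≡ᵇ-refl p
    | anyFrom-false (λ q v → (p ≡ᵇ q) ∧ v) w (suc p) (λ q v l → cong (_∧ v) (≡ᵇ-false (ℕₚ.<⇒≢ l))) = Boolₚ.∨-identityʳ v
  anyFrom-nth (v ∷ w) p (suc d) rewrite ≡ᵇ-false {p + suc d} {p} (λ e → ℕₚ.<⇒≢ (ℕₚ.m<m+n p {suc d} (s≤s z≤n)) (sym e)) | ℕₚ.+-suc p d = anyFrom-nth w (suc p) d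

  -- programs on the variables σ 0, …, σ k′, each a position marked by a flag on the read-only word w
  -- (a value beyond the end of w is an absent flag)
  module Pointers (k′ : ℕ) where
    K : ℕ
    K = suc k′
    open Sweep K

    idx : ℕ → Fin K
    idx v with v <? K
    ... | yes l = fromℕ< l
    ... | no _ = zero

    idx-toℕ : ∀ {v} → v < K → toℕ (idx v) ≡ v
    idx-toℕ {v} l with v <? K
    ... | yes l' = Finₚ.toℕ-fromℕ< l'
    ... | no n = ⊥-elim (n l)

    setf : ℕ → Bool → Vec Bool K → Vec Bool K
    setf v b fs = Vec.tabulate λ j → if toℕ j ≡ᵇ v then b else Vec.lookup fs j

    getf : ℕ → Vec Bool K → Bool
    getf v fs = Vec.lookup fs (idx v)

    data Code : Set where
      zeroV incV bitT : ℕ → Code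
      copyV eqT neT : ℕ → ℕ → Code
      constT : Bool → Code
      branch : Code → Code → Code → Code
      loop : Code → Code → Code

    -- zeroV, incV and copyV assign to their first variable; bitT, eqT and neT test
    compile : Code → Prog (extra K)
    -- The state of the transducer tells whether the first cell has been passed; only that cell
    -- receives the flag.
    compile (zeroV v) = sweep (λ b (fs , _) → true , setf v (not b) fs) (λ _ → true)
    -- The flag is delayed by one cell. At the last cell it falls off the word.
    compile (incV v) = sweep (λ b (fs , _) → getf v fs , setf v b fs) (λ _ → true)
    compile (copyV v u) = sweep (λ b (fs , _) → b , setf v (getf u fs) fs) (λ _ → true)
    compile (bitT v) = sweep (λ b (fs , c) → b ∨ (getf v fs ∧ c) , fs) (λ b → b)
    -- Different values show in a cell that carries exactly one of the two flags.
    compile (eqT v u) = sweep (λ b (fs , _) → b ∨ (getf v fs xor getf u fs) , fs) not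
    compile (neT v u) = sweep (λ b (fs , _) → b ∨ (getf v fs xor getf u fs) , fs) (λ b → b)
    compile (constT b) = sweep (λ b (fs , _) → b , fs) (λ _ → b)
    compile (branch p q r) = ite (compile p) (compile q) (compile r)
    compile (loop p q) = whileAll (compile p) (compile q)

    infixr 5 _⨾_
    _⨾_ : Code → Code → Code
    p ⨾ q = branch p q (constT false)

    module OnWord (w : List Bool) where
      N : ℕ
      N = length w

      flags : State → ℕ → Vec Bool K
      flags σ p = Vec.tabulate λ i → σ (toℕ i) ≡ᵇ p

      cells : List Bool → State → ℕ → List Cell
      cells [] σ p = []
      cells (b ∷ w) σ p = (flags σ p , b) ∷ cells w σ (suc p)

      Rep : State → Tape → Set
      Rep σ t = ∃ λ l → ∃ λ r → Margin l × Margin r × t ≡ onR l (map enc (cells w σ 0) ++ r)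

      record ExecN (p : Code) (σ : State) (n : ℕ) (b : Bool) (σ' : State) : Set where
        constructor exec
        field
          runs : ∀ {t} → Rep σ t → ∃ λ t' → ∃ λ m → m ≤ n × Run (compile p) zero t m b t' × Rep σ' t'
      open ExecN public

      -- All times are powers of X. The exponents do not depend on w: a composition adds one to the larger exponent, a loop two.
      X : ℕ
      X = 2 + N

      record Exec (p : Code) (σ : State) (a : ℕ) (b : Bool) (σ' : State) : Set where
        constructor pow
        field
          execN : ExecN p σ (X ^ a) b σ'
      open Exec public

      private
        len-cells : ∀ w σ p → length (cells w σ p) ≡ length w
        len-cells [] σ p = refl
        len-cells (b ∷ w) σ p = cong suc (len-cells w σ (suc p))

        getf-flags : ∀ σ p {v} → v < K → getf v (flags σ p) ≡ (σ v ≡ᵇ p)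
        getf-flags σ p {v} l = trans (Vecₚ.lookup∘tabulate (λ i → σ (toℕ i) ≡ᵇ p) (idx v)) (cong (λ u → σ u ≡ᵇ p) (idx-toℕ l))

        setf-flags : ∀ σ p v x → setf v (x ≡ᵇ p) (flags σ p) ≡ flags (upd σ v x) p
        setf-flags σ p v x = Vecₚ.tabulate-cong λ j → trans (cong (if toℕ j ≡ᵇ v then x ≡ᵇ p else_) (Vecₚ.lookup∘tabulate (λ i → σ (toℕ i) ≡ᵇ p) j)) (trans (push (toℕ j ≡ᵇ v) x (σ (toℕ j))) (cong (_≡ᵇ p) (sym (upd-if σ v x (toℕ j)))))
          where
          push : ∀ c a b → (if c then a ≡ᵇ p else b ≡ᵇ p) ≡ ((if c then a else b) ≡ᵇ p)
          push true _ _ = refl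
          push false _ _ = refl

        module _ (f : Transducer) (g : Bool → Bool) where
          exec-sweep : ∀ p → compile p ≡ sweep f g → ∀ σ σ' b → mealy f false (cells w σ 0) ≡ (b , cells w σ' 0) → Exec p σ 2 (g b) σ'
          exec-sweep p pe σ σ' b e = pow (exec λ { (l , r , ml , mr , refl) → _ , _ , bound , subst (λ P → Run P zero _ _ (g b) _) (sym pe) (subst (λ z → Run (sweep f g) zero _ _ (g (proj₁ z)) (onR (blank ∷ []) (map enc (proj₂ z) ++ blank ∷ []))) e
              (sweep-run f g (cells w σ 0) ml mr)) , (blank ∷ [] , blank ∷ [] , inj₂ refl , inj₂ refl , refl) })
            where
            bound : 2 * length (cells w σ 0) + 2 ≤ X ^ 2
            bound rewrite len-cells w σ 0 = ℕₚ.≤-trans (ℕₚ.≤-reflexive (trans (ℕₚ.+-comm (2 * N) 2) (sym (ℕₚ.*-suc 2 N))))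
              (ℕₚ.≤-trans (ℕₚ.*-mono-≤ {2} {X} (s≤s (s≤s z≤n)) (ℕₚ.n≤1+n (suc N))) (ℕₚ.≤-reflexive (cong (X *_) (sym (ℕₚ.*-identityʳ X)))))

        mealy-move : ∀ f (s : ℕ → Bool) σ σ' → (∀ p v → f (s p) (flags σ p , v) ≡ (s (suc p) , flags σ' p)) →
          ∀ u p → ∃ λ b → mealy f (s p) (cells u σ p) ≡ (b , cells u σ' p)
        mealy-move f s σ σ' h [] p = s p , refl
        mealy-move f s σ σ' h (v ∷ u) p rewrite h p v with mealy-move f s σ σ' h u (suc p)
        ... | b , e rewrite e = b , refl

        mealy-any : ∀ (h : Vec Bool K → Bool → Bool) (h' : ℕ → Bool → Bool) σ → (∀ p v → h (flags σ p) v ≡ h' p v) →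
          ∀ u p b → mealy (λ b (fs , v) → b ∨ h fs v , fs) b (cells u σ p) ≡ (b ∨ anyFrom h' u p , cells u σ p)
        mealy-any h h' σ e [] p b = cong (_, []) (sym (Boolₚ.∨-identityʳ b))
        mealy-any h h' σ e (v ∷ u) p b rewrite mealy-any h h' σ e u (suc p) (b ∨ h (flags σ p) v) | e p v =
          cong (_, _) (Boolₚ.∨-assoc b (h' p v) (anyFrom h' u (suc p)))

      abstract
        exec-zero : ∀ σ v → Exec (zeroV v) σ 2 true (upd σ v 0)
        exec-zero σ v = let (b , e) = mealy-move f later σ (upd σ v 0) clear w 0 in exec-sweep f (λ _ → true) (zeroV v) refl σ (upd σ v 0) b e
          where
          f : Transducer
          f b (fs , _) = true , setf v (not b) fs
          later : ℕ → Bool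
          later zero = false
          later (suc _) = true
          clear : ∀ p c → f (later p) (flags σ p , c) ≡ (later (suc p) , flags (upd σ v 0) p)
          clear zero c = cong (true ,_) (setf-flags σ 0 v 0)
          clear (suc p) c = cong (true ,_) (setf-flags σ (suc p) v 0)

      abstract
        exec-inc : ∀ σ v → v < K → Exec (incV v) σ 2 true (upd σ v (suc (σ v)))
        exec-inc σ v l = let (b , e) = mealy-move _ (λ p → suc (σ v) ≡ᵇ p) σ (upd σ v (suc (σ v)))
                               (λ p c → cong₂ _,_ (getf-flags σ p l) (setf-flags σ p v (suc (σ v)))) w 0 in exec-sweep _ _ (incV v) refl σ _ b e

      abstract
        exec-copy : ∀ σ v u → u < K → Exec (copyV v u) σ 2 true (upd σ v (σ u))
        exec-copy σ v u l = let (b , e) = mealy-move _ (λ p → false) σ (upd σ v (σ u))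
                                       (λ p c → cong (false ,_) (trans (cong (λ b → setf v b (flags σ p)) (getf-flags σ p l)) (setf-flags σ p v (σ u)))) w 0 in exec-sweep _ _ (copyV v u) refl σ _ b e

      abstract
        exec-const : ∀ σ b → Exec (constT b) σ 2 b σ
        exec-const σ b = let (c , e) = mealy-move _ (λ _ → false) σ σ (λ p v → refl) w 0 in exec-sweep _ _ (constT b) refl σ _ c e

      abstract
        exec-bit : ∀ σ v → v < K → Exec (bitT v) σ 2 (nth w (σ v)) σ
        exec-bit σ v l = subst (λ b → Exec (bitT v) σ 2 b σ) (anyFrom-nth w 0 (σ v))
          (exec-sweep _ _ (bitT v) refl σ σ _ (mealy-any _ _ σ (λ p c → cong (_∧ c) (getf-flags σ p l)) w 0 false))

      private
        differ : ∀ {a b} → a < N ⊎ b < N → anyFrom (λ p _ → (a ≡ᵇ p) xor (b ≡ᵇ p)) w 0 ≡ not (a ≡ᵇ b)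
        differ {a} {b} l with a ℕₚ.≟ b
        ... | yes refl rewrite ≡ᵇ-refl a = anyFrom-false _ w 0 λ q v _ → Boolₚ.xor-same (a ≡ᵇ q)
        ... | no n rewrite ≡ᵇ-false n with l
        ... | inj₁ la = anyFrom-true _ w 0 a la λ v → cong₂ _xor_ (≡ᵇ-refl a) (≡ᵇ-false (n ∘ sym))
        ... | inj₂ lb = anyFrom-true _ w 0 b lb λ v → cong₂ _xor_ (≡ᵇ-false n) (≡ᵇ-refl b)

        mealy-eq : ∀ σ {v u} → v < K → u < K → σ v < N ⊎ σ u < N →
          mealy (λ b (fs , _) → b ∨ (getf v fs xor getf u fs) , fs) false (cells w σ 0) ≡ (not (σ v ≡ᵇ σ u) , cells w σ 0)
        mealy-eq σ lv lu l = trans (mealy-any _ (λ p _ → (σ _ ≡ᵇ p) xor (σ _ ≡ᵇ p)) σ (λ p c → cong₂ _xor_ (getf-flags σ p lv) (getf-flags σ p lu)) w 0 false)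
          (cong (_, cells w σ 0) (differ l))

      abstract
        -- One of the values has to be a genuine position, since two different values beyond the end
        -- leave no flags and would pass as equal.
        exec-eq : ∀ σ v u → v < K → u < K → σ v < N ⊎ σ u < N → Exec (eqT v u) σ 2 (σ v ≡ᵇ σ u) σ
        exec-eq σ v u lv lu l = subst (λ b → Exec (eqT v u) σ 2 b σ) (Boolₚ.not-involutive _) (exec-sweep _ not (eqT v u) refl σ σ _ (mealy-eq σ lv lu l))

      abstract
        exec-ne : ∀ σ v u → v < K → u < K → σ v < N ⊎ σ u < N → Exec (neT v u) σ 2 (not (σ v ≡ᵇ σ u)) σ
        exec-ne σ v u lv lu l = exec-sweep _ _ (neT v u) refl σ σ _ (mealy-eq σ lv lu l)

      X^ : ∀ {a b} → a ≤ b → X ^ a ≤ X ^ b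
      X^ = ℕₚ.^-monoʳ-≤ X

      X+ : ∀ a b → X ^ a + X ^ b ≤ X ^ suc (a ⊔ b)
      X+ a b = ℕₚ.≤-trans (ℕₚ.+-mono-≤ (X^ (ℕₚ.m≤m⊔n a b)) (X^ (ℕₚ.m≤n⊔m a b)))
        (ℕₚ.≤-trans (ℕₚ.≤-reflexive (cong (X ^ (a ⊔ b) +_) (sym (ℕₚ.+-identityʳ _)))) (ℕₚ.*-monoˡ-≤ (X ^ (a ⊔ b)) {2} {X} (s≤s (s≤s z≤n))))

      abstract
        exec-weaken : ∀ {p σ n n' b σ'} → n ≤ n' → ExecN p σ n b σ' → ExecN p σ n' b σ'
        exec-weaken l e = exec λ rep → let (t , m , h , r) = runs e rep in t , m , ℕₚ.≤-trans h l , r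

      abstract
        exec-pow : ∀ {p σ a a' b σ'} → a ≤ a' → Exec p σ a b σ' → Exec p σ a' b σ'
        exec-pow l e = pow (exec-weaken (X^ l) (execN e))

      abstract
        exec-branch-true : ∀ {p q r σ σ' σ″ a a' b} → Exec p σ a true σ' → Exec q σ' a' b σ″ → Exec (branch p q r) σ (suc (a ⊔ a')) b σ″
        exec-branch-true {p} {q} {r} {a = a} {a'} e f = pow (exec λ rep →
          let (t , m , l , run , rep') = runs (execN e) rep
              (t' , m' , l' , run' , rep″) = runs (execN f) rep'
          in t' , m + m' , ℕₚ.≤-trans (ℕₚ.+-mono-≤ l l') (X+ a a') , run-ite-true (compile p) (compile q) (compile r) run run' , rep″)

      abstract
        exec-branch-false : ∀ {p q r σ σ' σ″ a a' b} → Exec p σ a false σ' → Exec r σ' a' b σ″ → Exec (branch p q r) σ (suc (a ⊔ a')) b σ″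
        exec-branch-false {p} {q} {r} {a = a} {a'} e f = pow (exec λ rep →
          let (t , m , l , run , rep') = runs (execN e) rep
              (t' , m' , l' , run' , rep″) = runs (execN f) rep'
          in t' , m + m' , ℕₚ.≤-trans (ℕₚ.+-mono-≤ l l') (X+ a a') , run-ite-false (compile p) (compile q) (compile r) run run' , rep″)

      module _ (p q : Code) (a m : ℕ) (m≤N : m ≤ N) (I : ℕ → State → Set) (Fail : State → Set)
        (body : ∀ j σ → j < m → I j σ → ∃ λ b → ∃ λ σ' → ∃ λ σ₁ → Exec p σ a true σ₁ × Exec q σ₁ a b σ' × (b ≡ true → I (suc j) σ') × (b ≡ false → Fail σ'))
        (done : ∀ σ → I m σ → Exec p σ a false σ) where
        private
          Result : State → ℕ → Set
          Result σ n = ∃ λ b → ∃ λ σ' → ExecN (loop p q) σ n b σ' × (b ≡ true → I m σ') × (b ≡ false → Fail σ')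

          -- Each of the `d` remaining passes costs a test and a body, and one last test ends the
          -- loop.
          go : ∀ d j σ → j + d ≡ m → I j σ → Result σ (suc (2 * d) * X ^ a)
          go zero j σ e i rewrite trans (sym (ℕₚ.+-identityʳ j)) e = true , σ , exec (λ rep →
            let (t , n , l , run , rep') = runs (execN (done σ i)) rep in
            t , n , ℕₚ.≤-trans l (ℕₚ.≤-reflexive (sym (ℕₚ.+-identityʳ _))) , run-while-done (compile p) (compile q) run , rep') , (λ _ → i) , λ ()
          go (suc d) j σ e i with body j σ (subst (suc j ≤_) e (ℕₚ.≤-trans (s≤s (ℕₚ.m≤m+n j d)) (ℕₚ.≤-reflexive (sym (ℕₚ.+-suc j d))))) i
          ... | false , σ' , σ₁ , ep , eq , _ , f = false , σ' , exec (λ rep →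
                let (t , n , l , run , rep') = runs (execN ep) rep
                    (t' , n' , l' , run' , rep″) = runs (execN eq) rep'
                in t' , n + n' , ℕₚ.≤-trans (ℕₚ.+-mono-≤ l l') (ℕₚ.≤-trans two (ℕₚ.*-monoˡ-≤ (X ^ a) {3} {suc (2 * suc d)} (s≤s (ℕₚ.*-monoʳ-≤ 2 {1} {suc d} (s≤s z≤n))))) ,
                   run-while-stop (compile p) (compile q) run run' , rep″) , (λ ()) , f
            where
            two : X ^ a + X ^ a ≤ 3 * X ^ a
            two = ℕₚ.+-monoʳ-≤ (X ^ a) (ℕₚ.m≤m+n (X ^ a) _)
          ... | true , σ' , σ₁ , ep , eq , i' , _ with go d (suc j) σ' (trans (sym (ℕₚ.+-suc j d)) e) (i' refl)
          ... | b , σ″ , er , good , bad = b , σ″ , exec (λ rep →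
                let (t , n , l , run , rep') = runs (execN ep) rep
                    (t' , n' , l' , run' , rep″) = runs (execN eq) rep'
                    (t″ , n″ , l″ , run″ , rep‴) = runs er rep″
                in t″ , n + (n' + n″) , ℕₚ.≤-trans (ℕₚ.+-mono-≤ l (ℕₚ.+-mono-≤ l' l″))
                     (ℕₚ.≤-reflexive (cong (λ z → suc z * X ^ a) (sym (ℕₚ.*-suc 2 d)))) , run-while-more (compile p) (compile q) run run' run″ , rep‴) , good , bad

        abstract
          exec-loop : ∀ σ → I 0 σ → ∃ λ b → ∃ λ σ' → Exec (loop p q) σ (2 + a) b σ' × (b ≡ true → I m σ') × (b ≡ false → Fail σ')
          exec-loop σ i with go m 0 σ refl i
          ... | b , σ' , e , good , bad = b , σ' , pow (exec-weaken bound e) , good , bad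
            where
            bound : suc (2 * m) * X ^ a ≤ X ^ (2 + a)
            bound = ℕₚ.≤-trans (ℕₚ.*-monoˡ-≤ (X ^ a) small) (ℕₚ.≤-reflexive (ℕₚ.*-assoc X X (X ^ a)))
              where
              small : suc (2 * m) ≤ X * X
              small = ℕₚ.≤-trans (ℕₚ.≤-trans (ℕₚ.n≤1+n _) (ℕₚ.≤-reflexive (sym (ℕₚ.*-suc 2 m))))
                (ℕₚ.*-mono-≤ {2} {X} (s≤s (s≤s z≤n)) (s≤s (ℕₚ.≤-trans m≤N (ℕₚ.n≤1+n N))))

-- Programs that evaluate the game.

module Evaluation where
  open Machines
  open Sweeps
  open Variables

  allBelow : ℕ → (ℕ → Bool) → Bool
  allBelow zero p = true
  allBelow (suc j) p = allBelow j p ∧ p j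

  cntBelow : ℕ → (ℕ → Bool) → ℕ
  cntBelow zero p = 0
  cntBelow (suc j) p = cntBelow j p + bit (p j)

  eqb : Bool → Bool → Bool
  eqb a b = if a then b else not b

  -- the game on numbers below n: adjacency α s on side s, counting the answers instead of choosing a bijection
  module NatGame (n : ℕ) (α : Bool → ℕ → ℕ → Bool) where
    row : Bool → Bool → ℕ → ℕ → List ℕ → List ℕ → Bool
    row s s' x y (u ∷ us) (v ∷ vs) = eqb (α s x u) (α s' y v) ∧ (eqb (x ≡ᵇ u) (y ≡ᵇ v) ∧ row s s' x y us vs)
    row s s' x y _ _ = true

    atom : Bool → Bool → List ℕ → List ℕ → Bool
    atom s s' (x ∷ xs) (y ∷ ys) = row s s' x y xs ys ∧ atom s s' xs ys
    atom s s' _ _ = true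

    -- How often the type of `x` occurs on its own side is found by the same recursion, with side
    -- `s` compared to itself. So no list of types is ever needed.
    eqv : ℕ → Bool → Bool → List ℕ → List ℕ → Bool
    eqv zero s s' xs ys = atom s s' xs ys
    eqv (suc r) s s' xs ys = allBelow n λ x →
      cntBelow n (λ y → eqv r s s (x ∷ xs) (y ∷ xs)) ≡ᵇ cntBelow n (λ y → eqv r s s' (x ∷ xs) (y ∷ ys))

  -- the evaluation of r rounds changes only the variables below frame r
  frame : ℕ → ℕ
  frame zero = 3
  frame (suc r) = 4 + frame r

  seqE : ℕ → ℕ → ℕ
  seqE a b = suc (a ⊔ b)

  module Programs (k′ : ℕ) where
    open Pointers k′

    -- the last variable holds the start of the second graph
    β : ℕ
    β = k′

    addLoop : Code → ℕ → Code
    addLoop test c = loop test (incV 0 ⨾ incV c)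

    start : Bool → Code
    start s = if s then copyV 0 β else zeroV 0

    -- variable 0 := position of the matrix entry (x , y) of graph s
    addr : Bool → ℕ → ℕ → Code
    addr s x y = start s ⨾ (zeroV 1 ⨾ addLoop (bitT 1) 1) ⨾ incV 0 ⨾ zeroV 1 ⨾
      loop (neT 1 x) ((zeroV 2 ⨾ addLoop (bitT 2) 2) ⨾ incV 1) ⨾ zeroV 2 ⨾ addLoop (neT 2 y) 2

    adjP : Bool → ℕ → ℕ → Code
    adjP s x y = branch (addr s x y) (bitT 0) (constT false)

    sameP : Code → Code → Code
    sameP p q = branch p q (branch q (constT false) (constT true))

    rowP : Bool → Bool → ℕ → ℕ → List ℕ → List ℕ → Code
    rowP s s' x y (u ∷ us) (v ∷ vs) = sameP (adjP s x u) (adjP s' y v) ⨾ sameP (eqT x u) (eqT y v) ⨾ rowP s s' x y us vs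
    rowP s s' x y _ _ = constT true

    atomP : Bool → Bool → List ℕ → List ℕ → Code
    atomP s s' (x ∷ xs) (y ∷ ys) = rowP s s' x y xs ys ⨾ atomP s s' xs ys
    atomP s s' _ _ = constT true

    -- The word begins with `n` ones and a zero, so `bitT y` acts as the test that `y` is below `n`.
    countP : ℕ → ℕ → Code → Code
    countP c y p = zeroV c ⨾ zeroV y ⨾ loop (bitT y) (branch p (incV c ⨾ incV y) (incV y))

    gameP : ℕ → Bool → Bool → List ℕ → List ℕ → Code
    gameP zero s s' xs ys = atomP s s' xs ys
    gameP (suc r) s s' xs ys = zeroV x ⨾ loop (bitT x)
        (countP c y (gameP r s s (x ∷ xs) (y ∷ xs)) ⨾ countP d y (gameP r s s' (x ∷ xs) (y ∷ ys)) ⨾ eqT c d ⨾ incV x)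
      where
      x y c d : ℕ
      x = frame r
      y = 1 + frame r
      c = 2 + frame r
      d = 3 + frame r

    -- The exponents mirror the programs: 2 for a sweep, `seqE` for a sequence or branch, 2 more for
    -- a loop.
    sameE : ℕ → ℕ → ℕ
    sameE a b = seqE a (seqE b 2)

    rowE : List ℕ → List ℕ → ℕ
    rowE (u ∷ us) (v ∷ vs) = seqE (sameE 15 15) (seqE (sameE 2 2) (rowE us vs))
    rowE _ _ = 2

    atomE : List ℕ → List ℕ → ℕ
    atomE (x ∷ xs) (y ∷ ys) = seqE (rowE xs ys) (atomE xs ys)
    atomE _ _ = 2

    countE : ℕ → ℕ
    countE a = seqE 2 (seqE 2 (2 + seqE a 3))

    gameE : ℕ → List ℕ → List ℕ → ℕ
    gameE zero xs ys = atomE xs ys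
    gameE (suc r) xs ys = seqE 2 (2 + seqE (countE (gameE r (frame r ∷ xs) (1 + frame r ∷ xs)))
      (seqE (countE (gameE r (frame r ∷ xs) (1 + frame r ∷ ys))) (seqE 2 2)))

    module Correct (w : List Bool) (n : ℕ) (n<N : n < length w) (pre : ∀ p → p < n → nth w p ≡ true) (end : nth w n ≡ false) where
      open OnWord w

      private
        n≤N : n ≤ N
        n≤N = ℕₚ.<⇒≤ n<N

      Achieves : Code → State → ℕ → (State → Set) → Set
      Achieves p σ a Q = ∃ λ σ' → Exec p σ a true σ' × Q σ'

      abstract
        achieve-seq : ∀ {p q σ a b Q R} → Achieves p σ a Q → (∀ σ' → Q σ' → Achieves q σ' b R) → Achieves (p ⨾ q) σ (seqE a b) R
        achieve-seq {p} {q} {a = a} {b} (σ' , e , h) k = let (σ″ , f , g) = k σ' h in σ″ , exec-branch-true e f , g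

      abstract
        achieve-map : ∀ {p σ a Q R} → (∀ σ' → Q σ' → R σ') → Achieves p σ a Q → Achieves p σ a R
        achieve-map h (σ' , e , q) = σ' , e , h σ' q

      abstract
        achieve-while : ∀ p q a m → m ≤ N → 2 ≤ a → (I : ℕ → State → Set) →
          (∀ j σ → j < m → I j σ → Exec p σ 2 true σ × Achieves q σ a (I (suc j))) → (∀ σ → I m σ → Exec p σ 2 false σ) →
          ∀ σ → I 0 σ → Achieves (loop p q) σ (2 + a) (I m)
        achieve-while p q a m l la I body done σ i
          with exec-loop p q a m l I (λ _ → ⊥) (λ j σ' j<m i' → let (e , σ″ , f , g) = body j σ' j<m i' in
                 true , σ″ , σ' , exec-pow la e , f , (λ _ → g) , λ ()) (λ σ' i' → exec-pow la (done σ' i')) σ i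
        ... | true , σ' , e , g , _ = σ' , e , g refl
        ... | false , _ , _ , _ , b = ⊥-elim (b refl)

      -- Variables below `v` are scratch space. This is the frame condition for the calls of a
      -- program.
      Above : ℕ → State → State → Set
      Above v σ σ' = ∀ u → v ≤ u → σ' u ≡ σ u

      upd-above : ∀ {v σ₀ σ i} x → i < v → Above v σ₀ σ → Above v σ₀ (upd σ i x)
      upd-above {σ = σ} x l h u le = trans (upd-other σ x (λ { refl → ℕₚ.<-irrefl refl (ℕₚ.<-≤-trans l le) })) (h u le)

      module _ (3≤β : 3 ≤ β) where
        private
          small : ∀ {v} → v ≤ 2 → v < K
          small l = s≤s (ℕₚ.≤-trans l (ℕₚ.≤-trans (ℕₚ.n≤1+n 2) 3≤β))

        abstract
          add-loop : ∀ test c m → m ≤ N → c ≢ 0 → c ≤ 2 → ∀ σ → σ c ≡ 0 →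
            (∀ j σ' → j < m → σ' c ≡ j → Above 3 σ σ' → Exec test σ' 2 true σ') →
            (∀ σ' → σ' c ≡ m → Above 3 σ σ' → Exec test σ' 2 false σ') →
            Achieves (addLoop test c) σ 5 λ σ' → σ' 0 ≡ σ 0 + m × (∀ u → u ≢ 0 → u ≢ c → σ' u ≡ σ u)
          add-loop test c m m≤N c≢0 c≤2 σ σc go stop =
            achieve-map (λ _ → proj₂) (achieve-while test (incV 0 ⨾ incV c) 3 m m≤N (s≤s (s≤s z≤n)) I body
              (λ σ' (cj , _ , h) → stop σ' cj (above h)) σ (σc , sym (ℕₚ.+-identityʳ (σ 0)) , λ _ _ _ → refl))
            where
            I : ℕ → State → Set
            I j σ' = σ' c ≡ j × σ' 0 ≡ σ 0 + j × (∀ u → u ≢ 0 → u ≢ c → σ' u ≡ σ u)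
            above : ∀ {σ'} → (∀ u → u ≢ 0 → u ≢ c → σ' u ≡ σ u) → Above 3 σ σ'
            above h u l = h u (λ { refl → case l of λ () }) (λ { refl → ℕₚ.<⇒≱ l c≤2 })
            body : ∀ j σ' → j < m → I j σ' → Exec test σ' 2 true σ' × Achieves (incV 0 ⨾ incV c) σ' 3 (I (suc j))
            body j σ' j<m (cj , z , h) = go j σ' j<m cj (above h) ,
              achieve-seq {incV 0} {incV c} {a = 2} {2} {Q = _≡ upd σ' 0 (suc (σ' 0))} (_ , exec-inc σ' 0 (small z≤n) , refl) (λ { _ refl →
                _ , exec-inc (upd σ' 0 (suc (σ' 0))) c (small c≤2) ,
                trans (upd-same (upd σ' 0 (suc (σ' 0))) c (suc (upd σ' 0 (suc (σ' 0)) c))) (cong suc (trans (upd-other σ' _ c≢0) cj)) ,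
                trans (upd-other (upd σ' 0 (suc (σ' 0))) _ (c≢0 ∘ sym)) (trans (trans (upd-same σ' 0 _) (cong suc z)) (sym (ℕₚ.+-suc (σ 0) j))) ,
                λ u n0 nc → trans (upd-other (upd σ' 0 (suc (σ' 0))) _ nc) (trans (upd-other σ' _ n0) (h u n0 nc)) })

        abstract
          bit-test : ∀ c → c < K → (∀ j σ' → j < n → σ' c ≡ j → Exec (bitT c) σ' 2 true σ') × (∀ σ' → σ' c ≡ n → Exec (bitT c) σ' 2 false σ')
          bit-test c l = (λ j σ' j<n e → subst (λ b → Exec (bitT c) σ' 2 b σ') (trans (cong (nth w) e) (pre j j<n)) (exec-bit σ' c l)) ,
            (λ σ' e → subst (λ b → Exec (bitT c) σ' 2 b σ') (trans (cong (nth w) e) end) (exec-bit σ' c l))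

        abstract
          ne-test : ∀ c x m → c < K → x < K → m < N → (∀ j σ' → j < m → σ' c ≡ j → σ' x ≡ m → Exec (neT c x) σ' 2 true σ') ×
            (∀ σ' → σ' c ≡ m → σ' x ≡ m → Exec (neT c x) σ' 2 false σ')
          ne-test c x m lc lx m<N = (λ j σ' j<m e f → subst (λ b → Exec (neT c x) σ' 2 b σ')
                (trans (cong₂ (λ a b → not (a ≡ᵇ b)) e f) (cong not (≡ᵇ-false (ℕₚ.<⇒≢ j<m)))) (exec-ne σ' c x lc lx (inj₂ (subst (_< N) (sym f) m<N)))) ,
            (λ σ' e f → subst (λ b → Exec (neT c x) σ' 2 b σ') (trans (cong₂ (λ a b → not (a ≡ᵇ b)) e f) (cong not (≡ᵇ-refl m)))
                (exec-ne σ' c x lc lx (inj₂ (subst (_< N) (sym f) m<N))))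

        abstract
          add-n : ∀ c → c ≢ 0 → c ≤ 2 → ∀ σ → Achieves (zeroV c ⨾ addLoop (bitT c) c) σ 6 λ σ' → σ' 0 ≡ σ 0 + n × (∀ u → u ≢ 0 → u ≢ c → σ' u ≡ σ u)
          add-n c c≢0 c≤2 σ = achieve-seq {zeroV c} {a = 2} {5} {Q = _≡ upd σ c 0} (_ , exec-zero σ c , refl) (λ { _ refl →
            achieve-map (λ σ' (z , h) → trans z (cong (_+ n) (upd-other σ 0 (c≢0 ∘ sym))) , λ u n0 nc → trans (h u n0 nc) (upd-other σ 0 nc))
              (add-loop (bitT c) c n n≤N c≢0 c≤2 (upd σ c 0) (upd-same σ c 0)
                (λ j σ' j<n e _ → proj₁ (bit-test c (small c≤2)) j σ' j<n e) (λ σ' e _ → proj₂ (bit-test c (small c≤2)) σ' e)) })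

        base : State → Bool → ℕ
        base σ s = if s then σ β else 0

        private
          addr-correct′ : ∀ s x y σ → 3 ≤ x → 3 ≤ y → x < K → y < K → σ x < N → σ y < N →
            Achieves (addr s x y) σ 14 λ σ' → σ' 0 ≡ suc (base σ s + n) + σ x * n + σ y × Above 3 σ σ'
          addr-correct′ s x y σ 3≤x 3≤y x<K y<K σx<N σy<N =
            achieve-seq {a = 2} {13} {Q = λ σ₁ → σ₁ 0 ≡ base σ s × Above 3 σ σ₁} (begin₀ s) λ σ₁ (z₁ , h₁) →
            achieve-seq {zeroV 1 ⨾ addLoop (bitT 1) 1} {a = 6} {12} (add-n 1 (λ ()) (s≤s z≤n) σ₁) λ σ₂ (z₂ , h₂) →
            achieve-seq {incV 0} {a = 2} {11} {Q = λ σ₃ → σ₃ 0 ≡ suc (base σ s + n) × Above 3 σ σ₃}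
              (_ , exec-inc σ₂ 0 (small z≤n) , trans (upd-same σ₂ 0 _) (cong suc (trans z₂ (cong (_+ n) z₁))) ,
                upd-above {3} {σ} {σ₂} {0} _ (s≤s z≤n) (λ u l → trans (h₂ u (λ { refl → case l of λ () }) (λ { refl → case l of λ { (s≤s ()) } })) (h₁ u l))) λ σ₃ (z₃ , h₃) →
            achieve-seq {zeroV 1} {a = 2} {10} {Q = λ σ₄ → σ₄ 1 ≡ 0 × σ₄ 0 ≡ suc (base σ s + n) × Above 3 σ σ₄}
              (_ , exec-zero σ₃ 1 , upd-same σ₃ 1 0 , trans (upd-other σ₃ 0 (λ ())) z₃ , upd-above {3} {σ} {σ₃} {1} 0 (s≤s (s≤s z≤n)) h₃) λ σ₄ (c₄ , z₄ , h₄) →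
            achieve-seq {a = 9} {6} {Q = I (σ x)} (achieve-while (neT 1 x) ((zeroV 2 ⨾ addLoop (bitT 2) 2) ⨾ incV 1) 7 (σ x) (ℕₚ.<⇒≤ σx<N) (s≤s (s≤s z≤n)) I
                (λ j σ' j<m (c , z , h) → proj₁ xtest j σ' j<m c (h x 3≤x) ,
                  achieve-seq {zeroV 2 ⨾ addLoop (bitT 2) 2} {incV 1} {a = 6} {2} (add-n 2 (λ ()) ℕₚ.≤-refl σ') λ σ″ (z″ , h″) →
                    _ , exec-inc σ″ 1 (small (s≤s z≤n)) , trans (upd-same σ″ 1 _) (cong suc (trans (h″ 1 (λ ()) (λ ())) c)) ,
                    trans (trans (upd-other σ″ _ (λ ())) z″) (trans (cong (_+ n) z) (trans (ℕₚ.+-assoc (suc (base σ s + n)) (j * n) n) (cong (suc (base σ s + n) +_) (ℕₚ.+-comm (j * n) n)))) ,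
                    upd-above {3} {σ} {σ″} {1} _ (s≤s (s≤s z≤n)) (λ u l → trans (h″ u (λ { refl → case l of λ () }) (λ { refl → ℕₚ.<-irrefl refl l })) (h u l)))
                (λ σ' (c , z , h) → proj₂ xtest σ' c (h x 3≤x)) σ₄ (c₄ , trans z₄ (sym (ℕₚ.+-identityʳ _)) , h₄)) λ σ₅ (c₅ , z₅ , h₅) →
            achieve-seq {zeroV 2} {a = 2} {5} {Q = λ σ₆ → σ₆ 2 ≡ 0 × σ₆ 0 ≡ suc (base σ s + n) + σ x * n × Above 3 σ σ₆}
              (_ , exec-zero σ₅ 2 , upd-same σ₅ 2 0 , trans (upd-other σ₅ 0 (λ ())) z₅ , upd-above {3} {σ} {σ₅} {2} 0 ℕₚ.≤-refl h₅) λ σ₆ (c₆ , z₆ , h₆) →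
            achieve-map (λ σ₇ (z₇ , h₇) → trans z₇ (cong (_+ σ y) z₆) , λ u l → trans (h₇ u (λ { refl → case l of λ () }) (λ { refl → ℕₚ.<-irrefl refl l })) (h₆ u l))
              (add-loop (neT 2 y) 2 (σ y) (ℕₚ.<⇒≤ σy<N) (λ ()) ℕₚ.≤-refl σ₆ c₆
                (λ j σ' j<m c h → proj₁ ytest j σ' j<m c (trans (h y 3≤y) (h₆ y 3≤y))) (λ σ' c h → proj₂ ytest σ' c (trans (h y 3≤y) (h₆ y 3≤y))))
            where
            xtest = ne-test 1 x (σ x) (small (s≤s z≤n)) x<K σx<N
            ytest = ne-test 2 y (σ y) (small ℕₚ.≤-refl) y<K σy<N
            I : ℕ → State → Set
            I j σ' = σ' 1 ≡ j × σ' 0 ≡ suc (base σ s + n) + j * n × Above 3 σ σ'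
            begin₀ : ∀ s → Achieves (start s) σ 2 λ σ₁ → σ₁ 0 ≡ base σ s × Above 3 σ σ₁
            begin₀ true = _ , exec-copy σ 0 β ℕₚ.≤-refl , upd-same σ 0 (σ β) , upd-above {3} {σ} {σ} {0} (σ β) (s≤s z≤n) (λ _ _ → refl)
            begin₀ false = _ , exec-zero σ 0 , upd-same σ 0 0 , upd-above {3} {σ} {σ} {0} 0 (s≤s z≤n) (λ _ _ → refl)

        abstract
          -- Row and column are bounded by `N` and not by `n`, because the entry `(n , 0)`, one
          -- place behind the matrix, is needed to locate the second graph.
          addr-correct : ∀ s x y σ → 3 ≤ x → 3 ≤ y → x < K → y < K → σ x < N → σ y < N →
            Achieves (addr s x y) σ 14 λ σ' → σ' 0 ≡ suc (base σ s + n) + σ x * n + σ y × Above 3 σ σ'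
          addr-correct = addr-correct′

        Computes : Code → ℕ → ℕ → Bool → State → Set
        Computes p a v b σ = ∃ λ σ' → Exec p σ a b σ' × Above v σ σ'

        above-trans : ∀ {v σ σ' σ″} → Above v σ σ' → Above v σ' σ″ → Above v σ σ″
        above-trans h h' u l = trans (h' u l) (h u l)

        abstract
          computes-and : ∀ {p q a a' v b b' σ} → 2 ≤ a' → Computes p a v b σ → (∀ {σ'} → Above v σ σ' → Computes q a' v b' σ') →
            Computes (p ⨾ q) (seqE a a') v (b ∧ b') σ
          computes-and {b = true} l (σ' , e , h) f with f h
          ... | σ″ , e' , h' = σ″ , exec-branch-true e e' , above-trans h h'
          computes-and {b = false} l (σ' , e , h) f = σ' , exec-branch-false e (exec-pow l (exec-const σ' false)) , h

        abstract
          computes-same : ∀ {p q a a' v b b' σ} → Computes p a v b σ → (∀ {σ'} → Above v σ σ' → Computes q a' v b' σ') →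
            Computes (sameP p q) (sameE a a') v (eqb b b') σ
          computes-same {a' = a'} {b = true} (σ' , e , h) f with f h
          ... | σ″ , e' , h' = σ″ , exec-branch-true e (exec-pow (ℕₚ.≤-trans (ℕₚ.m≤m⊔n a' 2) (ℕₚ.n≤1+n _)) e') , above-trans h h'
          computes-same {b = false} (σ' , e , h) f with f h
          computes-same {b = false} {true} (σ' , e , h) f | σ″ , e' , h' = σ″ , exec-branch-false e (exec-branch-true e' (exec-const σ″ false)) , above-trans h h'
          computes-same {b = false} {false} (σ' , e , h) f | σ″ , e' , h' = σ″ , exec-branch-false e (exec-branch-false e' (exec-const σ″ true)) , above-trans h h'

        computes-≡ : ∀ {p a v b b' σ} → b ≡ b' → Computes p a v b σ → Computes p a v b' σ
        computes-≡ refl c = c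

        Vertex : ℕ → State → ℕ → Set
        Vertex v σ x = v ≤ x × x < K × σ x < n

        vertex-above : ∀ {v σ σ' x} → Above v σ σ' → Vertex v σ x → Vertex v σ' x
        vertex-above h (l , k , m) = l , k , subst (_< n) (sym (h _ l)) m

        vertices-above : ∀ {v σ σ' xs} → Above v σ σ' → All (Vertex v σ) xs → All (Vertex v σ') xs
        vertices-above h = All.map (vertex-above h)

        map-above : ∀ {v σ σ' xs} → Above v σ σ' → All (Vertex v σ) xs → map σ' xs ≡ map σ xs
        map-above h [] = refl
        map-above h ((l , _) ∷ vs) = cong₂ _∷_ (h _ l) (map-above h vs)

        vertices-lower : ∀ {v v' σ xs} → v ≤ v' → All (Vertex v' σ) xs → All (Vertex v σ) xs
        vertices-lower l = All.map (λ (a , b) → ℕₚ.≤-trans l a , b)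

        cnt-≤ : ∀ m p → cntBelow m p ≤ m
        cnt-≤ zero p = z≤n
        cnt-≤ (suc m) p with p m
        ... | true = ℕₚ.≤-trans (ℕₚ.≤-reflexive (ℕₚ.+-comm (cntBelow m p) 1)) (s≤s (cnt-≤ m p))
        ... | false = ℕₚ.≤-trans (ℕₚ.≤-reflexive (ℕₚ.+-identityʳ (cntBelow m p))) (ℕₚ.≤-trans (cnt-≤ m p) (ℕₚ.n≤1+n m))

        allBelow-false : ∀ m {p j} → j < m → p j ≡ false → allBelow m p ≡ false
        allBelow-false (suc m) {p} {j} l e with j ℕₚ.≟ m
        ... | yes refl = trans (cong (allBelow m p ∧_) e) (Boolₚ.∧-zeroʳ (allBelow m p))
        ... | no ne = cong (_∧ p m) (allBelow-false m (ℕₚ.≤∧≢⇒< (ℕₚ.≤-pred l) ne) e)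

        abstract
          count-achieves : ∀ c y p a v (F : ℕ → Bool) σ → c < K → y < K → c ≢ y → v ≤ c → v ≤ y →
            (∀ j σ' → j < n → σ' y ≡ j → (∀ u → v ≤ u → u ≢ y → u ≢ c → σ' u ≡ σ u) → Computes p a v (F j) σ') →
            Achieves (countP c y p) σ (countE a) λ σ' → σ' c ≡ cntBelow n F × (∀ u → v ≤ u → u ≢ y → u ≢ c → σ' u ≡ σ u)
          count-achieves c y p a v F σ c<K y<K c≢y v≤c v≤y h =
            achieve-seq {zeroV c} {a = 2} {Q = _≡ upd σ c 0} (_ , exec-zero σ c , refl) λ { _ refl →
            achieve-seq {zeroV y} {a = 2} {Q = _≡ upd (upd σ c 0) y 0} (_ , exec-zero (upd σ c 0) y , refl) λ { _ refl →
            achieve-map (λ σ' (_ , e , g) → e , g)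
              (achieve-while (bitT y) (branch p (incV c ⨾ incV y) (incV y)) (seqE a 3) n n≤N
                (s≤s (ℕₚ.≤-trans (s≤s z≤n) (ℕₚ.m≤n⊔m a 3))) I body (λ σ' (e , _) → proj₂ (bit-test y y<K) σ' e) _
                (upd-same (upd σ c 0) y 0 , trans (upd-other (upd σ c 0) 0 c≢y) (upd-same σ c 0) ,
                 λ u _ ny nc → trans (upd-other (upd σ c 0) 0 ny) (upd-other σ 0 nc))) } }
            where
            I : ℕ → State → Set
            I j σ' = σ' y ≡ j × σ' c ≡ cntBelow j F × (∀ u → v ≤ u → u ≢ y → u ≢ c → σ' u ≡ σ u)
            inc : ∀ j b σ' σ″ → Above v σ' σ″ → I j σ' → F j ≡ b → Exec p σ' a b σ″ → Achieves (branch p (incV c ⨾ incV y) (incV y)) σ' (seqE a 3) (I (suc j))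
            inc j true σ' σ″ ab (ey , ec , g) fj e = _ , exec-branch-true e (exec-branch-true (exec-inc σ″ c c<K) (exec-inc _ y y<K)) ,
              trans (upd-same _ y _) (cong suc (trans (upd-other σ″ _ (c≢y ∘ sym)) (trans (ab y v≤y) ey))) ,
              trans (upd-other _ _ c≢y) (trans (upd-same σ″ c _) (trans (cong suc (trans (ab c v≤c) ec))
                (trans (ℕₚ.+-comm 1 (cntBelow j F)) (cong (λ b → cntBelow j F + bit b) (sym fj))))) ,
              λ u l ny nc → trans (upd-other _ _ ny) (trans (upd-other σ″ _ nc) (trans (ab u l) (g u l ny nc)))
            inc j false σ' σ″ ab (ey , ec , g) fj e = _ , exec-branch-false e (exec-pow (s≤s (s≤s z≤n)) (exec-inc σ″ y y<K)) ,
              trans (upd-same _ y _) (cong suc (trans (ab y v≤y) ey)) ,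
              trans (upd-other _ _ c≢y) (trans (ab c v≤c) (trans ec (trans (sym (ℕₚ.+-identityʳ (cntBelow j F))) (cong (λ b → cntBelow j F + bit b) (sym fj))))) ,
              λ u l ny nc → trans (upd-other _ _ ny) (trans (ab u l) (g u l ny nc))
            body : ∀ j σ' → j < n → I j σ' → Exec (bitT y) σ' 2 true σ' × Achieves (branch p (incV c ⨾ incV y) (incV y)) σ' (seqE a 3) (I (suc j))
            body j σ' j<n i@(ey , ec , g) with h j σ' j<n ey g
            ... | σ″ , e , ab = proj₁ (bit-test y y<K) j σ' j<n ey , inc j (F j) σ' σ″ ab i refl e

        module _ (α : Bool → ℕ → ℕ → Bool) (Bs : ℕ)
          (entry : ∀ s i j → i < n → j < n → nth w (suc ((if s then Bs else 0) + n) + i * n + j) ≡ α s i j) where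
          open NatGame n α

          adj-computes : ∀ s x y σ → σ β ≡ Bs → Vertex 3 σ x → Vertex 3 σ y → Computes (adjP s x y) 15 3 (α s (σ x) (σ y)) σ
          adj-computes s x y σ eb (3≤x , x<K , σx<n) (3≤y , y<K , σy<n)
            with addr-correct s x y σ 3≤x 3≤y x<K y<K (ℕₚ.<-trans σx<n n<N) (ℕₚ.<-trans σy<n n<N)
          ... | σ' , e , z , h = computes-≡ (trans (cong (nth w) z) (trans (cong (λ b → nth w (suc ((if s then b else 0) + n) + σ x * n + σ y)) eb) (entry s (σ x) (σ y) σx<n σy<n)))
                (σ' , exec-branch-true {a = 14} {a' = 14} e (exec-pow {a = 2} {a' = 14} (s≤s (s≤s z≤n)) (exec-bit σ' 0 (small z≤n))) , h)

          eq-computes : ∀ x y σ → Vertex 3 σ x → Vertex 3 σ y → Computes (eqT x y) 2 3 (σ x ≡ᵇ σ y) σ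
          eq-computes x y σ (_ , x<K , σx<n) (_ , y<K , _) = σ , exec-eq σ x y x<K y<K (inj₁ (ℕₚ.<-trans σx<n n<N)) , λ _ _ → refl

          row-computes : ∀ s s' x y xs ys σ → σ β ≡ Bs → Vertex 3 σ x → Vertex 3 σ y → All (Vertex 3 σ) xs → All (Vertex 3 σ) ys →
            Computes (rowP s s' x y xs ys) (rowE xs ys) 3 (row s s' (σ x) (σ y) (map σ xs) (map σ ys)) σ
          row-computes s s' x y (u ∷ us) (v ∷ vs) σ eb vx vy (vu ∷ vus) (vv ∷ vvs) =
            computes-and {a = sameE 15 15} {a' = seqE (sameE 2 2) (rowE us vs)} (s≤s (ℕₚ.≤-trans (s≤s z≤n) (ℕₚ.m≤m⊔n (sameE 2 2) (rowE us vs))))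
              (computes-same {a = 15} {a' = 15} (adj-computes s x u σ eb vx vu) λ {σ'} h → computes-≡ (cong₂ (α s') (h y (proj₁ vy)) (h v (proj₁ vv)))
                (adj-computes s' y v σ' (trans (h β 3≤β) eb) (vertex-above h vy) (vertex-above h vv)))
              λ {σ'} h → computes-and {a = sameE 2 2} {a' = rowE us vs} (two us vs)
                (computes-≡ (cong₂ eqb (cong₂ _≡ᵇ_ (h x (proj₁ vx)) (h u (proj₁ vu))) (cong₂ _≡ᵇ_ (h y (proj₁ vy)) (h v (proj₁ vv))))
                  (computes-same {a = 2} {a' = 2} (eq-computes x u σ' (vertex-above h vx) (vertex-above h vu)) λ {σ″} h' →
                    computes-≡ (cong₂ _≡ᵇ_ (h' y (proj₁ vy)) (h' v (proj₁ vv)))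
                      (eq-computes y v σ″ (vertex-above h' (vertex-above h vy)) (vertex-above h' (vertex-above h vv)))))
                λ {σ″} h' → let g = above-trans h h' in
                  computes-≡ (trans (cong₂ (λ a b → row s s' a b (map σ″ us) (map σ″ vs)) (g x (proj₁ vx)) (g y (proj₁ vy)))
                                    (cong₂ (row s s' (σ x) (σ y)) (map-above g vus) (map-above g vvs)))
                    (row-computes s s' x y us vs σ″ (trans (g β 3≤β) eb) (vertex-above g vx) (vertex-above g vy) (vertices-above g vus) (vertices-above g vvs))
            where
            two : ∀ us vs → 2 ≤ rowE us vs
            two [] vs = ℕₚ.≤-refl
            two (u ∷ us) [] = ℕₚ.≤-refl
            two (u ∷ us) (v ∷ vs) = s≤s (ℕₚ.≤-trans {1} (s≤s z≤n) (ℕₚ.m≤m⊔n (sameE 15 15) (seqE (sameE 2 2) (rowE us vs))))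
          row-computes s s' x y [] ys σ eb vx vy vxs vys = σ , exec-const σ true , λ _ _ → refl
          row-computes s s' x y (u ∷ us) [] σ eb vx vy vxs vys = σ , exec-const σ true , λ _ _ → refl

          atom-computes : ∀ s s' xs ys σ → σ β ≡ Bs → All (Vertex 3 σ) xs → All (Vertex 3 σ) ys →
            Computes (atomP s s' xs ys) (atomE xs ys) 3 (atom s s' (map σ xs) (map σ ys)) σ
          atom-computes s s' (x ∷ xs) (y ∷ ys) σ eb (vx ∷ vxs) (vy ∷ vys) = computes-and {a = rowE xs ys} {a' = atomE xs ys} (two xs ys)
              (row-computes s s' x y xs ys σ eb vx vy vxs vys)
              λ {σ'} h → computes-≡ (cong₂ (atom s s') (map-above h vxs) (map-above h vys))
                (atom-computes s s' xs ys σ' (trans (h β 3≤β) eb) (vertices-above h vxs) (vertices-above h vys))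
            where
            two : ∀ xs ys → 2 ≤ atomE xs ys
            two [] vs = ℕₚ.≤-refl
            two (u ∷ us) [] = ℕₚ.≤-refl
            two (u ∷ us) (v ∷ vs) = s≤s (ℕₚ.≤-trans (ℕₚ.≤-trans (s≤s z≤n) (two us vs)) (ℕₚ.m≤n⊔m (rowE us vs) _))
          atom-computes s s' [] ys σ eb vxs vys = σ , exec-const σ true , λ _ _ → refl
          atom-computes s s' (x ∷ xs) [] σ eb vxs vys = σ , exec-const σ true , λ _ _ → refl

          3≤frame : ∀ r → 3 ≤ frame r
          3≤frame zero = ℕₚ.≤-refl
          3≤frame (suc r) = ℕₚ.≤-trans (3≤frame r) (ℕₚ.m≤n+m (frame r) 4)

          game-computes : ∀ r s s' xs ys σ → frame r ≤ β → σ β ≡ Bs → All (Vertex (frame r) σ) xs → All (Vertex (frame r) σ) ys →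
            Computes (gameP r s s' xs ys) (gameE r xs ys) (frame r) (eqv r s s' (map σ xs) (map σ ys)) σ
          game-computes zero s s' xs ys σ l eb vxs vys = atom-computes s s' xs ys σ eb vxs vys
          game-computes (suc r) s s' xs ys σ l eb vxs vys =
            case exec-loop (bitT x) bodyP a₀ n n≤N I Fail body (λ σ' (e , _) → exec-pow 2≤a₀ (proj₂ (bit-test x x<K) σ' e)) (upd σ x 0)
                (upd-same σ x 0 , refl , upd-above {4 + f} {σ} {σ} 0 (s≤s (ℕₚ.m≤n+m f 3)) (λ _ _ → refl)) of λ where
              (true , σ' , e , good , _) → let (_ , eq , h) = good refl in
                σ' , exec-branch-true (exec-zero σ x) (subst (λ b → Exec (loop (bitT x) bodyP) (upd σ x 0) (2 + a₀) b σ') (sym eq) e) , h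
              (false , σ' , e , _ , bad) → let (eq , h) = bad refl in
                σ' , exec-branch-true (exec-zero σ x) (subst (λ b → Exec (loop (bitT x) bodyP) (upd σ x 0) (2 + a₀) b σ') (sym eq) e) , h
            where
            _⟨≤⟩_ : ∀ {i j k} → i ≤ j → j ≤ k → i ≤ k
            _⟨≤⟩_ = ℕₚ.≤-trans
            f x y c d : ℕ
            f = frame r
            x = f
            y = 1 + f
            c = 2 + f
            d = 3 + f
            p₁ p₂ bodyP : Code
            p₁ = gameP r s s (x ∷ xs) (y ∷ xs)
            p₂ = gameP r s s' (x ∷ xs) (y ∷ ys)
            bodyP = countP c y p₁ ⨾ countP d y p₂ ⨾ eqT c d ⨾ incV x
            a₁ a₂ a₀ : ℕ
            a₁ = gameE r (x ∷ xs) (y ∷ xs)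
            a₂ = gameE r (x ∷ xs) (y ∷ ys)
            a₀ = seqE (countE a₁) (seqE (countE a₂) (seqE 2 2))
            2≤a₀ : 2 ≤ a₀
            2≤a₀ = s≤s (ℕₚ.≤-trans (s≤s z≤n) (ℕₚ.m≤m⊔n (countE a₁) (seqE (countE a₂) (seqE 2 2))))
            d<K : d < K
            d<K = ℕₚ.<-trans l (ℕₚ.n<1+n β)
            c<K : c < K
            c<K = ℕₚ.<-trans (ℕₚ.n<1+n c) d<K
            y<K : y < K
            y<K = ℕₚ.<-trans (ℕₚ.n<1+n y) c<K
            x<K : x < K
            x<K = ℕₚ.<-trans (ℕₚ.n<1+n x) y<K
            f≤4+f : f ≤ 4 + f
            f≤4+f = ℕₚ.m≤n+m f 4
            xv yv : List ℕ
            xv = map σ xs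
            yv = map σ ys
            F₁ F₂ : ℕ → ℕ → Bool
            F₁ i j = eqv r s s (i ∷ xv) (j ∷ xv)
            F₂ i j = eqv r s s' (i ∷ xv) (j ∷ yv)
            G : ℕ → Bool
            G i = cntBelow n (F₁ i) ≡ᵇ cntBelow n (F₂ i)
            I : ℕ → State → Set
            I i σ' = σ' x ≡ i × allBelow i G ≡ true × Above (4 + f) σ σ'
            Fail : State → Set
            Fail σ' = allBelow n G ≡ false × Above (4 + f) σ σ'
            ≢+ : ∀ i j {m} → i ≢ j → i + m ≢ j + m
            ≢+ i j {m} n e = n (ℕₚ.+-cancelʳ-≡ m i j e)
            -- For the inner call `x` and `y` lie at or above its frame and count as pebbles. The
            -- counters lie above it too, so the call leaves them unchanged.
            call : ∀ s″ zs i j σ' → i < n → j < n → σ' x ≡ i → σ' y ≡ j → Above (4 + f) σ σ' → All (Vertex (4 + f) σ) zs →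
              Computes (gameP r s s″ (x ∷ xs) (y ∷ zs)) (gameE r (x ∷ xs) (y ∷ zs)) f (eqv r s s″ (i ∷ xv) (j ∷ map σ zs)) σ'
            call s″ zs i j σ' i<n j<n ex ey h vzs = computes-≡
              (cong₂ (eqv r s s″) (cong₂ _∷_ ex (map-above h vxs)) (cong₂ _∷_ ey (map-above h vzs)))
              (game-computes r s s″ (x ∷ xs) (y ∷ zs) σ' (f≤4+f ⟨≤⟩ l) (trans (h β l) eb)
                ((ℕₚ.≤-refl , x<K , subst (_< n) (sym ex) i<n) ∷ vertices-lower f≤4+f (vertices-above h vxs))
                ((ℕₚ.n≤1+n f , y<K , subst (_< n) (sym ey) j<n) ∷ vertices-lower f≤4+f (vertices-above h vzs)))
            above-of : ∀ {σ' σ″ e} → e ≤ 3 → (∀ u → f ≤ u → u ≢ y → u ≢ e + f → σ″ u ≡ σ' u) → Above (4 + f) σ' σ″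
            above-of e≤3 g u le = g u (f≤4+f ⟨≤⟩ le) (λ { refl → ℕₚ.<-irrefl refl (s≤s (s≤s (ℕₚ.m≤n+m f 2)) ⟨≤⟩ le) })
              (λ { refl → ℕₚ.<-irrefl refl (ℕₚ.+-monoˡ-≤ f (s≤s e≤3) ⟨≤⟩ le) })
            Outcome : ℕ → State → Set
            Outcome i σ' = ∃ λ b → ∃ λ σ″ → ∃ λ σ₁ → Exec (bitT x) σ' a₀ true σ₁ × Exec bodyP σ₁ a₀ b σ″ ×
              (b ≡ true → I (suc i) σ″) × (b ≡ false → Fail σ″)
            body : ∀ i σ' → i < n → I i σ' → Outcome i σ'
            body i σ' i<n (ex , al , h)
              with count-achieves c y p₁ a₁ f (F₁ i) σ' c<K y<K (≢+ 2 1 λ ()) (ℕₚ.m≤n+m f 2) (ℕₚ.n≤1+n f)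
                (λ j σ″ j<n ey g → call s xs i j σ″ i<n j<n (trans (g x ℕₚ.≤-refl (≢+ 0 1 λ ()) (≢+ 0 2 λ ())) ex) ey
                  (above-trans h (above-of (s≤s (s≤s z≤n)) g)) vxs)
            ... | σ₁ , e₁ , ec , g₁
              with count-achieves d y p₂ a₂ f (F₂ i) σ₁ d<K y<K (≢+ 3 1 λ ()) (ℕₚ.m≤n+m f 3) (ℕₚ.n≤1+n f)
                (λ j σ″ j<n ey g → call s' ys i j σ″ i<n j<n
                  (trans (g x ℕₚ.≤-refl (≢+ 0 1 λ ()) (≢+ 0 3 λ ())) (trans (g₁ x ℕₚ.≤-refl (≢+ 0 1 λ ()) (≢+ 0 2 λ ())) ex)) ey
                  (above-trans h (above-trans (above-of (s≤s (s≤s z≤n)) g₁) (above-of ℕₚ.≤-refl g))) vys)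
            ... | σ₂ , e₂ , ed , g₂ = decide (G i) refl
              where
              ec' : σ₂ c ≡ cntBelow n (F₁ i)
              ec' = trans (g₂ c (ℕₚ.m≤n+m f 2) (≢+ 2 1 λ ()) (≢+ 2 3 λ ())) ec
              h₂ : Above (4 + f) σ σ₂
              h₂ = above-trans h (above-trans (above-of (s≤s (s≤s z≤n)) g₁) (above-of ℕₚ.≤-refl g₂))
              ex₂ : σ₂ x ≡ i
              ex₂ = trans (g₂ x ℕₚ.≤-refl (≢+ 0 1 λ ()) (≢+ 0 3 λ ())) (trans (g₁ x ℕₚ.≤-refl (≢+ 0 1 λ ()) (≢+ 0 2 λ ())) ex)
              test : Exec (eqT c d) σ₂ 2 (G i) σ₂
              -- A count is at most `n` and therefore a position of the word, as `exec-eq` requires.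
              test = subst (λ b → Exec (eqT c d) σ₂ 2 b σ₂) (cong₂ _≡ᵇ_ ec' ed)
                (exec-eq σ₂ c d c<K d<K (inj₁ (subst (_< N) (sym ec') (ℕₚ.≤-<-trans (cnt-≤ n (F₁ i)) n<N))))
              decide : ∀ b → G i ≡ b → Outcome i σ'
              decide true gi = true , _ , σ' , exec-pow 2≤a₀ (proj₁ (bit-test x x<K) i σ' i<n ex) ,
                exec-branch-true e₁ (exec-branch-true e₂ (exec-branch-true (subst (λ b → Exec (eqT c d) σ₂ 2 b σ₂) gi test) (exec-inc σ₂ x x<K))) ,
                (λ _ → trans (upd-same σ₂ x _) (cong suc ex₂) , cong₂ _∧_ al gi , upd-above {4 + f} {σ} {σ₂} _ (s≤s (ℕₚ.m≤n+m f 3)) h₂) , λ ()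
              decide false gi = false , σ₂ , σ' , exec-pow 2≤a₀ (proj₁ (bit-test x x<K) i σ' i<n ex) ,
                exec-branch-true e₁ (exec-branch-true e₂ (exec-branch-false (subst (λ b → Exec (eqT c d) σ₂ 2 b σ₂) gi test) (exec-const σ₂ false))) ,
                (λ ()) , λ _ → allBelow-false n i<n gi , h₂

-- Equivalence of the counting game and the bijective game.

module CountingGame where
  open Gluing
  open Games
  open Variables using (≡ᵇ-refl; ≡ᵇ-true; ≡ᵇ-false)
  open Evaluation using (allBelow; cntBelow; eqb; module NatGame)

  ∧-true : ∀ {a b} → (a ∧ b) ≡ true → a ≡ true × b ≡ true
  ∧-true {true} {true} _ = refl , refl

  eqb-true : ∀ {a b} → eqb a b ≡ true → a ≡ b
  eqb-true {true} {true} _ = refl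
  eqb-true {false} {false} _ = refl

  eqb-refl : ∀ {a b} → a ≡ b → eqb a b ≡ true
  eqb-refl {true} refl = refl
  eqb-refl {false} refl = refl

  true-⇔ : ∀ {a b} → (a ≡ true → b ≡ true) → (b ≡ true → a ≡ true) → a ≡ b
  true-⇔ {true} f g = sym (f refl)
  true-⇔ {false} {true} f g = g refl
  true-⇔ {false} {false} f g = refl

  cntBelow-suc : ∀ n p → cntBelow (suc n) p ≡ bit (p 0) + cntBelow n (p ∘ suc)
  cntBelow-suc zero p = sym (ℕₚ.+-identityʳ (bit (p 0)))
  cntBelow-suc (suc n) p = trans (cong (_+ bit (p (suc n))) (cntBelow-suc n p)) (ℕₚ.+-assoc (bit (p 0)) (cntBelow n (p ∘ suc)) (bit (p (suc n))))

  cntBelow-cnt : ∀ n p → cntBelow n p ≡ cnt {n} (p ∘ toℕ)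
  cntBelow-cnt zero p = refl
  cntBelow-cnt (suc n) p = trans (cntBelow-suc n p) (cong (bit (p 0) +_) (cntBelow-cnt n (p ∘ suc)))

  allBelow-true : ∀ n {p} → allBelow n p ≡ true → ∀ j → j < n → p j ≡ true
  allBelow-true (suc n) e j l with ∧-true e | j ℕₚ.≟ n
  ... | _ , pn | yes refl = pn
  ... | al , _ | no ne = allBelow-true n al j (ℕₚ.≤∧≢⇒< (ℕₚ.≤-pred l) ne)

  allBelow-intro : ∀ n {p} → (∀ j → j < n → p j ≡ true) → allBelow n p ≡ true
  allBelow-intro zero h = refl
  allBelow-intro (suc n) h = cong₂ _∧_ (allBelow-intro n λ j l → h j (ℕₚ.<-trans l (ℕₚ.n<1+n n))) (h n (ℕₚ.n<1+n n))

  below : ∀ {n} → Fin n → Fin n → Bool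
  below y z = toℕ z <ᵇ toℕ y

  cnt-none : ∀ {n} {p : Fin n → Bool} → (∀ x → p x ≡ false) → cnt p ≡ 0
  cnt-none {zero} h = refl
  cnt-none {suc n} h rewrite h zero = cnt-none (h ∘ suc)

  select : ∀ {n} (q : Fin n → Bool) k → k < cnt q → ∃ λ y → q y ≡ true × cnt (λ z → q z ∧ below y z) ≡ k
  select {suc n} q k l with q zero in e
  select {suc n} q zero l | true = zero , e , cnt-none {n} λ z → Boolₚ.∧-zeroʳ (q (suc z))
  select {suc n} q (suc k) (s≤s l) | true with select (q ∘ suc) k l
  ... | y , qy , c = suc y , qy , cong suc c
  select {suc n} q k l | false with select (q ∘ suc) k l
  ... | y , qy , c = suc y , qy , c

  <ᵇ-irrefl : ∀ n → (n <ᵇ n) ≡ false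
  <ᵇ-irrefl zero = refl
  <ᵇ-irrefl (suc n) = <ᵇ-irrefl n

  <ᵇ-true : ∀ {m n} → m < n → (m <ᵇ n) ≡ true
  <ᵇ-true {zero} (s≤s _) = refl
  <ᵇ-true {suc m} (s≤s l) = <ᵇ-true l

  <ᵇ-< : ∀ m n → (m <ᵇ n) ≡ true → m < n
  <ᵇ-< zero (suc n) _ = s≤s z≤n
  <ᵇ-< (suc m) (suc n) e = s≤s (<ᵇ-< m n e)

  cnt-full : ∀ n → cnt {n} (λ _ → true) ≡ n
  cnt-full zero = refl
  cnt-full (suc n) = cong suc (cnt-full n)

  -- Mapping each x to the partner of the same rank within its class is a bijection.
  module Ranked {n m : ℕ} (n≡m : n ≡ m) (c : Fin n → Fin n → Bool) (d : Fin n → Fin m → Bool)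
    (c-refl : ∀ x → c x x ≡ true) (c-join : ∀ {x x' y} → d x y ≡ true → d x' y ≡ true → c x x' ≡ true)
    (c-cong : ∀ {x x'} → c x x' ≡ true → ∀ z → c x z ≡ c x' z) (d-cong : ∀ {x x'} → c x x' ≡ true → ∀ y → d x y ≡ d x' y)
    (same : ∀ x → cnt (c x) ≡ cnt (d x)) where
    private
      rank : Fin n → ℕ
      rank x = cnt (λ z → c x z ∧ below x z)

      rank< : ∀ x → rank x < cnt (d x)
      rank< x = subst (rank x <_) (same x) (cnt-strict (λ z e → proj₁ (∧-true e)) x
        (trans (cong (c x x ∧_) (<ᵇ-irrefl (toℕ x))) (Boolₚ.∧-zeroʳ (c x x))) (c-refl x))

      g : Fin n → Fin m
      g x = proj₁ (select (d x) (rank x) (rank< x))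
      dg : ∀ x → d x (g x) ≡ true
      dg x = proj₁ (proj₂ (select (d x) (rank x) (rank< x)))
      rank-g : ∀ x → cnt (λ z → d x z ∧ below (g x) z) ≡ rank x
      rank-g x = proj₂ (proj₂ (select (d x) (rank x) (rank< x)))

      rank-strict : ∀ {x x'} → c x x' ≡ true → toℕ x < toℕ x' → rank x < rank x'
      rank-strict {x} {x'} e l = cnt-strict
        (λ z h → let (a , b) = ∧-true h in cong₂ _∧_ (trans (sym (c-cong e z)) a) (<ᵇ-true (ℕₚ.<-trans (<ᵇ-< (toℕ z) (toℕ x) b) l))) x
        (trans (cong (c x x ∧_) (<ᵇ-irrefl (toℕ x))) (Boolₚ.∧-zeroʳ (c x x)))
        (cong₂ _∧_ (trans (sym (c-cong e x)) (c-refl x)) (<ᵇ-true l))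

      g-inj : ∀ {x x'} → g x ≡ g x' → x ≡ x'
      g-inj {x} {x'} e with ℕₚ.<-cmp (toℕ x) (toℕ x')
      ... | tri≈ _ p _ = Finₚ.toℕ-injective p
      ... | tri< l _ _ = ⊥-elim (ℕₚ.<⇒≢ (rank-strict cx l) ranks)
        where
        cx : c x x' ≡ true
        cx = c-join (dg x) (subst (λ y → d x' y ≡ true) (sym e) (dg x'))
        ranks : rank x ≡ rank x'
        ranks = trans (sym (rank-g x)) (trans (cnt-cong λ z → cong₂ _∧_ (d-cong cx z) (cong (λ y → below y z) e)) (rank-g x'))
      ... | tri> _ _ l = ⊥-elim (ℕₚ.<⇒≢ (rank-strict cx l) ranks)
        where
        cx : c x' x ≡ true
        cx = c-join (dg x') (subst (λ y → d x y ≡ true) e (dg x))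
        ranks : rank x' ≡ rank x
        ranks = trans (sym (rank-g x')) (trans (cnt-cong λ z → cong₂ _∧_ (d-cong cx z) (cong (λ y → below y z) (sym e))) (rank-g x))

      -- Pigeonhole: if `y` were missed, the injection `g` would fit all elements into one place
      -- fewer.
      g-sur : ∀ y → ∃ λ x → g x ≡ y
      g-sur y with Finₚ.any? (λ x → g x Fin.≟ y)
      ... | yes p = p
      ... | no np = ⊥-elim (ℕₚ.<-irrefl (trans (cnt-full n) (trans n≡m (sym (cnt-full m))))
            (ℕₚ.≤-trans (s≤s (cnt-inj {n} {m} (λ _ → true) (without (λ _ → true) y) g
              (λ x _ → cong not (dec-false (g x Fin.≟ y) λ e → np (x , e))) (λ _ _ _ _ → g-inj)))
              (ℕₚ.≤-reflexive (sym (cnt-without (λ _ → true) y refl)))))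

    ranked : PBij {n} {m} Full Full
    ranked = record { to = g ; from = proj₁ ∘ g-sur ; to∈ = λ _ → tt ; from∈ = λ _ → tt
      ; from-to = λ {x} _ → g-inj (proj₂ (g-sur (g x))) ; to-from = λ {y} _ → proj₂ (g-sur y) }

    ranked-d : ∀ x → d x (to ranked x) ≡ true
    ranked-d = dg

  module Link (n : ℕ) (α : Bool → ℕ → ℕ → Bool) (K : Bool → Graph) (sz : ∀ s → size (K s) ≡ n)
    (α-adj : ∀ s i j → α s (toℕ i) (toℕ j) ≡ adj (K s) i j) where
    open NatGame n α

    private
      V : Bool → Set
      V s = Fin (size (K s))

    vals : ∀ {m k} → Vec (Fin m) k → List ℕ
    vals [] = []
    vals (x ∷ xs) = toℕ x ∷ vals xs

    private
      toℕ-eq : ∀ {s s'} {x u : V s} {y v : V s'} → (toℕ x ≡ᵇ toℕ u) ≡ (toℕ y ≡ᵇ toℕ v) → x ≡ u → y ≡ v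
      toℕ-eq {x = x} {y = y} {v} e refl = Finₚ.toℕ-injective (≡ᵇ-true (toℕ y) (toℕ v) (trans (sym e) (≡ᵇ-refl (toℕ x))))

      eq-toℕ : ∀ {s s'} {x u : V s} {y v : V s'} → (x ≡ u → y ≡ v) → (y ≡ v → x ≡ u) → (toℕ x ≡ᵇ toℕ u) ≡ (toℕ y ≡ᵇ toℕ v)
      eq-toℕ {x = x} {u} {y} {v} f g = true-⇔
        (λ e → trans (cong (λ z → toℕ z ≡ᵇ toℕ v) (f (Finₚ.toℕ-injective (≡ᵇ-true _ _ e)))) (≡ᵇ-refl (toℕ v)))
        (λ e → trans (cong (λ z → toℕ z ≡ᵇ toℕ u) (g (Finₚ.toℕ-injective (≡ᵇ-true _ _ e)))) (≡ᵇ-refl (toℕ u)))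

      row-true : ∀ s s' x y {k} (xs : Vec (V s) k) (ys : Vec (V s') k) → row s s' (toℕ x) (toℕ y) (vals xs) (vals ys) ≡ true →
        ∀ {u v} → At u v xs ys → adj (K s) x u ≡ adj (K s') y v × (x ≡ u → y ≡ v) × (y ≡ v → x ≡ u)
      row-true s s' x y (u ∷ xs) (v ∷ ys) e here with ∧-true {eqb (α s (toℕ x) (toℕ u)) (α s' (toℕ y) (toℕ v))} e
      ... | a , b with ∧-true {eqb (toℕ x ≡ᵇ toℕ u) (toℕ y ≡ᵇ toℕ v)} b
      ... | b' , _ = trans (sym (α-adj s x u)) (trans (eqb-true a) (α-adj s' y v)) ,
            toℕ-eq {s} {s'} (eqb-true b') , toℕ-eq {s'} {s} (sym (eqb-true b'))
      row-true s s' x y (u ∷ xs) (v ∷ ys) e (there p) with ∧-true {eqb (α s (toℕ x) (toℕ u)) (α s' (toℕ y) (toℕ v))} e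
      ... | _ , b with ∧-true {eqb (toℕ x ≡ᵇ toℕ u) (toℕ y ≡ᵇ toℕ v)} b
      ... | _ , r = row-true s s' x y xs ys r p

      row-intro : ∀ s s' x y {k} (xs : Vec (V s) k) (ys : Vec (V s') k) →
        (∀ {u v} → At u v xs ys → adj (K s) x u ≡ adj (K s') y v × (x ≡ u → y ≡ v) × (y ≡ v → x ≡ u)) →
        row s s' (toℕ x) (toℕ y) (vals xs) (vals ys) ≡ true
      row-intro s s' x y [] [] h = refl
      row-intro s s' x y (u ∷ xs) (v ∷ ys) h = let (a , f , g) = h here in
        cong₂ _∧_ (eqb-refl (trans (α-adj s x u) (trans a (sym (α-adj s' y v)))))
          (cong₂ _∧_ (eqb-refl (eq-toℕ {s} {s'} f g)) (row-intro s s' x y xs ys λ p → h (there p)))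

      atom-true : ∀ s s' {k} (xs : Vec (V s) k) (ys : Vec (V s') k) → atom s s' (vals xs) (vals ys) ≡ true → Atomic (K s) (K s') xs ys
      atom-true s s' (x ∷ xs) (y ∷ ys) e here here = trans (adj-irrefl (K s) x) (sym (adj-irrefl (K s') y)) , (λ _ → refl) , (λ _ → refl)
      atom-true s s' (x ∷ xs) (y ∷ ys) e here (there q) = row-true s s' x y xs ys (proj₁ (∧-true {row s s' (toℕ x) (toℕ y) (vals xs) (vals ys)} e)) q
      atom-true s s' (x ∷ xs) (y ∷ ys) e (there p) here = let (a , f , g) = row-true s s' x y xs ys (proj₁ (∧-true {row s s' (toℕ x) (toℕ y) (vals xs) (vals ys)} e)) p in
        trans (adj-sym (K s) _ _) (trans a (adj-sym (K s') _ _)) , sym ∘ f ∘ sym , sym ∘ g ∘ sym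
      atom-true s s' (x ∷ xs) (y ∷ ys) e (there p) (there q) = atom-true s s' xs ys (proj₂ (∧-true {row s s' (toℕ x) (toℕ y) (vals xs) (vals ys)} e)) p q

      atom-intro : ∀ s s' {k} (xs : Vec (V s) k) (ys : Vec (V s') k) → Atomic (K s) (K s') xs ys → atom s s' (vals xs) (vals ys) ≡ true
      atom-intro s s' [] [] h = refl
      atom-intro s s' (x ∷ xs) (y ∷ ys) h = cong₂ _∧_ (row-intro s s' x y xs ys λ p → h here (there p)) (atom-intro s s' xs ys λ p q → h (there p) (there q))

      count-V : ∀ s (p : ℕ → Bool) → cntBelow n p ≡ cnt {size (K s)} (p ∘ toℕ)
      count-V s p = trans (cong (λ m → cntBelow m p) (sym (sz s))) (cntBelow-cnt (size (K s)) p)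

    -- The two directions need each other. `Ranked` wants an equivalence relation on Boolean values:
    -- `sound` turns them into games, games can be composed and inverted, and `complete` leads back.
    sound : ∀ r s s' {k} (xs : Vec (V s) k) (ys : Vec (V s') k) → eqv r s s' (vals xs) (vals ys) ≡ true → Game (K s) (K s') r xs ys
    complete : ∀ r s s' {k} (xs : Vec (V s) k) (ys : Vec (V s') k) → Game (K s) (K s') r xs ys → eqv r s s' (vals xs) (vals ys) ≡ true

    sound zero s s' xs ys e = over (atom-true s s' xs ys e)
    -- `eqv` tests atomic types only after the last round. Here a pebbled vertex `x` is played once
    -- more, and the position after the answer contains the condition for the present pebbles.
    sound (suc r) s s' xs ys e = round (λ {x} p q → atomic (answer x) (there p) (there q)) ranked answer
      where
      c : V s → V s → Bool
      c x z = eqv r s s (vals (x ∷ xs)) (vals (z ∷ xs))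
      d : V s → V s' → Bool
      d x y = eqv r s s' (vals (x ∷ xs)) (vals (y ∷ ys))
      gc : ∀ {x z} → c x z ≡ true → Game (K s) (K s) r (x ∷ xs) (z ∷ xs)
      gc {x} {z} = sound r s s (x ∷ xs) (z ∷ xs)
      gd : ∀ {x y} → d x y ≡ true → Game (K s) (K s') r (x ∷ xs) (y ∷ ys)
      gd {x} {y} = sound r s s' (x ∷ xs) (y ∷ ys)
      cg : ∀ {x z} → Game (K s) (K s) r (x ∷ xs) (z ∷ xs) → c x z ≡ true
      cg {x} {z} = complete r s s (x ∷ xs) (z ∷ xs)
      dg : ∀ {x y} → Game (K s) (K s') r (x ∷ xs) (y ∷ ys) → d x y ≡ true
      dg {x} {y} = complete r s s' (x ∷ xs) (y ∷ ys)
      counts : ∀ x → cnt (c x) ≡ cnt (d x)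
      counts x = trans (sym (count-V s (λ y → eqv r s s (vals (x ∷ xs)) (y ∷ vals xs))))
        (trans (≡ᵇ-true _ _ (allBelow-true n e (toℕ x) (subst (toℕ x <_) (sz s) (Finₚ.toℕ<n x)))) (count-V s' (λ y → eqv r s s' (vals (x ∷ xs)) (y ∷ vals ys))))
      same-game : ∀ {k} (us : Vec (V s) k) → ∀ r → Game (K s) (K s) r us us
      same-game us zero = over λ p q → same p q
        where
        same : ∀ {k} {us : Vec (V s) k} {x y x' y'} → At x y us us → At x' y' us us → adj (K s) x x' ≡ adj (K s) y y' × (x ≡ x' → y ≡ y') × (y ≡ y' → x ≡ x')
        eq : ∀ {k} {us : Vec (V s) k} {x y} → At x y us us → x ≡ y
        eq here = refl
        eq (there p) = eq p
        same p q with eq p | eq q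
        ... | refl | refl = refl , (λ e → e) , (λ e → e)
      same-game us (suc r) = round (atomic (same-game us zero)) (record { to = λ x → x ; from = λ x → x ; to∈ = λ _ → tt ; from∈ = λ _ → tt
        ; from-to = λ _ → refl ; to-from = λ _ → refl }) λ x → same-game (x ∷ us) r
      open Ranked (trans (sz s) (sym (sz s'))) c d (λ x → cg (same-game (x ∷ xs) r)) (λ p q → cg (game-trans (gd p) (game-sym (gd q))))
        (λ p z → true-⇔ (λ q → cg (game-trans (game-sym (gc p)) (gc q))) (λ q → cg (game-trans (gc p) (gc q))))
        (λ p y → true-⇔ (λ q → dg (game-trans (game-sym (gc p)) (gd q))) (λ q → dg (game-trans (gc p) (gd q)))) counts
      answer : ∀ x → Game (K s) (K s') r (x ∷ xs) (to ranked x ∷ ys)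
      answer x = gd (ranked-d x)

    complete zero s s' xs ys (over a) = atom-intro s s' xs ys a
    complete (suc r) s s' xs ys (round a f h) = allBelow-intro n λ j j<n →
      let x = fromℕ< (subst (j <_) (sym (sz s)) j<n)
          e = Finₚ.toℕ-fromℕ< (subst (j <_) (sym (sz s)) j<n)
      in subst (λ i → (cntBelow n (λ y → eqv r s s (i ∷ vals xs) (y ∷ vals xs)) ≡ᵇ cntBelow n (λ y → eqv r s s' (i ∷ vals xs) (y ∷ vals ys))) ≡ true) e (counts x)
      where
      c : V s → V s → Bool
      c x z = eqv r s s (vals (x ∷ xs)) (vals (z ∷ xs))
      d : V s → V s' → Bool
      d x y = eqv r s s' (vals (x ∷ xs)) (vals (y ∷ ys))
      c→d : ∀ x z → c x z ≡ true → d x (to f z) ≡ true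
      c→d x z e = complete r s s' (x ∷ xs) (to f z ∷ ys) (game-trans (sound r s s (x ∷ xs) (z ∷ xs) e) (h z))
      d→c : ∀ x y → d x y ≡ true → c x (from f y) ≡ true
      d→c x y e = complete r s s (x ∷ xs) (from f y ∷ xs) (game-trans (sound r s s' (x ∷ xs) (y ∷ ys) e)
        (game-sym (subst (λ v → Game (K s) (K s') r (from f y ∷ xs) (v ∷ ys)) (to-from f tt) (h (from f y)))))
      counts : ∀ x → (cntBelow n (λ y → eqv r s s (toℕ x ∷ vals xs) (y ∷ vals xs)) ≡ᵇ cntBelow n (λ y → eqv r s s' (toℕ x ∷ vals xs) (y ∷ vals ys))) ≡ true
      counts x = trans (cong₂ _≡ᵇ_ (count-V s (λ y → eqv r s s (toℕ x ∷ vals xs) (y ∷ vals xs))) (count-V s' (λ y → eqv r s s' (toℕ x ∷ vals xs) (y ∷ vals ys))))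
        (trans (cong (_≡ᵇ cnt (d x)) (ℕₚ.≤-antisym
          (cnt-inj (c x) (d x) (to f) (c→d x) (λ _ _ _ _ e → trans (sym (from-to f tt)) (trans (cong (from f) e) (from-to f tt))))
          (cnt-inj (d x) (c x) (from f) (d→c x) (λ _ _ _ _ e → trans (sym (to-from f tt)) (trans (cong (to f) e) (to-from f tt)))))) (≡ᵇ-refl (cnt (d x))))

-- The deciding machine and its time bound.

module Deciding where
  open FreeGraphs using (F; FreeGraph; gr; noP5; noF)
  open Games using (Game)
  open GameToIso using (gameRounds; game⇒iso; iso⇒game)
  open Machines
  open Sweeps
  open Variables
  open Evaluation
  open CountingGame

  nth-++ : ∀ a b p → nth (a ++ b) (length a + p) ≡ nth b p
  nth-++ [] b p = refl
  nth-++ (_ ∷ a) b p = nth-++ a b p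

  nth-prefix : ∀ a b p → p < length a → nth (a ++ b) p ≡ nth a p
  nth-prefix (_ ∷ a) b zero _ = refl
  nth-prefix (_ ∷ a) b (suc p) (s≤s l) = nth-prefix a b p l

  nth-map : ∀ {A : Set} {k} (h : A → Bool) (g : Fin k → A) j → nth (map h (tabulate g)) (toℕ j) ≡ h (g j)
  nth-map h g zero = refl
  nth-map h g (suc j) = nth-map h (g ∘ suc) j

  nth-concat : ∀ {A : Set} {k n} (f : A → List Bool) → (∀ x → length (f x) ≡ n) → (g : Fin k → A) → ∀ u i j → j < n →
    nth (concatMap f (tabulate g) ++ u) (toℕ i * n + j) ≡ nth (f (g i)) j
  nth-concat {n = n} f len g u zero j l rewrite Listₚ.++-assoc (f (g zero)) (concatMap f (tabulate (g ∘ suc))) u =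
    nth-prefix (f (g zero)) _ j (subst (j <_) (sym (len (g zero))) l)
  nth-concat {n = n} f len g u (suc i) j l rewrite Listₚ.++-assoc (f (g zero)) (concatMap f (tabulate (g ∘ suc))) u =
    trans (cong (nth (f (g zero) ++ rest)) (trans (ℕₚ.+-assoc n (toℕ i * n) j) (cong (_+ (toℕ i * n + j)) (sym (len (g zero))))))
      (trans (nth-++ (f (g zero)) rest (toℕ i * n + j)) (nth-concat f len (g ∘ suc) u i j l))
    where
    rest : List Bool
    rest = concatMap f (tabulate (g ∘ suc)) ++ u

  length-concat : ∀ {A : Set} {k n} (f : A → List Bool) → (∀ x → length (f x) ≡ n) → (g : Fin k → A) → length (concatMap f (tabulate g)) ≡ k * n
  length-concat {k = zero} f len g = refl
  length-concat {k = suc k} f len g = trans (Listₚ.length-++ (f (g zero))) (cong₂ _+_ (len (g zero)) (length-concat f len (g ∘ suc)))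

  module Encoding (G : Graph) where
    private
      n = size G
      bits : Fin n → List Bool
      bits i = map (λ j → adj G i j) (allFin n)
      len-bits : ∀ i → length (bits i) ≡ n
      len-bits i = trans (Listₚ.length-map (adj G i) (allFin n)) (Listₚ.length-tabulate (λ i → i))

      nth-ones : ∀ k l p → p < k → nth (replicate k true ++ l) p ≡ true
      nth-ones (suc k) l zero _ = refl
      nth-ones (suc k) l (suc p) (s≤s h) = nth-ones k l p h

      nth-after : ∀ k l p → nth (replicate k true ++ l) (k + p) ≡ nth l p
      nth-after zero l p = refl
      nth-after (suc k) l p = nth-after k l p

      split : ∀ u → encode G ++ u ≡ replicate n true ++ false ∷ concatMap bits (allFin n) ++ u
      split u = Listₚ.++-assoc (replicate n true) (false ∷ concatMap bits (allFin n)) u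

    encode-one : ∀ u p → p < n → nth (encode G ++ u) p ≡ true
    encode-one u p l = trans (cong (λ w → nth w p) (split u)) (nth-ones n _ p l)

    encode-zero : ∀ u → nth (encode G ++ u) n ≡ false
    encode-zero u = trans (cong₂ nth (split u) (sym (ℕₚ.+-identityʳ n))) (nth-after n _ 0)

    encode-adj : ∀ u i j → nth (encode G ++ u) (suc n + toℕ i * n + toℕ j) ≡ adj G i j
    encode-adj u i j = trans (cong₂ nth (split u) (trans (ℕₚ.+-assoc (suc n) (toℕ i * n) (toℕ j)) (sym (ℕₚ.+-suc n (toℕ i * n + toℕ j)))))
      (trans (nth-after n _ (suc (toℕ i * n + toℕ j)))
        (trans (nth-concat bits len-bits (λ i → i) u i (toℕ j) (Finₚ.toℕ<n j)) (nth-map (adj G i) (λ i → i) j)))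

    encode-length : length (encode G) ≡ suc n + n * n
    encode-length = trans (Listₚ.length-++ (replicate n true)) (trans (cong₂ _+_ (Listₚ.length-replicate n) (cong suc (length-concat bits len-bits (λ i → i))))
      (ℕₚ.+-suc n (n * n)))

  module Main (r : ℕ) where
    open Programs (2 + frame r)
    open Pointers (2 + frame r)

    -- Variable 3 receives `n`, and the address of the entry `(n , 0)` is the start of the second
    -- code. `sizeP` checks that `n` ones follow there and `finalP` that a zero comes next, so the
    -- game is evaluated only for graphs of the same size.
    measureP sizeP finalP mainP : Code
    measureP = zeroV 3 ⨾ loop (bitT 3) (incV 3)
    sizeP = zeroV 1 ⨾ loop (bitT 1) (branch (bitT 0) (incV 0 ⨾ incV 1) (constT false))
    finalP = branch (bitT 0) (constT false) (gameP r false true [] [])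
    mainP = measureP ⨾ zeroV 4 ⨾ addr false 3 4 ⨾ copyV β 0 ⨾ sizeP ⨾ finalP

    finalE mainE : ℕ
    finalE = seqE 2 (gameE r [] [] ⊔ 2)
    mainE = seqE 5 (seqE 2 (seqE 14 (seqE 2 (seqE 7 (finalE ⊔ 2)))))

    private
      3≤frame : ∀ r → 3 ≤ frame r
      3≤frame zero = ℕₚ.≤-refl
      3≤frame (suc r) = ℕₚ.≤-trans (3≤frame r) (ℕₚ.m≤n+m (frame r) 4)

      5≤β : 5 ≤ β
      5≤β = ℕₚ.+-monoʳ-≤ 2 (3≤frame r)

      var : ∀ {v} → v ≤ 4 → v < K
      var l = s≤s (ℕₚ.≤-trans l (ℕₚ.≤-trans (ℕₚ.n≤1+n 4) 5≤β))

      ≢β : ∀ {v} → v ≤ 4 → v ≢ β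
      ≢β l refl = ℕₚ.<⇒≱ 5≤β l

    module Decide (w : List Bool) (n m Bs : ℕ) (n<N : n < length w) (pre : ∀ p → p < n → nth w p ≡ true) (end : nth w n ≡ false)
      (Bs-def : Bs ≡ suc n + n * n) (pre' : ∀ p → p < m → nth w (Bs + p) ≡ true) (end' : nth w (Bs + m) ≡ false) where
      open OnWord w
      open Correct w n n<N pre end

      -- Read from the word, so that it is defined before the sizes have been compared. On side
      -- `true` it is shown to be the adjacency of the second graph once they agree.
      α : Bool → ℕ → ℕ → Bool
      α s i j = nth w (suc ((if s then Bs else 0) + n) + i * n + j)
      open NatGame n α

      Answer : Bool → Set
      Answer b = (b ≡ true → n ≡ m × eqv r false true [] [] ≡ true) × (n ≡ m → eqv r false true [] [] ≡ true → b ≡ true)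

      Gives : Code → State → ℕ → Set
      Gives p σ a = ∃ λ b → ∃ λ σ' → Exec p σ a b σ' × Answer b

      gives-seq : ∀ {p q σ a b Q} → Achieves p σ a Q → (∀ σ' → Q σ' → Gives q σ' b) → Gives (p ⨾ q) σ (seqE a b)
      gives-seq (σ' , e , h) k = let (b , σ″ , f , g) = k σ' h in b , σ″ , exec-branch-true e f , g

      private
        3≤β : 3 ≤ β
        3≤β = ℕₚ.≤-trans (s≤s (s≤s (s≤s z≤n))) 5≤β

        At₁ : State → Set
        At₁ σ = σ β ≡ Bs × σ 0 ≡ Bs

        measure : ∀ σ → Achieves measureP σ 5 λ σ' → σ' 3 ≡ n
        measure σ = achieve-seq {zeroV 3} {loop (bitT 3) (incV 3)} {a = 2} {4} {Q = _≡ upd σ 3 0} (_ , exec-zero σ 3 , refl) λ { _ refl →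
          achieve-while (bitT 3) (incV 3) 2 n (ℕₚ.<⇒≤ n<N) ℕₚ.≤-refl (λ j σ' → σ' 3 ≡ j)
            (λ j σ' j<n e → proj₁ (bit-test 3≤β 3 (var (ℕₚ.n≤1+n 3))) j σ' j<n e ,
              (_ , exec-inc σ' 3 (var (ℕₚ.n≤1+n 3)) , trans (upd-same σ' 3 _) (cong suc e)))
            (λ σ' e → proj₂ (bit-test 3≤β 3 (var (ℕₚ.n≤1+n 3))) σ' e) _ (upd-same σ 3 0) }

        final : ∀ σ → σ β ≡ Bs → σ 0 ≡ Bs + n → n ≤ m → Gives finalP σ finalE
        final σ eβ e0 n≤m with n ℕₚ.≟ m
        ... | no ne = false , σ , exec-branch-true {a = 2} {a' = gameE r [] [] ⊔ 2} (subst (λ b → Exec (bitT 0) σ 2 b σ) (trans (cong (nth w) e0) (pre' n (ℕₚ.≤∧≢⇒< n≤m ne))) (exec-bit σ 0 (var z≤n)))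
                  (exec-pow (ℕₚ.m≤n⊔m (gameE r [] []) 2) (exec-const σ false)) , (λ ()) , (λ e → ⊥-elim (ne e))
        ... | yes refl with game-computes 3≤β α Bs (λ _ _ _ _ _ → refl) r false true [] [] σ (ℕₚ.m≤n+m (frame r) 2) eβ [] []
        ... | σ' , e , _ = eqv r false true [] [] , σ' , exec-branch-false {a = 2} {a' = gameE r [] [] ⊔ 2}
                  (subst (λ b → Exec (bitT 0) σ 2 b σ) (trans (cong (nth w) e0) end') (exec-bit σ 0 (var z≤n)))
                  (exec-pow (ℕₚ.m≤m⊔n (gameE r [] []) 2) e) , (λ e → refl , e) , (λ _ e → e)

        sizes : ∀ σ → At₁ σ → Gives (sizeP ⨾ finalP) σ (seqE 7 (finalE ⊔ 2))
        sizes σ (eβ , e0) = case exec-loop (bitT 1) body 4 n (ℕₚ.<⇒≤ n<N) I (λ _ → m < n) go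
              (λ σ' (e , _) → exec-pow (s≤s (s≤s z≤n)) (proj₂ (bit-test 3≤β 1 (var (s≤s z≤n))) σ' e)) (upd σ 1 0)
              (upd-same σ 1 0 , trans (upd-other σ 0 (λ ())) (trans e0 (sym (ℕₚ.+-identityʳ Bs))) , trans (upd-other σ 0 (λ e → ≢β (s≤s z≤n) (sym e))) eβ , z≤n) of λ where
            (false , σ' , e , _ , bad) → false , σ' ,
              exec-branch-false {a = 7} {a' = finalE ⊔ 2} (exec-branch-true {a = 2} {a' = 6} (exec-zero σ 1) e) (exec-pow (ℕₚ.m≤n⊔m finalE 2) (exec-const σ' false)) ,
              (λ ()) , λ { refl → ⊥-elim (ℕₚ.<-irrefl refl (bad refl)) }
            (true , σ' , e , good , _) → let (_ , e0' , eβ' , n≤m) = good refl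
                                             (b , σ″ , f , ans) = final σ' eβ' e0' n≤m in
              b , σ″ , exec-branch-true {a = 7} {a' = finalE ⊔ 2} (exec-branch-true {a = 2} {a' = 6} (exec-zero σ 1) e) (exec-pow (ℕₚ.m≤m⊔n finalE 2) f) , ans
          where
          body : Code
          body = branch (bitT 0) (incV 0 ⨾ incV 1) (constT false)
          I : ℕ → State → Set
          I i σ' = σ' 1 ≡ i × σ' 0 ≡ Bs + i × σ' β ≡ Bs × i ≤ m
          go : ∀ i σ' → i < n → I i σ' → ∃ λ b → ∃ λ σ″ → ∃ λ σ₁ → Exec (bitT 1) σ' 4 true σ₁ × Exec body σ₁ 4 b σ″ × (b ≡ true → I (suc i) σ″) × (b ≡ false → m < n)
          go i σ' i<n (e1 , e0 , eβ , i≤m) with i ℕₚ.≟ m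
          ... | yes refl = false , σ' , σ' , exec-pow (s≤s (s≤s z≤n)) (proj₁ (bit-test 3≤β 1 (var (s≤s z≤n))) i σ' i<n e1) ,
                exec-branch-false {a = 2} {a' = 3} (subst (λ b → Exec (bitT 0) σ' 2 b σ') (trans (cong (nth w) e0) end') (exec-bit σ' 0 (var z≤n)))
                  (exec-pow (s≤s (s≤s z≤n)) (exec-const σ' false)) , (λ ()) , λ _ → i<n
          ... | no ne = true , _ , σ' , exec-pow (s≤s (s≤s z≤n)) (proj₁ (bit-test 3≤β 1 (var (s≤s z≤n))) i σ' i<n e1) ,
                exec-branch-true {a = 2} {a' = 3} (subst (λ b → Exec (bitT 0) σ' 2 b σ') (trans (cong (nth w) e0) (pre' i (ℕₚ.≤∧≢⇒< i≤m ne))) (exec-bit σ' 0 (var z≤n)))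
                  (exec-branch-true {a = 2} {a' = 2} (exec-inc σ' 0 (var z≤n)) (exec-inc _ 1 (var (s≤s z≤n)))) ,
                (λ _ → trans (upd-same _ 1 _) (cong suc (trans (upd-other σ' _ (λ ())) e1)) ,
                       trans (upd-other _ _ (λ ())) (trans (upd-same σ' 0 _) (trans (cong suc e0) (sym (ℕₚ.+-suc Bs i)))) ,
                       trans (upd-other _ _ (λ e → ≢β (s≤s z≤n) (sym e))) (trans (upd-other σ' _ (λ e → ≢β z≤n (sym e))) eβ) ,
                       ℕₚ.≤∧≢⇒< i≤m ne) , λ ()

      abstract
        decides : ∀ σ → Gives mainP σ mainE
        decides σ =
          gives-seq {a = 5} (measure σ) λ σ₁ e₃ →
          gives-seq {a = 2} {Q = λ σ₂ → σ₂ 3 ≡ n × σ₂ 4 ≡ 0} (_ , exec-zero σ₁ 4 , trans (upd-other σ₁ 0 (λ ())) e₃ , upd-same σ₁ 4 0) λ σ₂ (e₃ , e₄) →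
          gives-seq {a = 14} (addr-correct 3≤β false 3 4 σ₂ ℕₚ.≤-refl (ℕₚ.n≤1+n 3) (var (ℕₚ.n≤1+n 3)) (var ℕₚ.≤-refl)
              (subst (_< N) (sym e₃) n<N) (subst (_< N) (sym e₄) (ℕₚ.≤-<-trans z≤n n<N))) λ σ₃ (e₀ , _) →
          let e₀' = trans e₀ (trans (cong₂ (λ a b → suc n + a * n + b) e₃ e₄) (trans (ℕₚ.+-identityʳ (suc n + n * n)) (sym Bs-def))) in
          gives-seq {a = 2} {Q = At₁} (_ , exec-copy σ₃ β 0 (var z≤n) , trans (upd-same σ₃ β _) e₀' , trans (upd-other σ₃ _ (≢β z≤n)) e₀') λ σ₄ at →
          sizes σ₄ at

    -- The value `length w` points just behind the last cell, so the untouched input represents a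
    -- state without any flags.
    start-rep : ∀ w → OnWord.Rep w (λ _ → length w) (onR [] (map bitSym w))
    start-rep w = [] , [] , inj₁ refl , inj₁ refl , cong (onR []) (sym (trans (Listₚ.++-identityʳ _) (plain w 0 refl)))
      where
      open OnWord w
      open Sweep K
      blankFlags : ∀ p → p < N → flags (λ _ → N) p ≡ Vec.replicate K false
      blankFlags p l = trans (Vecₚ.tabulate-cong λ _ → ≡ᵇ-false (λ e → ℕₚ.<⇒≢ l (sym e))) (const-replicate K)
        where
        const-replicate : ∀ k → Vec.tabulate {n = k} (λ _ → false) ≡ Vec.replicate k false
        const-replicate zero = refl
        const-replicate (suc k) = cong (false ∷_) (const-replicate k)
      plain : ∀ u p → p + length u ≡ N → map enc (cells u (λ _ → N) p) ≡ map bitSym u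
      plain [] p e = refl
      plain (b ∷ u) p e = cong₂ _∷_ (trans (cong (λ fs → enc (fs , b)) (blankFlags p (subst (p <_) e (ℕₚ.m<m+n p (s≤s z≤n))))) (code-plain K b))
        (plain u (suc p) (trans (sym (ℕₚ.+-suc p (length u))) e))

  module Decision (r : ℕ) (game-iso : ∀ (Γ Δ : FreeGraph) → Game (gr Γ) (gr Δ) r [] [] → Iso (gr Γ) (gr Δ)) where
    open Main r
    open Pointers (2 + frame r) using (compile)

    M : TM
    M = toTM (compile mainP)

    -- `X` is at most `N * N`, as both codes are non-empty, so the running time is at most
    -- `N ^ (2 * mainE)`. The successor makes `c` positive, since it is also used as the factor.
    c : ℕ
    c = suc (2 * mainE)

    module Correctness (G G' : Graph) (free : Free₂ F (P 5) G) (free' : Free₂ F (P 5) G') where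
      w : List Bool
      w = encode G ++ encode G'
      n m Bs : ℕ
      n = size G
      m = size G'
      Bs = length (encode G)
      open Encoding
      open Pointers.OnWord (2 + frame r) w

      N-def : N ≡ Bs + length (encode G')
      N-def = Listₚ.length-++ (encode G)

      in-second : ∀ p → nth w (Bs + p) ≡ nth (encode G' ++ []) p
      in-second p = trans (nth-++ (encode G) (encode G') p) (cong (λ u → nth u p) (sym (Listₚ.++-identityʳ (encode G'))))

      n<N : n < N
      n<N = ℕₚ.≤-trans (s≤s (ℕₚ.m≤m+n n (n * n))) (ℕₚ.≤-trans (ℕₚ.≤-reflexive (sym (encode-length G))) (ℕₚ.≤-trans (ℕₚ.m≤m+n Bs _) (ℕₚ.≤-reflexive (sym N-def))))

      2≤N : 2 ≤ N
      2≤N = ℕₚ.≤-trans (ℕₚ.+-mono-≤ {1} {Bs} {1} (one G) (one G')) (ℕₚ.≤-reflexive (sym N-def))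
        where
        one : ∀ G → 1 ≤ length (encode G)
        one G = ℕₚ.≤-trans (s≤s z≤n) (ℕₚ.≤-reflexive (sym (encode-length G)))

      open Decide w n m Bs n<N (encode-one G (encode G')) (encode-zero G (encode G')) (encode-length G)
        (λ p l → trans (in-second p) (encode-one G' [] p l)) (trans (in-second m) (encode-zero G' []))

      Γ Δ : FreeGraph
      Γ = record { gr = G ; noF = proj₁ free ; noP5 = proj₂ free }
      Δ = record { gr = G' ; noF = proj₁ free' ; noP5 = proj₂ free' }

      graphs : Bool → Graph
      graphs false = G
      graphs true = G'

      position : n ≡ m → ∀ i j → suc (Bs + n) + i * n + j ≡ Bs + (suc m + i * m + j)
      position n≡m i j rewrite sym n≡m = trans (cong (λ z → z + i * n + j) (sym (ℕₚ.+-suc Bs n)))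
        (trans (cong (_+ j) (ℕₚ.+-assoc Bs (suc n) (i * n))) (ℕₚ.+-assoc Bs (suc n + i * n) j))

      sizes-n : n ≡ m → ∀ s → size (graphs s) ≡ n
      sizes-n e false = refl
      sizes-n e true = sym e

      α-adj : n ≡ m → ∀ s i j → α s (toℕ i) (toℕ j) ≡ adj (graphs s) i j
      α-adj e false i j = encode-adj G (encode G') i j
      α-adj e true i j = trans (cong (nth w) (position e (toℕ i) (toℕ j))) (trans (in-second _) (encode-adj G' [] i j))

      module Linked (n≡m : n ≡ m) = Link n α graphs (sizes-n n≡m) (α-adj n≡m)

      same-size : Iso G G' → n ≡ m
      same-size (φ , _) = ↔⇒≡ φ

      enough : X ^ mainE < c * N ^ c + c
      enough = ℕₚ.≤-<-trans (ℕₚ.≤-trans square (ℕₚ.m≤m+n (N ^ c) (2 * mainE * N ^ c))) (ℕₚ.m<m+n (c * N ^ c) (s≤s z≤n))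
        where
        X≤N² : X ≤ N * N
        X≤N² = ℕₚ.≤-trans (ℕₚ.+-monoˡ-≤ N 2≤N) (ℕₚ.≤-trans (ℕₚ.≤-reflexive (cong (N +_) (sym (ℕₚ.+-identityʳ N)))) (ℕₚ.*-monoˡ-≤ N 2≤N))
        square : X ^ mainE ≤ N ^ c
        square = ℕₚ.≤-trans (ℕₚ.^-monoˡ-≤ mainE (ℕₚ.≤-trans X≤N² (ℕₚ.≤-reflexive (cong (N *_) (sym (ℕₚ.*-identityʳ N))))))
          (ℕₚ.≤-trans (ℕₚ.≤-reflexive (ℕₚ.^-*-assoc N 2 mainE))
          (ℕₚ.≤-trans (ℕₚ.≤-reflexive (sym (ℕₚ.+-identityʳ (N ^ (2 * mainE))))) (ℕₚ.*-monoˡ-≤ (N ^ (2 * mainE)) {1} {N} (ℕₚ.≤-trans (s≤s z≤n) 2≤N))))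

      init : ∀ u → initConfig M u ≡ conf (compile mainP) zero (onR [] (map bitSym u))
      init [] = refl
      init (b ∷ u) = refl

      Correct-in : ℕ → Set
      Correct-in T = Σ Bool λ b → HaltsWith M w T b × ((b ≡ true → Iso G G') × (Iso G G' → b ≡ true))

      module _ (T : ℕ) (T-big : X ^ mainE < T) {b : Bool} {t : Tape} {k : ℕ} (k≤ : k ≤ X ^ mainE)
        (run-t : Run (compile mainP) zero (onR [] (map bitSym w)) k b t) where
        halts : HaltsWith M w T b
        halts = trans (cong (run M T) (init w)) (subst (λ j → run M j (conf (compile mainP) zero (onR [] (map bitSym w))) ≡ just b)
          (trans (ℕₚ.+-suc k (T ∸ suc k)) (ℕₚ.m+[n∸m]≡n (ℕₚ.≤-<-trans k≤ T-big))) (run-prog (compile mainP) run-t (T ∸ suc k)))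

      answer : ∀ {b} → Answer b → (b ≡ true → Iso G G') × (Iso G G' → b ≡ true)
      answer (yes⇒ , ⇐yes) = (λ p → let (q , g) = yes⇒ p in game-iso Γ Δ (Linked.sound q r false true [] [] g)) ,
        λ φ → ⇐yes (same-size φ) (Linked.complete (same-size φ) r false true [] [] (iso⇒game φ r))

      correct-in : ∀ T → X ^ mainE < T → Gives mainP (λ _ → N) mainE → Correct-in T
      correct-in T big (b , σ' , e , ans) = let (t , k , k≤ , run-t , _) = runs (execN e) (start-rep w) in b , halts T big k≤ run-t , answer ans

      result : Correct-in (c * length w ^ c + c)
      result = correct-in (c * length w ^ c + c) enough (decides (λ _ → N))

    decision : GI-PolyOn F (P 5)
    decision = M , c , Correctness.result

open GameToIso using (gameRounds; game⇒iso)
open Deciding using (module Decision)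

theorem3 : GI-PolyOn (co ((P 1 ⊕ P 1) ⊕ P 3)) (P 5)
theorem3 = Decision.decision gameRounds game⇒iso
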